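{- Let $T$ be a hereditarily G-compact theory with monster model $\mathfrak C$, let $A\subseteq\mathfrak C$ be a small set, and let $G$ be a group definable in $\mathfrak C$ over $A$. Then $G^{00}_A=G^{000}_A$. In particular, if $T$ has NIP, then $G^{00}=G^{000}$.
   Context: Theories are complete first-order theories; structures may be many-sorted (possibly with infinitely many sorts). An interpreted structure $N$ may be many-sorted: each of its sorts is a definable set modulo a definable equivalence relation, and its basic relations and functions are definable in the interpreting structure, where parameters are allowed. Lascar distance: let $\mathfrak C$ be a monster model of a theory. For small (possibly infinite) tuples $a,b\in\mathfrak C$ write $d_L(a,b)\le n$ if there are tuples $a=a_0,a_1,\dots,a_n=b$ and small $M_1,\dots,M_n\preceq\mathfrak C$ such that $\operatorname{tp}(a_{i-1}/M_i)=\operatorname{tp}(a_i/M_i)$ for $i=1,\dots,n$. $d_L(a,b)$ is the least such $n$, or $\infty$ if there is none. A theory is G-compact if for every tuple $a$ there is an integer $n$ such that for all $b$, $d_L(a,b)<\infty$ implies $d_L(a,b)\le n$. A theory $T$ is hereditarily G-compact if for every model $M\models T$ and every structure $N$ interpreted by $M$ (with parameters), $\operatorname{Th}(N)$ is G-compact. Connected components: for $G$ definable over a small set $A$, identified with $G(\mathfrak C)$, $G^{000}_A$ is the smallest subgroup of $G$ which is invariant under $\operatorname{Aut}(\mathfrak C/A)$ and has small index in $G$ (i.e. index at most $2^{|T|+|A|}$); $G^{00}_A$ is the smallest subgroup of $G$ which is type-definable with parameters in $A$ and has small index. If $G^{000}_A$ (respectively $G^{00}_A$) does not depend on the choice of the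 small set $A$ over which $G$ is definable, it is denoted by $G^{000}$ (respectively $G^{00}$) and is said to exist. It is known that if $T$ has NIP, then $G^{00}$ and $G^{000}$ exist. -}

module Defs where

open import Algebra.Bundles using (Group)
open import Algebra.Structures using (IsGroup)
open import Axiom.ExcludedMiddle using (ExcludedMiddle)
open import Axiom.Extensionality.Propositional using (Extensionality)
open import Data.Bool.Base using (Bool; true)
open import Data.Empty using (⊥)
open import Data.Fin.Base using (Fin)
open import Data.List.Base using (List)
open import Data.List.Relation.Unary.All using (All)
open import Data.Maybe.Base using (Maybe; just; nothing; maybe′)
open import Data.Nat.Base using (ℕ; zero; suc)
open import Data.Product.Base using (Σ; Σ-syntax; ∃; ∃-syntax; _×_; _,_; proj₁; proj₂)
open import Data.Sum.Base using (_⊎_; [_,_]; [_,_]′)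
open import Data.Sum.Relation.Binary.Pointwise using (_⊎ₛ_)
open import Data.Unit.Base using (⊤)
open import Function.Bundles using (_⇔_; Func; Injection; Inverse)
open import Level using (Level; Lift; lower; Setω; _⊔_) renaming (suc to lsuc)
open import Relation.Binary.Bundles using (Setoid)
open import Relation.Binary.PropositionalEquality.Core using (_≡_)
open import Relation.Binary.PropositionalEquality.Properties using (setoid)
open import Relation.Nullary using (¬_)
open import Relation.Unary using (Pred; _⊆_)
import Algebra.Properties.Group as GroupProperties
import Function.Relation.Binary.Setoid.Equality as FuncEq
import Relation.Binary.Construct.On as On
import Relation.Binary.Reasoning.Setoid as SetoidReasoning

private variable
  ℓ : Level

-- The classical metatheory.  `ExcludedMiddle` ranges over all types, not
-- only propositions, so it is also a choice operator; function
-- extensionality makes it respect equality of Bool-valued predicates, which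
-- is what choosing representatives of equivalence classes requires.

record Classical : Setω where
  field
    excludedMiddle : ∀ {a} → ExcludedMiddle a
    extensionality : ∀ {a b} → Extensionality a b

-- A setoid stands for the cardinality of its quotient.

Cardinal : ∀ ℓ → Set (lsuc ℓ)
Cardinal ℓ = Setoid ℓ ℓ

infix 4 _≤ᶜ_ _<ᶜ_

_≤ᶜ_ : Cardinal ℓ → Cardinal ℓ → Set ℓ
X ≤ᶜ Y = Injection X Y

_<ᶜ_ : Cardinal ℓ → Cardinal ℓ → Set ℓ
X <ᶜ Y = X ≤ᶜ Y × ¬ (Y ≤ᶜ X)

2^_ : Cardinal ℓ → Cardinal ℓ
2^ X = FuncEq.setoid X (setoid Bool)

StrongLimit : Cardinal ℓ → Set (lsuc ℓ)
StrongLimit κ = ∀ X → X <ᶜ κ → 2^ X <ᶜ κ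

Arity : Set ℓ → Set ℓ
Arity S = Σ[ n ∈ ℕ ] (Fin n → S)

record Signature ℓ : Set (lsuc ℓ) where
  field
    Sort     : Set ℓ
    FunSym   : Set ℓ
    dom      : FunSym → Arity Sort
    cod      : FunSym → Sort
    RelSym   : Set ℓ
    relArity : RelSym → Arity Sort

open Signature public

-- A possibly infinite family of sorted variables.

record Vars {ℓ} (S : Set ℓ) : Set (lsuc ℓ) where
  constructor vars
  field
    Var    : Set ℓ
    sortOf : Var → S

open Vars public

private variable
  L : Signature ℓ
  S : Set ℓ
  s : S
  V W : Vars S

fin : Arity S → Vars S
fin (n , σ) = vars (Lift _ (Fin n)) (λ i → σ (lower i))

∅ᵛ : Vars S
∅ᵛ = vars (Lift _ ⊥) (λ ())

single : S → Vars S
single s = vars (Lift _ ⊤) (λ _ → s)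

infixl 6 _⊕_ _▷_

_⊕_ : Vars S → Vars S → Vars S
V ⊕ W = vars (Var V ⊎ Var W) [ sortOf V , sortOf W ]′

_▷_ : Vars S → S → Vars S
V ▷ s = vars (Maybe (Var V)) (maybe′ (sortOf V) s)

⨁ : {I S : Set ℓ} → (I → Vars S) → Vars S
⨁ V = vars (Σ[ i ∈ _ ] Var (V i)) (λ (i , v) → sortOf (V i) v)

data Term {ℓ} (L : Signature ℓ) (V : Vars (Sort L)) : Sort L → Set ℓ where
  var : (v : Var V) → Term L V (sortOf V v)
  app : (f : FunSym L) →
        ((i : Var (fin (dom L f))) → Term L V (sortOf (fin (dom L f)) i)) →
        Term L V (cod L f)

infixr 5 _⇒ᶠ_
infix  6 _≐ᶠ_

data Formula {ℓ} (L : Signature ℓ) (V : Vars (Sort L)) : Set ℓ where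
  _≐ᶠ_ : {s : Sort L} → Term L V s → Term L V s → Formula L V
  rel  : (r : RelSym L) →
         ((i : Var (fin (relArity L r))) → Term L V (sortOf (fin (relArity L r)) i)) →
         Formula L V
  ⊥ᶠ   : Formula L V
  _⇒ᶠ_ : Formula L V → Formula L V → Formula L V
  ∀ᶠ   : (s : Sort L) → Formula L (V ▷ s) → Formula L V

¬ᶠ_ : {V : Vars (Sort L)} → Formula L V → Formula L V
¬ᶠ φ = φ ⇒ᶠ ⊥ᶠ

Sentence : Signature ℓ → Set ℓ
Sentence L = Formula L ∅ᵛ

Theory : Signature ℓ → Set (lsuc ℓ)
Theory {ℓ} L = Pred (Sentence L) ℓ

-- |T| = |L| + ℵ₀, where sorts count as symbols.

∣_∣ᵀ : {L : Signature ℓ} → Theory L → Cardinal ℓ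
∣_∣ᵀ {L = L} T = setoid (ℕ ⊎ Sort L ⊎ FunSym L ⊎ RelSym L)

-- Carriers are setoids because interpreted structures are quotients.

Carriers : Set ℓ → Set (lsuc ℓ)
Carriers {ℓ} S = S → Setoid ℓ ℓ

record TupleOf {ℓ} {S : Set ℓ} (C : Carriers S) (V : Vars S) : Set ℓ where
  constructor tuple
  field
    at : (v : Var V) → Setoid.Carrier (C (sortOf V v))

open TupleOf public

infix 4 _≋_

_≋_ : {S : Set ℓ} {C : Carriers S} {V : Vars S} → TupleOf C V → TupleOf C V → Set ℓ
_≋_ {C = C} {V = V} x y = ∀ v → Setoid._≈_ (C (sortOf V v)) (at x v) (at y v)

infixl 6 _⋈_ _⋈₁_

_⋈_ : {C : Carriers S} → TupleOf C V → TupleOf C W → TupleOf C (V ⊕ W)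
x ⋈ y = tuple [ at x , at y ]

_⋈₁_ : {C : Carriers S} → TupleOf C V → Setoid.Carrier (C s) → TupleOf C (V ▷ s)
at (x ⋈₁ e) (just v) = at x v
at (x ⋈₁ e) nothing  = e

record Structure {ℓ} (L : Signature ℓ) : Set (lsuc ℓ) where
  field
    carrier : Carriers (Sort L)
    fun     : (f : FunSym L) → TupleOf carrier (fin (dom L f)) →
              Setoid.Carrier (carrier (cod L f))
    fun-cong : ∀ f {x y} → x ≋ y →
               Setoid._≈_ (carrier (cod L f)) (fun f x) (fun f y)
    relation : (r : RelSym L) → TupleOf carrier (fin (relArity L r)) → Set ℓ
    relation-resp : ∀ r {x y} → x ≋ y →
                    relation r x → relation r y

open Structure public

∥_∥ : {L : Signature ℓ} → Structure L → Sort L → Set ℓ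
∥ M ∥ s = Setoid.Carrier (carrier M s)

Eq : {L : Signature ℓ} (M : Structure L) {s : Sort L} → ∥ M ∥ s → ∥ M ∥ s → Set ℓ
Eq M {s} = Setoid._≈_ (carrier M s)

infix 4 Eq
syntax Eq M x y = x ≈[ M ] y

Tuple : {L : Signature ℓ} → Structure L → Vars (Sort L) → Set ℓ
Tuple M = TupleOf (carrier M)

eval : {L : Signature ℓ} (M : Structure L) {V : Vars (Sort L)} → Tuple M V →
       {s : Sort L} → Term L V s → ∥ M ∥ s
eval M x (var v)    = at x v
eval M x (app f ts) = fun M f (tuple (λ i → eval M x (ts i)))

infix 4 _⊨_[_] _⊨ᵀ_ _⊩_

_⊨_[_] : {L : Signature ℓ} (M : Structure L) {V : Vars (Sort L)} → Formula L V → Tuple M V → Set ℓ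
M ⊨ t ≐ᶠ u [ x ]   = eval M x t ≈[ M ] eval M x u
M ⊨ rel r ts [ x ] = relation M r (tuple (λ i → eval M x (ts i)))
M ⊨ ⊥ᶠ [ x ]       = Lift _ ⊥
M ⊨ φ ⇒ᶠ ψ [ x ]   = M ⊨ φ [ x ] → M ⊨ ψ [ x ]
M ⊨ ∀ᶠ s φ [ x ]   = (e : ∥ M ∥ s) → M ⊨ φ [ x ⋈₁ e ]

Th : Structure L → Theory L
Th M φ = M ⊨ φ [ tuple (λ ()) ]

_⊨ᵀ_ : {L : Signature ℓ} → Structure L → Theory L → Set ℓ
M ⊨ᵀ T = T ⊆ Th M

_⊩_ : {L : Signature ℓ} → Theory L → Sentence L → Set (lsuc ℓ)
T ⊩ φ = ∀ M → M ⊨ᵀ T → Th M φ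

Complete : {L : Signature ℓ} → Theory L → Set (lsuc ℓ)
Complete T = (∃[ M ] M ⊨ᵀ T) × (∀ φ → T ⊩ φ ⊎ T ⊩ (¬ᶠ φ))

Element : {L : Signature ℓ} → Structure L → Set ℓ
Element {L = L} M = Σ[ s ∈ Sort L ] ∥ M ∥ s

data EqElement {ℓ} {L : Signature ℓ} (M : Structure L) : Element M → Element M → Set ℓ where
  same : ∀ {s} {x y : ∥ M ∥ s} → x ≈[ M ] y → EqElement M (s , x) (s , y)

elements : {L : Signature ℓ} → Structure L → Setoid ℓ ℓ
elements M = record
  { Carrier = Element M
  ; _≈_     = EqElement M
  ; isEquivalence = record
    { refl  = λ { {s , _} → same (Setoid.refl (carrier M s)) }
    ; sym   = λ { {s , _} (same p) → same (Setoid.sym (carrier M s) p) }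
    ; trans = λ { {s , _} (same p) (same q) → same (Setoid.trans (carrier M s) p q) }
    }
  }

-- A subset denotes the set of ≈-classes that it meets.

Subset : {L : Signature ℓ} → Structure L → Set (lsuc ℓ)
Subset {ℓ} M = Pred (Element M) ℓ

everything : (M : Structure L) → Subset M
everything M _ = Lift _ ⊤

∣_∋_∣ : {L : Signature ℓ} (M : Structure L) → Subset M → Cardinal ℓ
∣ M ∋ A ∣ = On.setoid {B = ∃ A} (elements M) proj₁

params : {L : Signature ℓ} (M : Structure L) → Subset M → Vars (Sort L)
params M A = vars (∃ A) (λ ((s , _) , _) → s)

enum : (M : Structure L) (A : Subset M) → Tuple M (params M A)
at (enum M A) ((_ , x) , _) = x

-- Formulas in the variables V with parameters from A.

module _ {ℓ} {L : Signature ℓ} (M : Structure L) where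

  FormulaOver : Subset M → Vars (Sort L) → Set ℓ
  FormulaOver A V = Formula L (V ⊕ params M A)

  Holds : (A : Subset M) {V : Vars (Sort L)} → FormulaOver A V → Tuple M V → Set ℓ
  Holds A φ x = M ⊨ φ [ x ⋈ enum M A ]

  SameTypeOver : (A : Subset M) {V : Vars (Sort L)} → Tuple M V → Tuple M V → Set ℓ
  SameTypeOver A {V} x y = (φ : FormulaOver A V) → Holds A φ x ⇔ Holds A φ y

  FinitelySatisfiable : (A : Subset M) {V : Vars (Sort L)} → Pred (FormulaOver A V) ℓ → Set ℓ
  FinitelySatisfiable A {V} p =
    (Φ : List (FormulaOver A V)) → All p Φ → ∃[ x ] All (λ φ → Holds A φ x) Φ

  Realized : (A : Subset M) {V : Vars (Sort L)} → Pred (FormulaOver A V) ℓ → Set ℓ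
  Realized A p = ∃[ x ] (∀ φ → p φ → Holds A φ x)

  ClosedUnderFunctions : Subset M → Set ℓ
  ClosedUnderFunctions U =
    ∀ f (x : Tuple M (fin (dom L f))) → (∀ i → U (_ , at x i)) → U (_ , fun M f x)

substructure : (M : Structure L) (U : Subset M) → ClosedUnderFunctions M U → Structure L
substructure M U closed = record
  { carrier       = λ s → On.setoid {B = Σ[ x ∈ ∥ M ∥ s ] U (s , x)} (carrier M s) proj₁
  ; fun           = λ f x → fun M f (tuple (λ i → proj₁ (at x i))) , closed f _ (λ i → proj₂ (at x i))
  ; fun-cong      = λ f p → fun-cong M f p
  ; relation      = λ r x → relation M r (tuple (λ i → proj₁ (at x i)))
  ; relation-resp = λ r p → relation-resp M r p
  }

record IsElementarySubstructure {ℓ} {L : Signature ℓ}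
       (M : Structure L) (U : Subset M) : Set (lsuc ℓ) where
  field
    closed     : ClosedUnderFunctions M U
    elementary : {V : Vars (Sort L)} (φ : Formula L V) (x : Tuple (substructure M U closed) V) →
                 substructure M U closed ⊨ φ [ x ] ⇔ M ⊨ φ [ tuple (λ v → proj₁ (at x v)) ]

record Automorphism {ℓ} {L : Signature ℓ} (M : Structure L) : Set ℓ where
  field
    bijection : ∀ s → Inverse (carrier M s) (carrier M s)

  apply : {V : Vars (Sort L)} → Tuple M V → Tuple M V
  apply x = tuple (λ v → Inverse.to (bijection _) (at x v))

  field
    preserves-fun : ∀ f x → Inverse.to (bijection _) (fun M f x) ≈[ M ] fun M f (apply x)
    preserves-rel : ∀ r x → relation M r x ⇔ relation M r (apply x)

  Fixes : Subset M → Set ℓ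
  Fixes A = apply (enum M A) ≋ enum M A

record IsMonster {ℓ} {L : Signature ℓ} (T : Theory L) (κ : Cardinal ℓ)
       (ℭ : Structure L) : Set (lsuc ℓ) where
  field
    isModel     : ℭ ⊨ᵀ T
    strongLimit : StrongLimit κ
    ∣T∣<κ       : ∣ T ∣ᵀ <ᶜ κ
    saturated   : (A : Subset ℭ) → ∣ ℭ ∋ A ∣ <ᶜ κ →
                  (s : Sort L) (p : Pred (FormulaOver ℭ A (single s)) ℓ) →
                  FinitelySatisfiable ℭ A p → Realized ℭ A p
    homogeneous : (V : Vars (Sort L)) → setoid (Var V) <ᶜ κ → (a b : Tuple ℭ V) →
                  (∀ (φ : Formula L V) → ℭ ⊨ φ [ a ] ⇔ ℭ ⊨ φ [ b ]) →
                  Σ[ σ ∈ Automorphism ℭ ] Automorphism.apply σ a ≋ b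

module _ {ℓ} {L : Signature ℓ} (κ : Cardinal ℓ) (ℭ : Structure L) where

  LascarDistance≤ : ℕ → {V : Vars (Sort L)} → Tuple ℭ V → Tuple ℭ V → Set (lsuc ℓ)
  LascarDistance≤ zero    a b = Lift (lsuc ℓ) (a ≋ b)
  LascarDistance≤ (suc n) a b =
    ∃[ M ] ∃[ a′ ]
      ∣ ℭ ∋ M ∣ <ᶜ κ × IsElementarySubstructure ℭ M ×
      SameTypeOver ℭ M a a′ × LascarDistance≤ n a′ b

GCompact : {L : Signature ℓ} → Theory L → Set (lsuc ℓ)
GCompact {L = L} T =
  ∀ κ ℭ → IsMonster T κ ℭ →
  (V : Vars (Sort L)) → setoid (Var V) <ᶜ κ → (a : Tuple ℭ V) →
  ∃[ n ] (∀ b → (∃[ m ] LascarDistance≤ κ ℭ m a b) → LascarDistance≤ κ ℭ n a b)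

-- N is interpreted in M with parameters: every sort s of N is, via `quot`,
-- the definable set `domain s` modulo the equivalence relation defined by
-- `equality s`.

record Interpretation {ℓ} {L L′ : Signature ℓ}
       (M : Structure L) (N : Structure L′) : Set ℓ where
  field
    dim    : Sort L′ → Arity (Sort L)
    domain : ∀ s → FormulaOver M (everything M) (fin (dim s))

  Domain : Sort L′ → Set ℓ
  Domain s = ∃[ x ] Holds M (everything M) (domain s) x

  field
    quot       : ∀ s → Domain s → ∥ N ∥ s
    surjective : ∀ s y → ∃[ x ] quot s x ≈[ N ] y
    equality   : ∀ s → FormulaOver M (everything M) (fin (dim s) ⊕ fin (dim s))
    equality-defines :
      ∀ s (x y : Domain s) →
      Holds M (everything M) (equality s)
        (proj₁ x ⋈ proj₁ y)
        ⇔ quot s x ≈[ N ] quot s y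

  DomainTuple : Vars (Sort L′) → Set ℓ
  DomainTuple V = (v : Var V) → Domain (sortOf V v)

  quotTuple : {V : Vars (Sort L′)} → DomainTuple V → Tuple N V
  quotTuple x = tuple (λ v → quot _ (x v))

  unfold : Vars (Sort L′) → Vars (Sort L)
  unfold V = ⨁ (λ v → fin (dim (sortOf V v)))

  flatten : {V : Vars (Sort L′)} → DomainTuple V → Tuple M (unfold V)
  flatten x = tuple (λ (v , i) → at (proj₁ (x v)) i)

  field
    graph : ∀ f → FormulaOver M (everything M) (unfold (fin (dom L′ f)) ⊕ fin (dim (cod L′ f)))
    graph-defines :
      ∀ f (x : DomainTuple (fin (dom L′ f))) (y : Domain (cod L′ f)) →
      Holds M (everything M) (graph f)
        (flatten x ⋈ proj₁ y)
        ⇔ fun N f (quotTuple x) ≈[ N ] quot _ y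
    relationFormula : ∀ r → FormulaOver M (everything M) (unfold (fin (relArity L′ r)))
    relation-defines :
      ∀ r (x : DomainTuple (fin (relArity L′ r))) →
      Holds M (everything M) (relationFormula r) (flatten x)
        ⇔ relation N r (quotTuple x)

HereditarilyGCompact : {L : Signature ℓ} → Theory L → Set (lsuc ℓ)
HereditarilyGCompact {ℓ} T =
  ∀ M → M ⊨ᵀ T → (L′ : Signature ℓ) (N : Structure L′) →
  Interpretation M N → GCompact (Th N)

IndependenceProperty : {L : Signature ℓ} (M : Structure L) (m n : Arity (Sort L)) →
                       Formula L (fin m ⊕ fin n) → Set ℓ
IndependenceProperty M m n φ =
  ∀ k → Σ[ a ∈ (Fin k → Tuple M (fin m)) ] Σ[ b ∈ ((Fin k → Bool) → Tuple M (fin n)) ]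
    (∀ i I → M ⊨ φ [ a i ⋈ b I ] ⇔ I i ≡ true)

NIP : {L : Signature ℓ} → Theory L → Set (lsuc ℓ)
NIP T = ∀ M → M ⊨ᵀ T → ∀ m n φ → ¬ IndependenceProperty M m n φ

record GroupIn {ℓ} {L : Signature ℓ} (ℭ : Structure L) : Set (lsuc ℓ) where
  infix  8 _⁻¹
  infixl 7 _∙_
  infix  4 _≈_
  field
    arity  : Arity (Sort L)
    Member : Pred (Tuple ℭ (fin arity)) ℓ

  Elt : Set ℓ
  Elt = ∃ Member

  _≈_ : Elt → Elt → Set ℓ
  g ≈ h = proj₁ g ≋ proj₁ h

  field
    _∙_     : Elt → Elt → Elt
    ε       : Elt
    _⁻¹     : Elt → Elt
    isGroup : IsGroup _≈_ _∙_ ε _⁻¹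

  group : Group ℓ ℓ
  group = record { isGroup = isGroup }

record DefinableOver {ℓ} {L : Signature ℓ} {ℭ : Structure L}
       (G : GroupIn ℭ) (A : Subset ℭ) : Set ℓ where
  open GroupIn G
  field
    member         : FormulaOver ℭ A (fin arity)
    member-defines : ∀ x → Holds ℭ A member x ⇔ Member x
    product        : FormulaOver ℭ A (fin arity ⊕ fin arity ⊕ fin arity)
    product-defines :
      ∀ g h k →
      Holds ℭ A product
        (proj₁ g ⋈ proj₁ h ⋈ proj₁ k)
        ⇔ g ∙ h ≈ k

record IsSubgroup {c ℓ} (G : Group c ℓ) {p} (H : Pred (Group.Carrier G) p) : Set (c ⊔ ℓ ⊔ p) where
  open Group G
  field
    resp      : ∀ {x y} → x ≈ y → H x → H y
    ε-closed  : H ε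
    ∙-closed  : ∀ {x y} → H x → H y → H (x ∙ y)
    ⁻¹-closed : ∀ {x} → H x → H (x ⁻¹)

-- The set G/H of left cosets, x and y being identified when x⁻¹y ∈ H.

cosets : ∀ {c ℓ p} (G : Group c ℓ) (H : Pred (Group.Carrier G) p) → IsSubgroup G H → Setoid c p
cosets G H isSub = record
  { Carrier = Carrier
  ; _≈_     = λ x y → H (x ⁻¹ ∙ y)
  ; isEquivalence = record
    { refl  = λ {x} → resp (sym (inverseˡ x)) ε-closed
    ; sym   = λ {x} {y} p → resp (sym-lemma x y) (⁻¹-closed p)
    ; trans = λ {x} {y} {z} p q → resp (trans-lemma x y z) (∙-closed p q)
    }
  }
  where
  open Group G
  open GroupProperties G
  open IsSubgroup isSub
  open SetoidReasoning (Group.setoid G)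

  sym-lemma : ∀ x y → (x ⁻¹ ∙ y) ⁻¹ ≈ y ⁻¹ ∙ x
  sym-lemma x y = begin
    (x ⁻¹ ∙ y) ⁻¹     ≈⟨ ⁻¹-anti-homo-∙ (x ⁻¹) y ⟩
    y ⁻¹ ∙ (x ⁻¹) ⁻¹  ≈⟨ ∙-congˡ (⁻¹-involutive x) ⟩
    y ⁻¹ ∙ x          ∎

  trans-lemma : ∀ x y z → (x ⁻¹ ∙ y) ∙ (y ⁻¹ ∙ z) ≈ x ⁻¹ ∙ z
  trans-lemma x y z = begin
    (x ⁻¹ ∙ y) ∙ (y ⁻¹ ∙ z)  ≈⟨ assoc (x ⁻¹) y (y ⁻¹ ∙ z) ⟩
    x ⁻¹ ∙ (y ∙ (y ⁻¹ ∙ z))  ≈⟨ ∙-congˡ (assoc y (y ⁻¹) z) ⟨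
    x ⁻¹ ∙ ((y ∙ y ⁻¹) ∙ z)  ≈⟨ ∙-congˡ (∙-congʳ (inverseʳ y)) ⟩
    x ⁻¹ ∙ (ε ∙ z)           ≈⟨ ∙-congˡ (identityˡ z) ⟩
    x ⁻¹ ∙ z                 ∎

module Components {ℓ} {L : Signature ℓ} (T : Theory L) (κ : Cardinal ℓ)
                  (ℭ : Structure L) (G : GroupIn ℭ) where
  open GroupIn G
  open Automorphism

  SmallIndex : (A : Subset ℭ) (H : Pred Elt ℓ) → IsSubgroup group H → Set ℓ
  SmallIndex A H isSub = cosets group H isSub ≤ᶜ 2^ (∣ T ∣ᵀ ⊎ₛ ∣ ℭ ∋ A ∣)

  Invariant : (A : Subset ℭ) → Pred Elt ℓ → Set ℓ
  Invariant A H =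
    (σ : Automorphism ℭ) → Fixes σ A →
    ∀ g h → apply σ (proj₁ g) ≋ proj₁ h → H g → H h

  TypeDefinable : (A : Subset ℭ) → Pred Elt ℓ → Set (lsuc ℓ)
  TypeDefinable A H =
    Σ[ p ∈ Pred (FormulaOver ℭ A (fin arity)) ℓ ]
      (∀ g → H g ⇔ (∀ φ → p φ → Holds ℭ A φ (proj₁ g)))

  record IsSmallestSubgroup {q} (A : Subset ℭ) (Q : Pred (Pred Elt ℓ) q) (H : Pred Elt ℓ) : Set (lsuc ℓ ⊔ q) where
    field
      isSubgroup : IsSubgroup group H
      smallIndex : SmallIndex A H isSubgroup
      property   : Q H
      smallest   : ∀ K (isSub : IsSubgroup group K) → SmallIndex A K isSub → Q K → H ⊆ K

  IsG⁰⁰⁰[_] IsG⁰⁰[_] : Subset ℭ → Pred Elt ℓ → Set (lsuc ℓ)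
  IsG⁰⁰⁰[ A ] = IsSmallestSubgroup A (Invariant A)
  IsG⁰⁰[ A ]  = IsSmallestSubgroup A (TypeDefinable A)

  -- H is the component over every small set over which G is definable; such
  -- an H exists exactly when the component does not depend on that set.

  IsG⁰⁰⁰ IsG⁰⁰ : Pred Elt ℓ → Set (lsuc ℓ)
  IsG⁰⁰⁰ H = ∀ A → ∣ ℭ ∋ A ∣ <ᶜ κ → DefinableOver G A → IsG⁰⁰⁰[ A ] H
  IsG⁰⁰ H  = ∀ A → ∣ ℭ ∋ A ∣ <ᶜ κ → DefinableOver G A → IsG⁰⁰[ A ] H

{-# OPTIONS --safe #-}

-- Call a set θ ⊆ G definable over A thick if it is symmetric and there is a bound on the length of sequences
-- whose quotients x⁻¹y, x before y, all avoid θ.  By Ramsey's theorem thick sets are closed under finite intersections;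
-- let P be the intersection of all of them.  If g ∈ P then, by compactness, there are arbitrarily long families
-- whose quotients all have the type of g or g⁻¹ over A, so by the pigeonhole principle P lies in every A-invariant
-- subgroup of small index.  Conversely a finite maximal antichain for each thick set shows that the subgroup
-- generated by P has index at most 2^(|T|+|A|): this subgroup is G⁰⁰⁰_A.
--
-- Let N be G as a torsor over itself, which is interpreted in ℭ over A and is a monster model of its theory.  Two
-- elements of N with the same type over a model differ by an element of P², and x and xg have the same type over
-- some small model if g ∈ P.  Hence G-compactness of Th(N) bounds the number of factors from P that are needed in
-- the generated subgroup, which is then P^m for some m and type-definable by compactness: it is also G⁰⁰_A.
--
-- Now enlarge A to B.  If for every thick set θ over B finitely many conjugates of G⁰⁰_B under Aut(ℭ/A) have their
-- intersection inside all conjugates of θ^m, then the intersection of all conjugates is an A-invariant subgroup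
-- of small index, so that G⁰⁰_A ⊆ G⁰⁰_B.  Otherwise there are long sequences of σ_i and g_i with σ_j g_i ∈ G⁰⁰_B for
-- j < i but σ_i g_i ∉ θ^m.  After thinning them out, quotients of consecutive g_i yield c_i such that σ_j c_i is
-- nearly in G⁰⁰_B exactly if i ≠ j, and the products of the c_i contradict NIP.

module Submission where

open import Defs
open import Algebra.Bundles using (Group)
import Algebra.Properties.Group as GroupProperties
open import Data.Bool.Base using (Bool; true; false; if_then_else_)
open import Data.Empty using (⊥; ⊥-elim)
open import Data.Fin.Base using (Fin; zero; suc; toℕ)
open import Data.Fin.Properties using (toℕ-injective)
open import Data.List.Base using (List; []; _∷_; map; _++_; mapMaybe; length; lookup; filter; replicate; tabulate)
open import Data.List.Membership.Propositional using (_∈_)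
open import Data.List.Membership.Propositional.Properties using (∈-++⁺ˡ; ∈-++⁺ʳ; ∈-filter⁻; ∈-lookup)
import Data.List.Properties as Listₚ
open import Data.List.Properties using (map-injective; ∷-injective; ∷-injectiveˡ; ∷-injectiveʳ)
open import Data.List.Relation.Unary.All as All using (All; []; _∷_)
import Data.List.Relation.Unary.All.Properties as Allₚ
open import Data.List.Relation.Unary.AllPairs as AllPairs using (AllPairs; []; _∷_)
import Data.List.Relation.Unary.AllPairs.Properties as AllPairsₚ
open import Data.List.Relation.Unary.Any as Any using (here; there)
open import Data.List.Relation.Unary.Any.Properties using (lookup-index)
open import Data.Maybe.Base using (Maybe; just; nothing)
open import Data.Nat.Base using (ℕ; zero; suc; _+_; _*_; _≤_; _<_; z≤n; s≤s)
import Data.Nat.Properties as ℕₚ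
open import Data.Product.Base using (Σ; Σ-syntax; ∃; ∃-syntax; _×_; _,_; proj₁; proj₂)
open import Data.Sum.Base using (_⊎_; inj₁; inj₂; [_,_]′; [_,_])
open import Data.Sum.Properties using (inj₂-injective)
import Data.Sum.Relation.Binary.Pointwise as Pointwise
open import Data.Sum.Relation.Binary.Pointwise using (_⊎ₛ_)
open import Data.Unit.Base using (⊤; tt)
open import Function.Base using (_∘_; id)
open import Function.Bundles using (_⇔_; mk⇔; Equivalence; Injection; _↣_; mk↣; Inverse)
open import Level using (Level; Lift; lift; lower; _⊔_)
open import Relation.Binary.Bundles using (Setoid)
open import Relation.Binary.Definitions using (tri<; tri≈; tri>)
open import Relation.Binary.PropositionalEquality using (_≡_; refl; sym; trans; cong; cong₂; subst; setoid)
open import Relation.Nullary using (¬_; Dec; yes; no; does; ¬?)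
open import Relation.Unary using (Pred; Decidable; _⊆_; _≐_)

-- Choice and cardinal arithmetic

-- The torsor replaces the group because its relations see only the quotients x₀⁻¹xᵢ: left
-- translations are then automorphisms, and a pair with a given quotient can be moved anywhere. So
-- one fixed Skolem hull suffices to find the small models: among more elements than there are types
-- over the hull, with quotients similar to g up to inversion, two share their type, and an
-- automorphism of the torsor carries this pair to x and xg and the hull to the desired model.
--
-- The bound m on the number of factors controls the NIP argument. As Pⁿ lies in the generated
-- subgroup Pᵐ for every n, compactness provides for each thick θ a thick χ with χⁿ inside θᵐ, and
-- all longer products are absorbed in this way. The preimages σ⁻¹(θᵐ) are instances of one formula
-- with the parameters moved by σ⁻¹, which is why many conjugates can contradict NIP.
--
-- Two parameter sets over which the group is definable need not be comparable, so their components
-- are compared through the parameters of both together.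

module Choice (cl : Classical) where
  open Classical cl public

  dec : ∀ {a} (P : Set a) → Dec P
  dec P = excludedMiddle

  dne : ∀ {a} {P : Set a} → ¬ ¬ P → P
  dne {P = P} nn with dec P
  ... | yes p = p
  ... | no n  = ⊥-elim (nn n)

  abstract
    -- Subsets of `U` are coded as `U → Bool`, which stays in the universe of `U`; families of
    -- subsets then remain at the same level, and extensionally equal subsets are equal.
    -- Propositions of any level enter through `truth`.
    truth : ∀ {a} → Set a → Bool
    truth P = does (dec P)

    holds : ∀ {a} {P : Set a} → truth P ≡ true → P
    holds {P = P} e with dec P
    ... | yes p = p

    isTrue : ∀ {a} {P : Set a} → P → truth P ≡ true
    isTrue {P = P} p with dec P
    ... | yes _ = refl
    ... | no n  = ⊥-elim (n p)

    truth-cong : ∀ {a b} {P : Set a} {Q : Set b} → (P → Q) → (Q → P) → truth P ≡ truth Q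
    truth-cong {P = P} {Q} f g with dec P | dec Q
    ... | yes _ | yes _ = refl
    ... | no _  | no _  = refl
    ... | yes p | no n  = ⊥-elim (n (f p))
    ... | no n  | yes q = ⊥-elim (n (g q))

  Bool-ext : {b c : Bool} → (b ≡ true → c ≡ true) → (c ≡ true → b ≡ true) → b ≡ c
  Bool-ext {true}  {c}     f g = sym (f refl)
  Bool-ext {false} {true}  f g = g refl
  Bool-ext {false} {false} f g = refl

  module _ {a} {U : Set a} where

    infix 4 _∋_ _⊑_

    _∋_ : (U → Bool) → U → Set
    S ∋ u = S u ≡ true

    _⊑_ : (U → Bool) → (U → Bool) → Set a
    S ⊑ S′ = ∀ u → S ∋ u → S′ ∋ u

    ⊑-antisym : ∀ {S S′} → S ⊑ S′ → S′ ⊑ S → S ≡ S′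
    ⊑-antisym p q = extensionality λ u → Bool-ext (p u) (q u)

    ⋃ : ((U → Bool) → Bool) → U → Bool
    ⋃ C u = truth (∃[ S ] C S ≡ true × S ∋ u)

    -- The stages of the iteration of an inflationary map form a chain (Bourbaki–Witt), so the iteration
    -- stops at their union.
    module Iteration (next : (U → Bool) → U → Bool) (grow : ∀ S → S ⊑ next S) where

      data Stage : (U → Bool) → Set a where
        step  : ∀ {S} → Stage S → Stage (next S)
        limit : ∀ C → (∀ S → C S ≡ true → Stage S) → Stage (⋃ C)

      -- The extreme points of the classical proof: `compare` places every stage on one side of an
      -- extreme `c`, and `extreme` shows by induction that all stages are of this kind.
      Extreme : (U → Bool) → Set a
      Extreme c = ∀ {z} → Stage z → z ⊑ c → ¬ c ⊑ z → next z ⊑ c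

      compare : ∀ {c x} → Extreme c → Stage x → x ⊑ c ⊎ next c ⊑ x
      compare {c} ext (step {z} sz) with compare ext sz
      ... | inj₂ p = inj₂ λ u → grow z u ∘ p u
      ... | inj₁ z⊑c with dec (c ⊑ z)
      ...   | yes c⊑z = inj₂ (subst (λ y → next y ⊑ next z) (⊑-antisym z⊑c c⊑z) λ _ → id)
      ...   | no n    = inj₁ (ext sz z⊑c n)
      compare {c} ext (limit C sC) with dec (∃[ S ] C S ≡ true × next c ⊑ S)
      ... | yes (S , CS , p) = inj₂ λ u q → isTrue (S , CS , p u q)
      ... | no n = inj₁ below
        where
        below : ⋃ C ⊑ c
        below u q with holds q
        ... | S , CS , u∈S with compare ext (sC S CS)
        ...   | inj₁ p = p u u∈S
        ...   | inj₂ p = ⊥-elim (n (S , CS , p))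

      extreme : ∀ {c} → Stage c → Extreme c
      extreme (step {d} sd) {z} sz z⊑ n with compare (extreme sd) sz
      ... | inj₂ p = ⊥-elim (n p)
      ... | inj₁ z⊑d with dec (d ⊑ z)
      ...   | yes d⊑z = subst (λ y → next z ⊑ next y) (⊑-antisym z⊑d d⊑z) λ _ → id
      ...   | no m    = λ u → grow d u ∘ extreme sd sz z⊑d m u
      extreme (limit C sC) {z} sz z⊑ n with dec (∃[ S ] C S ≡ true × ¬ S ⊑ z)
      ... | no m = ⊥-elim (n λ u p → let S , CS , q = holds p in dne (λ S⋢z → m (S , CS , S⋢z)) u q)
      ... | yes (S , CS , m) with compare (extreme (sC S CS)) sz
      ...   | inj₁ z⊑S = λ u p → isTrue (S , CS , extreme (sC S CS) sz z⊑S m u p)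
      ...   | inj₂ p   = ⊥-elim (m λ u → p u ∘ grow S u)

      chain : ∀ {x y} → Stage x → Stage y → x ⊑ y ⊎ y ⊑ x
      chain {y = y} sx sy with compare (extreme sy) sx
      ... | inj₁ p = inj₁ p
      ... | inj₂ p = inj₂ λ u → p u ∘ grow y u

      top : U → Bool
      top = ⋃ (λ S → truth (Stage S))

      stage-top : Stage top
      stage-top = limit _ λ _ → holds

      top-closed : next top ⊑ top
      top-closed u p = isTrue (next top , isTrue (step stage-top) , p)

    Chain : ((U → Bool) → Bool) → Set a
    Chain C = ∀ S S′ → C S ≡ true → C S′ ≡ true → S ⊑ S′ ⊎ S′ ⊑ S

    -- `next` moves to a strictly larger member of `𝓕` whenever there is one, so a stage that it
    -- does not enlarge is maximal. The hypothesis includes the empty chain, hence `𝓕` is inhabited.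
    zorn : ∀ {b} (𝓕 : Pred (U → Bool) b) →
           (∀ C → (∀ S → C S ≡ true → 𝓕 S) → Chain C → 𝓕 (⋃ C)) →
           ∃[ S ] 𝓕 S × (∀ S′ → 𝓕 S′ → S ⊑ S′ → S′ ⊑ S)
    zorn 𝓕 union = top , 𝓕-stage stage-top , maximal
      where
      Extension : (U → Bool) → Set _
      Extension S = ∃[ S′ ] 𝓕 S′ × S ⊑ S′ × ¬ S′ ⊑ S
      next : (U → Bool) → U → Bool
      next S with dec (Extension S)
      ... | yes (S′ , _) = S′
      ... | no _         = S
      grow : ∀ S → S ⊑ next S
      grow S with dec (Extension S)
      ... | yes (_ , _ , p , _) = p
      ... | no _                = λ _ → id
      open Iteration next grow
      𝓕-next : ∀ {S} → 𝓕 S → 𝓕 (next S)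
      𝓕-next {S} f with dec (Extension S)
      ... | yes (_ , f′ , _) = f′
      ... | no _             = f
      𝓕-stage : ∀ {S} → Stage S → 𝓕 S
      𝓕-stage (step s)     = 𝓕-next (𝓕-stage s)
      𝓕-stage (limit C sC) =
        union C (λ S p → 𝓕-stage (sC S p)) λ S S′ p q → chain (sC S p) (sC S′ q)
      unextendable : ∀ S → next S ⊑ S → ¬ Extension S
      unextendable S p e with dec (Extension S)
      ... | yes (_ , _ , _ , n) = n p
      ... | no n                = n e
      maximal : ∀ S′ → 𝓕 S′ → top ⊑ S′ → S′ ⊑ top
      maximal S′ f p = dne λ n → unextendable top top-closed (S′ , f , p , n)

    module _ {b} (Q : Pred (List U) b) (Q[] : Q []) where

      abstract
        -- Zorn's lemma for a property of finite character, tested on lists: a nonempty list inside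
        -- the union of a chain lies in one of its members, and the empty list is covered by `Q[]`.
        -- Maximality takes the form that whatever can be added is already there.
        tukey : ∃[ S ] (∀ l → All (S ∋_) l → Q l) ×
                       (∀ u → (∀ l → All (λ x → S ∋ x ⊎ x ≡ u) l → Q l) → S ∋ u)
        tukey = let S , good , maximal = zorn 𝓕 union
                in S , good , λ u q → maximal (λ x → truth (S ∋ x ⊎ x ≡ u)) (λ l → q l ∘ All.map holds)
                                        (λ x p → isTrue (inj₁ p)) u (isTrue (inj₂ refl))
          where
          𝓕 : Pred (U → Bool) (a Level.⊔ b)
          𝓕 S = ∀ l → All (S ∋_) l → Q l
          union : ∀ C → (∀ S → C S ≡ true → 𝓕 S) → Chain C → 𝓕 (⋃ C)
          union C f ch []       _  = Q[]
          union C f ch (u ∷ l′) ps =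
            let S , CS , q = common u l′ ps in f S CS (u ∷ l′) q
            where
            common : ∀ u l → All (⋃ C ∋_) (u ∷ l) → ∃[ S ] C S ≡ true × All (S ∋_) (u ∷ l)
            common u [] (p ∷ []) with holds p
            ... | S , CS , q = S , CS , q ∷ []
            common u (v ∷ l) (p ∷ ps) with holds p | common v l ps
            ... | S , CS , q | S′ , CS′ , qs with ch S S′ CS CS′
            ...   | inj₁ r = S′ , CS′ , r u q ∷ qs
            ...   | inj₂ r = S , CS , q ∷ All.map (r _) qs

  -- The element comes from `dec`; the given proof only excludes emptiness. The choice thus depends
  -- on `c` alone, which yields `choose-irr` and canonical representatives of classes.
  choose : ∀ {a} {X : Set a} (c : X → Bool) → ∃ (c ∋_) → X
  choose c e with dec (∃ (c ∋_))
  ... | yes (x , _) = x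
  ... | no n        = ⊥-elim (n e)

  choose-∋ : ∀ {a} {X : Set a} (c : X → Bool) (e : ∃ (c ∋_)) → c ∋ choose c e
  choose-∋ c e with dec (∃ (c ∋_))
  ... | yes (_ , p) = p
  ... | no n        = ⊥-elim (n e)

  choose-irr : ∀ {a} {X : Set a} {c d : X → Bool} → c ≡ d → ∀ e e′ → choose c e ≡ choose d e′
  choose-irr {c = c} refl e e′ with dec (∃ (c ∋_))
  ... | yes _ = refl
  ... | no n  = ⊥-elim (n e)

  UIP : ∀ {a} {X : Set a} {x y : X} (p q : x ≡ y) → p ≡ q
  UIP refl refl = refl

  Σ-≡ : ∀ {a} {X : Set a} {f : X → Bool} {p q : Σ X (f ∋_)} → proj₁ p ≡ proj₁ q → p ≡ q
  Σ-≡ {p = x , p} {.x , q} refl = cong (x ,_) (UIP p q)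

  ≤ᶜ-trans : ∀ {ℓ} {X Y Z : Cardinal ℓ} → X ≤ᶜ Y → Y ≤ᶜ Z → X ≤ᶜ Z
  ≤ᶜ-trans f g = record
    { to = Injection.to g ∘ Injection.to f
    ; cong = Injection.cong g ∘ Injection.cong f
    ; injective = Injection.injective f ∘ Injection.injective g }

  ≤<-trans : ∀ {ℓ} {X Y Z : Cardinal ℓ} → X ≤ᶜ Y → Y <ᶜ Z → X <ᶜ Z
  ≤<-trans {X = X} {Y} {Z} f (g , n) = ≤ᶜ-trans {X = X} {Y} {Z} f g , λ h → n (≤ᶜ-trans {X = Z} {X} {Y} h f)

  module _ {ℓ} (S : Setoid ℓ ℓ) where
    open Setoid S using (Carrier; _≈_) renaming (refl to ≈-refl; sym to ≈-sym; trans to ≈-trans)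

    surjection⇒≤ : {X : Set ℓ} (f : X → Carrier) → (∀ s → ∃[ x ] f x ≈ s) → S ≤ᶜ setoid X
    surjection⇒≤ {X} f surj = record
      { to = λ s → choose (fibre s) (nonempty s)
      ; cong = λ s≈t → choose-irr (extensionality λ x → truth-cong (λ p → ≈-trans p s≈t)
                                     (λ p → ≈-trans p (≈-sym s≈t))) _ _
      ; injective = λ {s} {t} e → ≈-trans (≈-sym (in-fibre s)) (subst (λ x → f x ≈ t) (sym e) (in-fibre t)) }
      where
      fibre : Carrier → X → Bool
      fibre s x = truth (f x ≈ s)
      nonempty : ∀ s → ∃ (fibre s ∋_)
      nonempty s = let x , p = surj s in x , isTrue p
      in-fibre : ∀ s → f (choose (fibre s) (nonempty s)) ≈ s
      in-fibre s = holds (choose-∋ (fibre s) (nonempty s))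

    private
      class : Carrier → Carrier → Bool
      class s x = truth (x ≈ s)
      class-∋ : ∀ s → ∃ (class s ∋_)
      class-∋ s = s , isTrue ≈-refl

    rep : Carrier → Carrier
    rep s = choose (class s) (class-∋ s)

    rep-≈ : ∀ s → rep s ≈ s
    rep-≈ s = holds (choose-∋ (class s) (class-∋ s))

    rep-cong : ∀ {s t} → s ≈ t → rep s ≡ rep t
    rep-cong s≈t = choose-irr (extensionality λ x → truth-cong (λ p → ≈-trans p s≈t)
                                 (λ p → ≈-trans p (≈-sym s≈t))) _ _

    -- The fixed points of `rep` count the classes of the setoid, but up to `≡`, so that cardinal
    -- arithmetic for plain types applies to quotients.
    Representative : Set ℓ
    Representative = ∃[ s ] rep s ≡ s

    represent : Carrier → Representative
    represent s = rep s , rep-cong (rep-≈ s)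

    Rep-≡ : {x y : Representative} → proj₁ x ≡ proj₁ y → x ≡ y
    Rep-≡ {x , p} {.x , q} refl = cong (x ,_) (UIP p q)

    Rep≤ : setoid Representative ≤ᶜ S
    Rep≤ = record
      { to = proj₁ ; cong = λ { refl → ≈-refl }
      ; injective = λ {x} {y} e → Rep-≡ (trans (sym (proj₂ x)) (trans (rep-cong e) (proj₂ y))) }

    ≤Rep : S ≤ᶜ setoid Representative
    ≤Rep = record
      { to = represent ; cong = λ e → Rep-≡ (rep-cong e)
      ; injective = λ {x} {y} e → ≈-trans (≈-sym (rep-≈ x)) (subst (_≈ y) (sym (cong proj₁ e)) (rep-≈ y)) }

_↣∘_ : ∀ {a b c} {X : Set a} {Y : Set b} {Z : Set c} → Y ↣ Z → X ↣ Y → X ↣ Z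
g ↣∘ f = mk↣ (Injection.injective f ∘ Injection.injective g)

square+-< : ∀ {i s t} → i ≤ s → s < t → s * s + i < t * t
square+-< {i} {s} {t} i≤s s<t = begin-strict
  s * s + i      ≤⟨ ℕₚ.+-monoʳ-≤ (s * s) i≤s ⟩
  s * s + s      ≡⟨ ℕₚ.+-comm (s * s) s ⟩
  suc s * s      <⟨ ℕₚ.*-monoʳ-< (suc s) (ℕₚ.n<1+n s) ⟩
  suc s * suc s  ≤⟨ ℕₚ.*-mono-≤ s<t s<t ⟩
  t * t          ∎
  where open ℕₚ.≤-Reasoning

abstract
  -- The values with `i + j = s` lie between s² and s² + s; by `square+-<` these intervals are
  -- disjoint for different s.
  ℕ×ℕ↣ℕ : (ℕ × ℕ) ↣ ℕ
  ℕ×ℕ↣ℕ = mk↣ {to = λ (i , j) → (i + j) * (i + j) + i} inj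
    where
    inj : ∀ {p q : ℕ × ℕ} → (proj₁ p + proj₂ p) * (proj₁ p + proj₂ p) + proj₁ p ≡
                            (proj₁ q + proj₂ q) * (proj₁ q + proj₂ q) + proj₁ q → p ≡ q
    inj {i , j} {i′ , j′} e with ℕₚ.<-cmp (i + j) (i′ + j′)
    ... | tri< s<t _ _ = ⊥-elim (ℕₚ.<-irrefl e (ℕₚ.<-≤-trans (square+-< (ℕₚ.m≤m+n i j) s<t) (ℕₚ.m≤m+n _ i′)))
    ... | tri> _ _ t<s = ⊥-elim (ℕₚ.<-irrefl (sym e) (ℕₚ.<-≤-trans (square+-< (ℕₚ.m≤m+n i′ j′) t<s) (ℕₚ.m≤m+n _ i)))
    ... | tri≈ _ s≡t _ with ℕₚ.+-cancelˡ-≡ ((i + j) * (i + j)) i i′ (trans e (cong (λ s → s * s + i′) (sym s≡t)))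
    ...   | refl = cong (i ,_) (ℕₚ.+-cancelˡ-≡ i j j′ s≡t)

-- Comparability of cardinals, pairing functions and small sets

module Cardinality (cl : Classical) where
  open Choice cl

  module _ {a} (X Y : Set a) where

    private
      Compatible : X × Y → X × Y → Set a
      Compatible u v = (proj₁ u ≡ proj₁ v → u ≡ v) × (proj₂ u ≡ proj₂ v → u ≡ v)
      max = tukey (λ l → ∀ {u v} → u ∈ l → v ∈ l → Compatible u v) λ ()
      S = proj₁ max

      compat : ∀ {u v} → S ∋ u → S ∋ v → Compatible u v
      compat p q = proj₁ (proj₂ max) _ (p ∷ q ∷ []) (here refl) (there (here refl))

      Free : X × Y → Set a
      Free (x , y) = ¬ (∃[ y′ ] S ∋ (x , y′)) × ¬ (∃[ x′ ] S ∋ (x′ , y))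

      free-compat : ∀ {w u v} → Free w → S ∋ u ⊎ u ≡ w → S ∋ v ⊎ v ≡ w → Compatible u v
      free-compat fr       (inj₁ p)    (inj₁ q)    = compat p q
      free-compat (f , g)  (inj₁ p)    (inj₂ refl) = (λ { refl → ⊥-elim (f (_ , p)) }) ,
          λ { refl → ⊥-elim (g (_ , p)) }
      free-compat (f , g)  (inj₂ refl) (inj₁ p)    = (λ { refl → ⊥-elim (f (_ , p)) }) ,
          λ { refl → ⊥-elim (g (_ , p)) }
      free-compat fr       (inj₂ refl) (inj₂ refl) = (λ _ → refl) , λ _ → refl

      not-free : ∀ w → ¬ Free w
      not-free w fr = proj₁ fr (_ , proj₂ (proj₂ max) w λ l ps p q →
        free-compat fr (All.lookup ps p) (All.lookup ps q))

    -- A maximal partial bijection exhausts one of the two sides, for otherwise a pair of unmatched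
    -- points could be added.
    comparable : X ↣ Y ⊎ Y ↣ X
    comparable with dec (∀ x → ∃[ y ] S ∋ (x , y))
    ... | yes f = inj₁ (mk↣ {to = proj₁ ∘ f} λ {x} {x′} e →
                    cong proj₁ (proj₂ (compat (proj₂ (f x)) (proj₂ (f x′))) e))
    ... | no n  = inj₂ (mk↣ {to = proj₁ ∘ g} λ {y} {y′} e →
                    cong proj₂ (proj₁ (compat (proj₂ (g y)) (proj₂ (g y′))) e))
      where
      g : ∀ y → ∃[ x ] S ∋ (x , y)
      g y = dne λ m → n λ x → dne λ k → not-free (x , y) (k , m)

  zorn⁺ : ∀ {a b} {U : Set a} (𝓕 : Pred (U → Bool) b) (S₀ : U → Bool) → 𝓕 S₀ →
          (∀ C → ∃ (C ∋_) → (∀ S → C S ≡ true → 𝓕 S) → Chain C → 𝓕 (⋃ C)) →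
          ∃[ S ] S₀ ⊑ S × 𝓕 S × (∀ S′ → 𝓕 S′ → S ⊑ S′ → S′ ⊑ S)
  zorn⁺ {U = U} 𝓕 S₀ f₀ union = finish (zorn 𝓖 𝓖-union)
    where
    Empty : (U → Bool) → Set _
    Empty S = ∀ u → ¬ S ∋ u
    𝓖 : (U → Bool) → Set _
    𝓖 S = Empty S ⊎ S₀ ⊑ S × 𝓕 S
    𝓖-union : ∀ C → (∀ S → C S ≡ true → 𝓖 S) → Chain C → 𝓖 (⋃ C)
    𝓖-union C g ch with dec (∃[ S ] C S ≡ true × ¬ Empty S)
    ... | no n = inj₁ λ u p → let S , CS , q = holds p in n (S , CS , λ e → e u q)
    ... | yes (S , CS , ne) = inj₂ ((λ u p → isTrue (S , CS , proj₁ (proper S CS ne) u p)) ,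
                                    subst 𝓕 (⊑-antisym C⁺⊑ ⊑C⁺) (union C⁺ (S , isTrue (CS , ne))
                                      (λ S p → let CS , ne = holds p in proj₂ (proper S CS ne))
                                      (λ S S′ p q → ch S S′ (proj₁ (holds p)) (proj₁ (holds q)))))
      where
      proper : ∀ S → C S ≡ true → ¬ Empty S → S₀ ⊑ S × 𝓕 S
      proper S CS ne with g S CS
      ... | inj₁ e = ⊥-elim (ne e)
      ... | inj₂ p = p
      C⁺ : (U → Bool) → Bool
      C⁺ S = truth (C S ≡ true × ¬ Empty S)
      C⁺⊑ : ⋃ C⁺ ⊑ ⋃ C
      C⁺⊑ u p = let S , C⁺S , q = holds p in isTrue (S , proj₁ (holds C⁺S) , q)
      ⊑C⁺ : ⋃ C ⊑ ⋃ C⁺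
      ⊑C⁺ u p = let S , CS , q = holds p in isTrue (S , isTrue (CS , λ e → e u q) , q)
    finish : (∃[ S ] 𝓖 S × (∀ S′ → 𝓖 S′ → S ⊑ S′ → S′ ⊑ S)) →
             ∃[ S ] S₀ ⊑ S × 𝓕 S × (∀ S′ → 𝓕 S′ → S ⊑ S′ → S′ ⊑ S)
    finish (S , inj₁ e , m) =
      S₀ , (λ _ → id) , f₀ , λ S′ f p u q → ⊥-elim (e u (m S′ (inj₂ (p , f)) (λ v r → ⊥-elim (e v r)) u q))
    finish (S , inj₂ (p , f) , m) = S , p , f , λ S′ f′ q → m S′ (inj₂ ((λ u → q u ∘ p u) , f′)) q

  -- A maximal pairing on an infinite subset D of X: if the complement of D embeds into D then so does X,
  -- otherwise a copy of D outside D yields a larger pairing.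
  module Pairing {a} {X : Set a} (ν : ℕ ↣ X) where

    private
      ι = Injection.to ν

      Relation : Set a
      Relation = X × X × X → Bool

      -- A partial pairing is coded as a single set of triples, ordered by inclusion as Zorn's lemma
      -- requires; its domain is read off the diagonal.
      Dom : Relation → X → Set a
      Dom F x = ∃[ z ] F ∋ (x , x , z)

      record PairingOn (F : Relation) : Set a where
        field
          closed : ∀ {x y z} → F ∋ (x , y , z) → Dom F x × Dom F y × Dom F z
          total  : ∀ {x y} → Dom F x → Dom F y → ∃[ z ] F ∋ (x , y , z)
          inj    : ∀ {x y x′ y′ z} → F ∋ (x , y , z) → F ∋ (x′ , y′ , z) → (x , y) ≡ (x′ , y′)
      open PairingOn

      pairℕ : ℕ → ℕ → ℕ
      pairℕ i j = Injection.to ℕ×ℕ↣ℕ (i , j)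

      F₀ : Relation
      F₀ (x , y , z) = truth (∃[ i ] ∃[ j ] x ≡ ι i × y ≡ ι j × z ≡ ι (pairℕ i j))

      dom₀ : ∀ i → Dom F₀ (ι i)
      dom₀ i = _ , isTrue (i , i , refl , refl , refl)

      dom₀⁻ : ∀ {x} → Dom F₀ x → ∃[ i ] x ≡ ι i
      dom₀⁻ (_ , p) = let i , _ , q , _ = holds p in i , q

      pairing₀ : PairingOn F₀
      closed pairing₀ p with holds p
      ... | i , j , refl , refl , refl = dom₀ i , dom₀ j , dom₀ (pairℕ i j)
      total pairing₀ p q with dom₀⁻ p | dom₀⁻ q
      ... | i , refl | j , refl = _ , isTrue (i , j , refl , refl , refl)
      inj pairing₀ p q with holds p | holds q
      ... | i , j , refl , refl , e | i′ , j′ , refl , refl , e′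
        with Injection.injective ℕ×ℕ↣ℕ {i , j} {i′ , j′} (Injection.injective ν (trans (sym e) e′))
      ... | refl = refl

      dom-mono : ∀ {F G} → F ⊑ G → ∀ {x} → Dom F x → Dom G x
      dom-mono p (z , q) = z , p _ q

      union : ∀ C → ∃ (C ∋_) → (∀ S → C S ≡ true → PairingOn S) → Chain C → PairingOn (⋃ C)
      union C _ f ch = record
        { closed = λ p → let S , CS , q = holds p
                             dx , dy , dz = closed (f S CS) q
                         in dom-mono (up CS) dx , dom-mono (up CS) dy , dom-mono (up CS) dz
        ; total  = λ (_ , p) (_ , q) → let S , CS , p′ , q′ = common p q
                                           z , r = total (f S CS) (_ , p′) (_ , q′)
                                       in z , up CS _ r
        ; inj    = λ p q → let S , CS , p′ , q′ = common p q in inj (f S CS) p′ q′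
        }
        where
        up : ∀ {S} → C S ≡ true → S ⊑ ⋃ C
        up CS u p = isTrue (_ , CS , p)
        common : ∀ {u v} → ⋃ C ∋ u → ⋃ C ∋ v → ∃[ S ] C S ≡ true × S ∋ u × S ∋ v
        common p q with holds p | holds q
        ... | S , CS , p′ | S′ , CS′ , q′ with ch S S′ CS CS′
        ...   | inj₁ r = S′ , CS′ , r _ p′ , q′
        ...   | inj₂ r = S , CS , p′ , r _ q′

      module Maximal (F : Relation) (F₀⊑F : F₀ ⊑ F) (pairing : PairingOn F)
                     (maximal : ∀ F′ → PairingOn F′ → F ⊑ F′ → F′ ⊑ F) where

        D E : Set a
        D = Σ[ x ∈ X ] truth (Dom F x) ≡ true
        E = Σ[ x ∈ X ] truth (¬ Dom F x) ≡ true

        abstract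
          h : D → D → D
          h (x , p) (y , q) = let z , r = total pairing (holds p) (holds q)
                              in z , isTrue (proj₂ (proj₂ (closed pairing r)))

          h-inj : ∀ {x y x′ y′} → h x y ≡ h x′ y′ → x ≡ x′ × y ≡ y′
          h-inj {x , p} {y , q} {x′ , p′} {y′ , q′} e =
            let z , r   = total pairing (holds p) (holds q)
                z′ , r′ = total pairing (holds p′) (holds q′)
                eq = inj pairing r (subst (λ w → F ∋ (x′ , y′ , w)) (sym (cong proj₁ e)) r′)
            in Σ-≡ (cong proj₁ eq) , Σ-≡ (cong proj₂ eq)

        d : ℕ → D
        d i = ι i , isTrue (dom-mono F₀⊑F (dom₀ i))

        d₀≢d₁ : ¬ d 0 ≡ d 1
        d₀≢d₁ e with Injection.injective ν (cong proj₁ e)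
        ... | ()

        -- Fixing the first argument of `h` to `d 0` or to `d 1` gives two disjoint copies of D
        -- inside D. One takes D and the other the image of E, so all of X embeds into D and borrows
        -- its pairing.
        fits : E ↣ D → (X × X) ↣ X
        fits e = mk↣ {to = λ (x , y) → proj₁ (h (k x) (k y))} λ {u} {v} eq →
                   let p , q = h-inj {k (proj₁ u)} {k (proj₂ u)} (Σ-≡ eq) in cong₂ _,_ (k-inj p) (k-inj q)
          where
          k : X → D
          k x with dec (Dom F x)
          ... | yes p = h (d 0) (x , isTrue p)
          ... | no n  = h (d 1) (Injection.to e (x , isTrue n))
          k-inj : ∀ {x y} → k x ≡ k y → x ≡ y
          k-inj {x} {y} eq with dec (Dom F x) | dec (Dom F y)
          ... | yes _ | yes _ = cong proj₁ (proj₂ (h-inj {d 0} {_} {d 0} eq))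
          ... | no _  | no _  = cong proj₁ (Injection.injective e (proj₂ (h-inj {d 1} {_} {d 1} eq)))
          ... | yes _ | no _  = ⊥-elim (d₀≢d₁ (proj₁ (h-inj {d 0} {_} {d 1} eq)))
          ... | no _  | yes _ = ⊥-elim (d₀≢d₁ (sym (proj₁ (h-inj {d 1} {_} {d 0} eq))))

        -- The pairing extends to D together with its copy `ē` D: arguments are coded into D by `k`
        -- and paired by `h`, and the result is pushed through `ē`, where no value of F lies. This
        -- contradicts maximality.
        overflows : ¬ (D ↣ E)
        overflows e = outside (d 0) (proj₁ (closed pairing
                        (maximal F⁺ pairing⁺ (λ _ p → isTrue (inj₁ p)) _ (new (d 0)))))
          where
          ē : D → X
          ē x = proj₁ (Injection.to e x)
          ē-inj : ∀ {x y} → ē x ≡ ē y → x ≡ y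
          ē-inj p = Injection.injective e (Σ-≡ p)
          outside : ∀ x → ¬ Dom F (ē x)
          outside x = holds (proj₂ (Injection.to e x))
          D⁺ : X → Set a
          D⁺ x = Dom F x ⊎ ∃[ y ] ē y ≡ x
          k : ∀ {x} → D⁺ x → D
          k {x} (inj₁ p)       = h (d 0) (x , isTrue p)
          k     (inj₂ (y , _)) = h (d 1) y
          k-inj : ∀ {x y} (p : D⁺ x) (q : D⁺ y) → k p ≡ k q → x ≡ y
          k-inj (inj₁ _) (inj₁ _) eq = cong proj₁ (proj₂ (h-inj {d 0} {_} {d 0} eq))
          k-inj (inj₂ (_ , refl)) (inj₂ (_ , refl)) eq = cong ē (proj₂ (h-inj {d 1} {_} {d 1} eq))
          k-inj (inj₁ _) (inj₂ _) eq = ⊥-elim (d₀≢d₁ (proj₁ (h-inj {d 0} {_} {d 1} eq)))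
          k-inj (inj₂ _) (inj₁ _) eq = ⊥-elim (d₀≢d₁ (sym (proj₁ (h-inj {d 1} {_} {d 0} eq))))
          New : X × X × X → Set a
          New (x , y , z) = Σ[ p ∈ D⁺ x ] Σ[ q ∈ D⁺ y ] ¬ (Dom F x × Dom F y) × z ≡ ē (h (k p) (k q))
          F⁺ : Relation
          F⁺ u = truth (F ∋ u ⊎ New u)
          new : ∀ x → F⁺ ∋ (ē x , ē x , ē (h (h (d 1) x) (h (d 1) x)))
          new x = isTrue (inj₂ (inj₂ (x , refl) , inj₂ (x , refl) , outside x ∘ proj₁ , refl))
          dom⁺ : ∀ {x} → D⁺ x → Dom F⁺ x
          dom⁺ (inj₁ (z , p))    = z , isTrue (inj₁ p)
          dom⁺ (inj₂ (y , refl)) = _ , new y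
          dom⁺⁻ : ∀ {x} → Dom F⁺ x → D⁺ x
          dom⁺⁻ (z , p) with holds p
          ... | inj₁ q       = inj₁ (z , q)
          ... | inj₂ (q , _) = q
          closed⁺ : ∀ {x y z} → F ∋ (x , y , z) ⊎ New (x , y , z) → Dom F⁺ x × Dom F⁺ y × Dom F⁺ z
          closed⁺ (inj₁ q) = let dx , dy , dz = closed pairing q
                             in dom⁺ (inj₁ dx) , dom⁺ (inj₁ dy) , dom⁺ (inj₁ dz)
          closed⁺ (inj₂ (dx , dy , _ , e)) = dom⁺ dx , dom⁺ dy , dom⁺ (inj₂ (_ , sym e))
          total⁺ : ∀ {x y} → D⁺ x → D⁺ y → ∃[ z ] F⁺ ∋ (x , y , z)
          total⁺ {x} {y} p q with dec (Dom F x × Dom F y)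
          ... | yes (dx , dy) = let z , r = total pairing dx dy in z , isTrue (inj₁ r)
          ... | no n          = ē (h (k p) (k q)) , isTrue (inj₂ (p , q , n , refl))
          inj⁺ : ∀ {x y x′ y′ z} → F ∋ (x , y , z) ⊎ New (x , y , z) →
                 F ∋ (x′ , y′ , z) ⊎ New (x′ , y′ , z) → (x , y) ≡ (x′ , y′)
          inj⁺ (inj₁ r) (inj₁ r′) = inj pairing r r′
          inj⁺ (inj₁ r) (inj₂ (_ , _ , _ , e)) =
            ⊥-elim (outside _ (subst (Dom F) e (proj₂ (proj₂ (closed pairing r)))))
          inj⁺ (inj₂ (_ , _ , _ , e)) (inj₁ r) =
            ⊥-elim (outside _ (subst (Dom F) e (proj₂ (proj₂ (closed pairing r)))))
          inj⁺ (inj₂ (dx , dy , _ , e)) (inj₂ (dx′ , dy′ , _ , e′)) =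
            let e₁ , e₂ = h-inj {k dx} {k dy} {k dx′} {k dy′} (ē-inj (trans (sym e) e′))
            in cong₂ _,_ (k-inj dx dx′ e₁) (k-inj dy dy′ e₂)
          pairing⁺ : PairingOn F⁺
          closed pairing⁺ p = closed⁺ (holds p)
          total pairing⁺ p q = total⁺ (dom⁺⁻ p) (dom⁺⁻ q)
          inj pairing⁺ p q = inj⁺ (holds p) (holds q)

        embedding : (X × X) ↣ X
        embedding with comparable E D
        ... | inj₁ e = fits e
        ... | inj₂ e = ⊥-elim (overflows e)

    abstract
      pair : (X × X) ↣ X
      pair = let F , F₀⊑F , pairing , maximal = zorn⁺ PairingOn F₀ pairing₀ union
             in Maximal.embedding F F₀⊑F pairing maximal

    private
      encoding : List X ↣ X
      encoding = mk↣ {to = code} (code-inj _ _)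
        where
        ⟨_,_⟩ : X → X → X
        ⟨ x , y ⟩ = Injection.to pair (x , y)
        ⟨⟩-inj : ∀ {x y x′ y′} → ⟨ x , y ⟩ ≡ ⟨ x′ , y′ ⟩ → x ≡ x′ × y ≡ y′
        ⟨⟩-inj e = let eq = Injection.injective pair e in cong proj₁ eq , cong proj₂ eq
        code : List X → X
        code []       = ⟨ ι 0 , ι 0 ⟩
        code (x ∷ xs) = ⟨ ι 1 , ⟨ x , code xs ⟩ ⟩
        code-inj : ∀ xs ys → code xs ≡ code ys → xs ≡ ys
        code-inj []       []       e = refl
        code-inj []       (y ∷ ys) e with Injection.injective ν (proj₁ (⟨⟩-inj e))
        ... | ()
        code-inj (x ∷ xs) []       e with Injection.injective ν (proj₁ (⟨⟩-inj e))
        ... | ()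
        code-inj (x ∷ xs) (y ∷ ys) e =
          let p , q = ⟨⟩-inj (proj₂ (⟨⟩-inj e)) in cong₂ _∷_ p (code-inj xs ys q)

    abstract
      listCode : List X ↣ X
      listCode = encoding

  cantor : ∀ {a} {X : Set a} → ¬ ((X → Bool) ↣ X)
  cantor {X = X} f = absurd (dec (S ∋ Injection.to f S))
    where
    S : X → Bool
    S x = truth (∃[ R ] Injection.to f R ≡ x × ¬ R ∋ x)
    absurd : ¬ Dec (S ∋ Injection.to f S)
    absurd (no n)  = n (isTrue (S , refl , n))
    absurd (yes p) with holds p
    ... | R , e , q with Injection.injective f e
    ...   | refl = q p

  preimage : ∀ {a b} {X : Set a} {Y : Set b} → X ↣ Y → (X → Bool) ↣ (Y → Bool)
  preimage {X = X} {Y} f = mk↣ {to = image} λ {S} {R} e → extensionality λ x →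
    Bool-ext (half e x) (half (sym e) x)
    where
    image : (X → Bool) → Y → Bool
    image S y = truth (∃[ x ] Injection.to f x ≡ y × S ∋ x)
    half : ∀ {S R} → image S ≡ image R → ∀ x → S ∋ x → R ∋ x
    half {S} {R} e x p with holds {P = ∃[ x′ ] Injection.to f x′ ≡ Injection.to f x × R ∋ x′}
                              (trans (cong (λ I → I (Injection.to f x)) (sym e)) (isTrue (x , refl , p)))
    ... | x′ , q , r = subst (R ∋_) (Injection.injective f q) r

  module SmallSets {ℓ} (κ : Cardinal ℓ) (strongLimit : StrongLimit κ)
                   (small-ℕ : setoid (Lift ℓ ℕ) <ᶜ κ) where

    Small : Set ℓ → Set ℓ
    Small X = setoid X <ᶜ κ

    small-↣ : ∀ {X Y} → X ↣ Y → Small Y → Small X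
    small-↣ {X} {Y} = ≤<-trans {X = setoid X} {setoid Y} {κ}

    small-⊥ : Small (Lift ℓ ⊥)
    small-⊥ = small-↣ (mk↣ {to = λ ()} λ { {()} }) small-ℕ

    small-2^ : ∀ {X} → Small X → Small (X → Bool)
    small-2^ {X} s = ≤<-trans {X = setoid (X → Bool)} {2^ setoid X} {κ}
      (record { to = λ f → record { to = f ; cong = cong f }
              ; cong = λ { refl x → refl } ; injective = extensionality })
      (strongLimit (setoid X) s)

    private
      ｛_｝ : ∀ {a} {Y : Set a} → Y → Y → Bool
      ｛ y ｝ z = truth (z ≡ y)

      ｛｝-inj : ∀ {a} {Y : Set a} {y z : Y} → ｛ y ｝ ≡ ｛ z ｝ → y ≡ z
      ｛｝-inj {y = y} e = holds (trans (cong (λ S → S y) (sym e)) (isTrue refl))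

      -- `x` becomes the set with the one element {f x}, and `y` the set with the elements {y} and
      -- ∅; the presence of ∅ tells the summands apart. By `comparable`, closure under power sets
      -- then implies closure under sums.
      ⊎-embed : ∀ {X Y : Set ℓ} → X ↣ Y → (X ⊎ Y) ↣ ((Y → Bool) → Bool)
      ⊎-embed {X} {Y} f = mk↣ {to = to} inj
        where
        ∅ : Y → Bool
        ∅ _ = false
        ∅≢ : ∀ {y} → ¬ ∅ ≡ ｛ y ｝
        ∅≢ {y} e with trans (cong (λ S → S y) e) (isTrue refl)
        ... | ()
        to : X ⊎ Y → (Y → Bool) → Bool
        to (inj₁ x) = ｛ ｛ Injection.to f x ｝ ｝
        to (inj₂ y) S = truth (S ≡ ｛ y ｝ ⊎ S ≡ ∅)
        not₁₂ : ∀ {x y} → ¬ to (inj₁ x) ≡ to (inj₂ y)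
        not₁₂ e = ∅≢ (holds (trans (cong (λ 𝓢 → 𝓢 ∅) e) (isTrue (inj₂ refl))))
        inj : ∀ {u v} → to u ≡ to v → u ≡ v
        inj {inj₁ x} {inj₁ x′} e = cong inj₁ (Injection.injective f (｛｝-inj (｛｝-inj e)))
        inj {inj₁ x} {inj₂ y}  e = ⊥-elim (not₁₂ e)
        inj {inj₂ y} {inj₁ x}  e = ⊥-elim (not₁₂ (sym e))
        inj {inj₂ y} {inj₂ y′} e with holds {P = ｛ y ｝ ≡ ｛ y′ ｝ ⊎ ｛ y ｝ ≡ ∅}
                                        (trans (cong (λ 𝓢 → 𝓢 ｛ y ｝) (sym e)) (isTrue (inj₁ refl)))
        ... | inj₁ p = cong inj₂ (｛｝-inj p)
        ... | inj₂ p = ⊥-elim (∅≢ (sym p))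

    small-⊎ : ∀ {X Y} → Small X → Small Y → Small (X ⊎ Y)
    small-⊎ {X} {Y} sx sy with comparable X Y
    ... | inj₁ f = small-↣ (⊎-embed f) (small-2^ (small-2^ sy))
    ... | inj₂ f = small-↣ (⊎-embed f ↣∘ swap) (small-2^ (small-2^ sx))
      where
      swap : (X ⊎ Y) ↣ (Y ⊎ X)
      swap = mk↣ {to = λ { (inj₁ x) → inj₂ x ; (inj₂ y) → inj₁ y }}
        λ { {inj₁ _} {inj₁ _} refl → refl ; {inj₁ _} {inj₂ _} () ; {inj₂ _} {inj₁ _} () ; {inj₂ _} {inj₂ _} refl →
            refl }

    -- The summand ℕ makes the set infinite, as the pairing function demands.
    small-List : ∀ {X} → Small X → Small (List X)
    small-List {X} s = small-↣ (Pairing.listCode ν ↣∘ mk↣ {to = map inj₂} (map-injective inj₂-injective))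
        (small-⊎ small-ℕ s)
      where
      ν : ℕ ↣ (Lift ℓ ℕ ⊎ X)
      ν = mk↣ {to = inj₁ ∘ lift} λ { refl → refl }

    small-× : ∀ {X Y} → Small X → Small Y → Small (X × Y)
    small-× sx sy = small-↣ (mk↣ {to = λ (x , y) → inj₁ x ∷ inj₂ y ∷ []} λ { refl → refl })
                            (small-List (small-⊎ sx sy))

    small-→ : ∀ {X Y} → Small X → Small Y → Small (X → Y)
    small-→ {X} {Y} sx sy = small-↣ (mk↣ {to = graph} λ {f} {g} e → extensionality λ x →
        holds (trans (cong (λ S → S (x , f x)) (sym e)) (isTrue refl))) (small-2^ (small-× sx sy))
      where
      graph : (X → Y) → X × Y → Bool
      graph f (x , y) = truth (y ≡ f x)

-- Renaming, automorphisms, definable sets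

open Equivalence using (to; from)

⇔-refl : ∀ {a} {P : Set a} → P ⇔ P
⇔-refl = mk⇔ id id

⇔-sym : ∀ {a b} {P : Set a} {Q : Set b} → P ⇔ Q → Q ⇔ P
⇔-sym e = mk⇔ (from e) (to e)

infixr 5 _⇔∘_

_⇔∘_ : ∀ {a b c} {P : Set a} {Q : Set b} {R : Set c} → P ⇔ Q → Q ⇔ R → P ⇔ R
e ⇔∘ f = mk⇔ (to f ∘ to e) (from e ∘ from f)

-- Sorts agree only up to `≡`, because the sort of an image is often known by a proof, as for a
-- variable found again in a list. Terms and values are transported along it.
record Ren {ℓ} {S : Set ℓ} (V W : Vars S) : Set ℓ where
  constructor ren
  field
    var↦ : Var V → Var W
    sort : ∀ v → sortOf W (var↦ v) ≡ sortOf V v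

open Ren public

liftRen : ∀ {ℓ} {S : Set ℓ} {V W : Vars S} {s} → Ren V W → Ren (V ▷ s) (W ▷ s)
liftRen ρ = ren (λ { (just v) → just (var↦ ρ v) ; nothing → nothing })
                (λ { (just v) → sort ρ v ; nothing → refl })

module _ {ℓ} {L : Signature ℓ} where

  renTerm : ∀ {V W s} → Ren V W → Term L V s → Term L W s
  renTerm ρ (var v)    = subst (Term L _) (sort ρ v) (var (var↦ ρ v))
  renTerm ρ (app f ts) = app f (λ i → renTerm ρ (ts i))

  rename : ∀ {V W} → Ren V W → Formula L V → Formula L W
  rename ρ (t ≐ᶠ u)   = renTerm ρ t ≐ᶠ renTerm ρ u
  rename ρ (rel r ts) = rel r (λ i → renTerm ρ (ts i))
  rename ρ ⊥ᶠ         = ⊥ᶠ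
  rename ρ (φ ⇒ᶠ ψ)   = rename ρ φ ⇒ᶠ rename ρ ψ
  rename ρ (∀ᶠ s φ)   = ∀ᶠ s (rename (liftRen ρ) φ)

module _ {ℓ} {L : Signature ℓ} (M : Structure L) where

  private
    module C s = Setoid (carrier M s)

  ≋-refl : ∀ {V} {x : Tuple M V} → x ≋ x
  ≋-refl _ = C.refl _

  ≋-sym : ∀ {V} {x y : Tuple M V} → x ≋ y → y ≋ x
  ≋-sym p v = C.sym _ (p v)

  ≋-trans : ∀ {V} {x y z : Tuple M V} → x ≋ y → y ≋ z → x ≋ z
  ≋-trans p q v = C.trans _ (p v) (q v)

  ⋈-cong : ∀ {V W} {x x′ : Tuple M V} {y y′ : Tuple M W} → x ≋ x′ → y ≋ y′ → x ⋈ y ≋ x′ ⋈ y′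
  ⋈-cong p q (inj₁ v) = p v
  ⋈-cong p q (inj₂ v) = q v

  ⋈₁-cong : ∀ {V s} {x x′ : Tuple M V} {e e′ : ∥ M ∥ s} → x ≋ x′ → e ≈[ M ] e′ → x ⋈₁ e ≋ x′ ⋈₁ e′
  ⋈₁-cong p q (just v) = p v
  ⋈₁-cong p q nothing  = q

  eval-cong : ∀ {V s} {x y : Tuple M V} → x ≋ y → (t : Term L V s) → eval M x t ≈[ M ] eval M y t
  eval-cong p (var v)    = p v
  eval-cong p (app f ts) = fun-cong M f (λ i → eval-cong p (ts i))

  ⊨-resp : ∀ {V} (φ : Formula L V) {x y : Tuple M V} → x ≋ y → M ⊨ φ [ x ] → M ⊨ φ [ y ]
  ⊨-resp (t ≐ᶠ u) p e = C.trans _ (C.sym _ (eval-cong p t)) (C.trans _ e (eval-cong p u))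
  ⊨-resp (rel r ts) p h = relation-resp M r (λ i → eval-cong p (ts i)) h
  ⊨-resp ⊥ᶠ p h = h
  ⊨-resp (φ ⇒ᶠ ψ) p h k = ⊨-resp ψ p (h (⊨-resp φ (≋-sym p) k))
  ⊨-resp (∀ᶠ s φ) p h e = ⊨-resp φ (⋈₁-cong p (C.refl _)) (h e)

  ⊨-resp⇔ : ∀ {V} (φ : Formula L V) {x y : Tuple M V} → x ≋ y → M ⊨ φ [ x ] ⇔ M ⊨ φ [ y ]
  ⊨-resp⇔ φ p = mk⇔ (⊨-resp φ p) (⊨-resp φ (≋-sym p))

  pull : ∀ {V W} → Ren V W → Tuple M W → Tuple M V
  pull ρ x = tuple λ v → subst ∥ M ∥ (sort ρ v) (at x (var↦ ρ v))

  eval-subst : ∀ {V s t} (e : s ≡ t) (x : Tuple M V) (u : Term L V s) →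
               eval M x (subst (Term L V) e u) ≡ subst ∥ M ∥ e (eval M x u)
  eval-subst refl x u = refl

  eval-ren : ∀ {V W s} (ρ : Ren V W) (x : Tuple M W) (t : Term L V s) →
             eval M x (renTerm ρ t) ≈[ M ] eval M (pull ρ x) t
  eval-ren ρ x (var v)    = C.reflexive _ (eval-subst (sort ρ v) x (var (var↦ ρ v)))
  eval-ren ρ x (app f ts) = fun-cong M f (λ i → eval-ren ρ x (ts i))

  pull-lift : ∀ {V W s} (ρ : Ren V W) (x : Tuple M W) (e : ∥ M ∥ s) →
              pull (liftRen ρ) (x ⋈₁ e) ≋ pull ρ x ⋈₁ e
  pull-lift ρ x e (just v) = C.refl _
  pull-lift ρ x e nothing  = C.refl _

  ⊨-rename : ∀ {V W} (ρ : Ren V W) (φ : Formula L V) (x : Tuple M W) →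
             M ⊨ rename ρ φ [ x ] ⇔ M ⊨ φ [ pull ρ x ]
  ⊨-rename ρ (t ≐ᶠ u) x = mk⇔
    (λ e → C.trans _ (C.sym _ (eval-ren ρ x t)) (C.trans _ e (eval-ren ρ x u)))
    (λ e → C.trans _ (eval-ren ρ x t) (C.trans _ e (C.sym _ (eval-ren ρ x u))))
  ⊨-rename ρ (rel r ts) x = mk⇔ (relation-resp M r (λ i → eval-ren ρ x (ts i)))
                                (relation-resp M r (λ i → C.sym _ (eval-ren ρ x (ts i))))
  ⊨-rename ρ ⊥ᶠ x = ⇔-refl
  ⊨-rename ρ (φ ⇒ᶠ ψ) x = mk⇔
    (λ h k → to (⊨-rename ρ ψ x) (h (from (⊨-rename ρ φ x) k)))
    (λ h k → from (⊨-rename ρ ψ x) (h (to (⊨-rename ρ φ x) k)))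
  ⊨-rename ρ (∀ᶠ s φ) x = mk⇔
    (λ h e → ⊨-resp φ (pull-lift ρ x e) (to (⊨-rename (liftRen ρ) φ (x ⋈₁ e)) (h e)))
    (λ h e → from (⊨-rename (liftRen ρ) φ (x ⋈₁ e)) (⊨-resp φ (≋-sym (pull-lift ρ x e)) (h e)))

module _ {ℓ} {L : Signature ℓ} {M : Structure L} (σ : Automorphism M) where
  open Automorphism σ
  private
    module C s = Setoid (carrier M s)
    module I s = Inverse (bijection s)

  apply-cong : ∀ {V} {x y : Tuple M V} → x ≋ y → apply x ≋ apply y
  apply-cong p v = I.to-cong _ (p v)

  apply-⋈ : ∀ {V W} (x : Tuple M V) (y : Tuple M W) → apply (x ⋈ y) ≋ apply x ⋈ apply y
  apply-⋈ x y (inj₁ v) = C.refl _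
  apply-⋈ x y (inj₂ v) = C.refl _

  eval-apply : ∀ {V s} (x : Tuple M V) (t : Term L V s) → I.to s (eval M x t) ≈[ M ] eval M (apply x) t
  eval-apply x (var v)    = C.refl _
  eval-apply x (app f ts) = C.trans _ (preserves-fun f _) (fun-cong M f (λ i → eval-apply x (ts i)))

  ⊨-apply : ∀ {V} (φ : Formula L V) (x : Tuple M V) → M ⊨ φ [ x ] ⇔ M ⊨ φ [ apply x ]
  ⊨-apply (t ≐ᶠ u) x = mk⇔
    (λ e → C.trans _ (C.sym _ (eval-apply x t)) (C.trans _ (I.to-cong _ e) (eval-apply x u)))
    (λ e → C.trans _ (C.sym _ (I.strictlyInverseʳ _ _)) (C.trans _
      (I.from-cong _ (C.trans _ (eval-apply x t) (C.trans _ e (C.sym _ (eval-apply x u)))))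
      (I.strictlyInverseʳ _ _)))
  ⊨-apply (rel r ts) x = mk⇔
    (λ h → relation-resp M r (λ i → eval-apply x (ts i)) (to (preserves-rel r _) h))
    (λ h → from (preserves-rel r _) (relation-resp M r (λ i → C.sym _ (eval-apply x (ts i))) h))
  ⊨-apply ⊥ᶠ x = ⇔-refl
  ⊨-apply (φ ⇒ᶠ ψ) x = mk⇔
    (λ h k → to (⊨-apply ψ x) (h (from (⊨-apply φ x) k)))
    (λ h k → from (⊨-apply ψ x) (h (to (⊨-apply φ x) k)))
  ⊨-apply (∀ᶠ s φ) x = mk⇔
    (λ h e → ⊨-resp M φ (λ { (just v) → C.refl _ ; nothing → I.strictlyInverseˡ s e })
               (to (⊨-apply φ (x ⋈₁ I.from s e)) (h (I.from s e))))
    (λ h e → from (⊨-apply φ (x ⋈₁ e))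
               (⊨-resp M φ (λ { (just v) → C.refl _ ; nothing → C.refl _ }) (h (I.to s e))))

module _ {ℓ} {L : Signature ℓ} {M : Structure L} where
  open Automorphism
  private
    module C s = Setoid (carrier M s)

  idAut : Automorphism M
  bijection idAut s = record { to = id ; from = id ; to-cong = id ; from-cong = id ; inverse = id , id }
  preserves-fun idAut f x = C.refl _
  preserves-rel idAut r x = ⇔-refl

  infixr 9 _∘ᴬ_

  _∘ᴬ_ : Automorphism M → Automorphism M → Automorphism M
  bijection (τ ∘ᴬ σ) s = record
    { to = T.to ∘ S.to ; from = S.from ∘ T.from ; to-cong = T.to-cong ∘ S.to-cong
    ; from-cong = S.from-cong ∘ T.from-cong
    ; inverse = (λ p → T.inverseˡ (S.inverseˡ p)) , (λ p → S.inverseʳ (T.inverseʳ p)) }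
    where
    module T = Inverse (bijection τ s)
    module S = Inverse (bijection σ s)
  preserves-fun (τ ∘ᴬ σ) f x =
    C.trans _ (Inverse.to-cong (bijection τ _) (preserves-fun σ f x)) (preserves-fun τ f (apply σ x))
  preserves-rel (τ ∘ᴬ σ) r x = preserves-rel σ r x ⇔∘ preserves-rel τ r (apply σ x)

  infix 10 _⁻¹ᴬ

  _⁻¹ᴬ : Automorphism M → Automorphism M
  bijection (σ ⁻¹ᴬ) s = record
    { to = S.from ; from = S.to ; to-cong = S.from-cong ; from-cong = S.to-cong
    ; inverse = S.inverseʳ , S.inverseˡ }
    where module S = Inverse (bijection σ s)
  preserves-fun (σ ⁻¹ᴬ) f x =
    C.trans _ (Inverse.from-cong (bijection σ _)
      (C.trans _ (fun-cong M f (λ i → C.sym _ (Inverse.strictlyInverseˡ (bijection σ _) (at x i))))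
                 (C.sym _ (preserves-fun σ f _))))
      (Inverse.strictlyInverseʳ (bijection σ _) _)
  preserves-rel (σ ⁻¹ᴬ) r x = mk⇔
    (λ h → from (preserves-rel σ r _)
             (relation-resp M r (λ i → C.sym _ (Inverse.strictlyInverseˡ (bijection σ _) (at x i))) h))
    (λ h → relation-resp M r (λ i → Inverse.strictlyInverseˡ (bijection σ _) (at x i))
             (to (preserves-rel σ r _) h))

  apply-⁻¹ˡ : (σ : Automorphism M) → ∀ {V} (x : Tuple M V) → apply (σ ⁻¹ᴬ) (apply σ x) ≋ x
  apply-⁻¹ˡ σ x v = Inverse.strictlyInverseʳ (bijection σ _) (at x v)

  apply-⁻¹ʳ : (σ : Automorphism M) → ∀ {V} (x : Tuple M V) → apply σ (apply (σ ⁻¹ᴬ) x) ≋ x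
  apply-⁻¹ʳ σ x v = Inverse.strictlyInverseˡ (bijection σ _) (at x v)

  fixes-⁻¹ : (σ : Automorphism M) → ∀ {V} {x : Tuple M V} → apply σ x ≋ x → apply (σ ⁻¹ᴬ) x ≋ x
  fixes-⁻¹ σ {x = x} p = ≋-trans M (apply-cong (σ ⁻¹ᴬ) (≋-sym M p)) (apply-⁻¹ˡ σ x)

-- Elementary substructures and the Tarski-Vaught test

module ElementarySubstructures (cl : Classical) {ℓ} {L : Signature ℓ} (M : Structure L) where
  open Choice cl
  private
    module C s = Setoid (carrier M s)

  underlying : ∀ {U V} {closed : ClosedUnderFunctions M U} → Tuple (substructure M U closed) V → Tuple M V
  underlying x = tuple λ v → proj₁ (at x v)

  TarskiVaught : Subset M → Set (Level.suc ℓ)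
  TarskiVaught U = ∀ {V s} (φ : Formula L (V ▷ s)) (x : Tuple M V) → (∀ v → U (_ , at x v)) →
                   (∃[ e ] M ⊨ φ [ x ⋈₁ e ]) → ∃[ e ] U (_ , e) × M ⊨ φ [ x ⋈₁ e ]

  elementary⇒TarskiVaught : ∀ {U} → IsElementarySubstructure M U → TarskiVaught U
  elementary⇒TarskiVaught {U} el {V} {s} φ x x∈U (e , h) = dne λ n →
    lower (to (elementary (∀ᶠ s (¬ᶠ φ)) y) (λ (e′ , e′∈U) k →
      ⊥-elim (n (e′ , e′∈U , ⊨-resp M φ (shift (e′ , e′∈U)) (to (elementary φ (y ⋈₁ (e′ , e′∈U))) k)))) e h)
    where
    open IsElementarySubstructure el
    y : Tuple (substructure M U closed) V
    y = tuple λ v → at x v , x∈U v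
    shift : ∀ e′ → underlying {closed = closed} (y ⋈₁ e′) ≋ x ⋈₁ proj₁ e′
    shift e′ (just v) = C.refl _
    shift e′ nothing  = C.refl _

  TarskiVaught⇒elementary : ∀ {U} → ClosedUnderFunctions M U → TarskiVaught U → IsElementarySubstructure M U
  TarskiVaught⇒elementary {U} closed tv = record { closed = closed ; elementary = elementary }
    where
    N : Structure L
    N = substructure M U closed
    eval-N : ∀ {V s} (x : Tuple N V) (t : Term L V s) → Eq M (proj₁ (eval N x t))
        (eval M (underlying {closed = closed} x) t)
    eval-N x (var v)    = C.refl _
    eval-N x (app f ts) = fun-cong M f λ i → eval-N x (ts i)
    shift : ∀ {V s} (x : Tuple N V) (e : ∥ N ∥ s) → underlying {closed = closed} (x ⋈₁ e) ≋ underlying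
        {closed = closed} x ⋈₁ proj₁ e
    shift x e (just v) = C.refl _
    shift x e nothing  = C.refl _
    elementary : ∀ {V} (φ : Formula L V) (x : Tuple N V) → N ⊨ φ [ x ] ⇔ M ⊨ φ [ underlying {closed = closed} x ]
    elementary (t ≐ᶠ u) x = mk⇔
      (λ e → C.trans _ (C.sym _ (eval-N x t)) (C.trans _ e (eval-N x u)))
      (λ e → C.trans _ (eval-N x t) (C.trans _ e (C.sym _ (eval-N x u))))
    elementary (rel r ts) x = mk⇔ (relation-resp M r λ i → eval-N x (ts i))
                                  (relation-resp M r λ i → C.sym _ (eval-N x (ts i)))
    elementary ⊥ᶠ x = ⇔-refl
    elementary (φ ⇒ᶠ ψ) x = mk⇔
      (λ h k → to (elementary ψ x) (h (from (elementary φ x) k)))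
      (λ h k → from (elementary ψ x) (h (to (elementary φ x) k)))
    elementary (∀ᶠ s φ) x = mk⇔
      (λ h e → dne λ n →
        let e′ , e′∈U , k = tv (¬ᶠ φ) (underlying {closed = closed} x) (λ v → proj₂ (at x v)) (e , λ p → lift (n p))
        in lower (k (⊨-resp M φ (shift x (e′ , e′∈U)) (to (elementary φ (x ⋈₁ (e′ , e′∈U))) (h (e′ , e′∈U))))))
      (λ h e → from (elementary φ (x ⋈₁ e)) (⊨-resp M φ (≋-sym M (shift x e)) (h (proj₁ e))))

-- Finite supports of formulas

module Supports (cl : Classical) where
  open Choice cl

  -- Membership passes through `truth`, whose proofs are unique: a variable that is listed several
  -- times still counts once.
  sub : ∀ {ℓ} {S : Set ℓ} {V : Vars S} → List (Var V) → Vars S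
  sub {V = V} l = vars (Σ[ v ∈ Var V ] truth (v ∈ l) ≡ true) (λ (v , _) → sortOf V v)

  restrict : ∀ {ℓ} {S : Set ℓ} {C : Carriers S} {V : Vars S} (l : List (Var V)) → TupleOf C V →
      TupleOf C (sub {V = V} l)
  restrict l x = tuple λ (v , _) → at x v

  include : ∀ {ℓ} {S : Set ℓ} {V : Vars S} {l l′ : List (Var V)} → (∀ {v} → v ∈ l → v ∈ l′) →
            Ren (sub {V = V} l) (sub {V = V} l′)
  include i = ren (λ (v , p) → v , isTrue (i (holds p))) (λ _ → refl)

  merge : ∀ {a} {X : Set a} {n} (l : Fin n → List X) → ∃[ l′ ] (∀ i {x} → x ∈ l i → x ∈ l′)
  merge {n = zero}  l = [] , λ ()
  merge {n = suc n} l = let l′ , i = merge (l ∘ suc)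
                        in l zero ++ l′ , λ { zero → ∈-++⁺ˡ ; (suc j) → ∈-++⁺ʳ (l zero) ∘ i j }

  module _ {ℓ} {L : Signature ℓ} where

    private
      SupportT : ∀ {V s} → Term L V s → Set (Level.suc ℓ)
      SupportT {V} {s} t = Σ[ l ∈ List (Var V) ] Σ[ t′ ∈ Term L (sub {V = V} l) s ]
        (∀ M (x : Tuple M V) → eval M x t ≈[ M ] eval M (restrict l x) t′)

      weakenT : ∀ {V s} (t : Term L V s) (σ : SupportT t) {l} → (∀ {v} → v ∈ proj₁ σ → v ∈ l) →
                Σ[ t′ ∈ Term L (sub {V = V} l) s ]
                  (∀ M (x : Tuple M V) → eval M x t ≈[ M ] eval M (restrict l x) t′)
      weakenT {V} t (l₀ , t₀ , e) {l} i = renTerm (include {V = V} i) t₀ , λ M x →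
        Setoid.trans (carrier M _) (e M x) (Setoid.sym (carrier M _)
            (eval-ren M (include {V = V} i) (restrict l x) t₀))

      weakenAll : ∀ {V n} {s : Fin n → Sort L} (t : ∀ i → Term L V (s i)) → (∀ i → SupportT (t i)) →
                  Σ[ l ∈ List (Var V) ] (∀ i → Σ[ t′ ∈ Term L (sub {V = V} l) (s i) ]
                  (∀ M (x : Tuple M V) → eval M x (t i) ≈[ M ] eval M (restrict l x) t′))
      weakenAll t σ = let l , i = merge (proj₁ ∘ σ) in l , λ j → weakenT (t j) (σ j) (i j)

      supportT : ∀ {V s} (t : Term L V s) → SupportT t
      supportT (var v)    = v ∷ [] , var (v , isTrue (here refl)) , λ M x → Setoid.refl (carrier M _)
      supportT (app f ts) =
        let l , t′ = weakenAll (λ i → ts (lift i)) (λ i → supportT (ts (lift i)))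
        in l , app f (λ (lift i) → proj₁ (t′ i)) , λ M x → fun-cong M f λ (lift i) → proj₂ (t′ i) M x

    -- Variable contexts may be infinite, but a formula is a finite tree. The list and the reduced
    -- formula are found by recursion on `φ` alone and serve all structures at once; a quantifier
    -- drops its bound variable from the list.
    support : ∀ {V} (φ : Formula L V) → Σ[ l ∈ List (Var V) ] Σ[ φ′ ∈ Formula L (sub {V = V} l) ]
              (∀ M (x : Tuple M V) → M ⊨ φ [ x ] ⇔ M ⊨ φ′ [ restrict l x ])
    support {V} (t ≐ᶠ u) =
      let l , t₀ , e = supportT t
          m , u₀ , f = supportT u
          t₁ , e₁ = weakenT {V} t (l , t₀ , e) {l ++ m} ∈-++⁺ˡ
          u₁ , f₁ = weakenT {V} u (m , u₀ , f) {l ++ m} (∈-++⁺ʳ l)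
      in l ++ m , t₁ ≐ᶠ u₁ , λ M x → let module C = Setoid (carrier M _) in
        mk⇔ (λ p → C.trans (C.sym (e₁ M x)) (C.trans p (f₁ M x)))
            (λ p → C.trans (e₁ M x) (C.trans p (C.sym (f₁ M x))))
    support (rel r ts) =
      let l , t′ = weakenAll (λ i → ts (lift i)) (λ i → supportT (ts (lift i)))
      in l , rel r (λ (lift i) → proj₁ (t′ i)) , λ M x →
        mk⇔ (relation-resp M r λ (lift i) → proj₂ (t′ i) M x)
            (relation-resp M r λ (lift i) → Setoid.sym (carrier M _) (proj₂ (t′ i) M x))
    support ⊥ᶠ = [] , ⊥ᶠ , λ M x → ⇔-refl
    support {V} (φ ⇒ᶠ ψ) =
      let l , φ₀ , e = support φ
          m , ψ₀ , f = support ψ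
          ρ = include {V = V} {l} {l ++ m} ∈-++⁺ˡ
          ρ′ = include {V = V} {m} {l ++ m} (∈-++⁺ʳ l)
      in l ++ m , (rename ρ φ₀ ⇒ᶠ rename ρ′ ψ₀) , λ M x →
        let e₁ = e M x ⇔∘ ⇔-sym (⊨-rename M ρ φ₀ (restrict (l ++ m) x))
            f₁ = f M x ⇔∘ ⇔-sym (⊨-rename M ρ′ ψ₀ (restrict (l ++ m) x))
        in mk⇔ (λ h k → to f₁ (h (from e₁ k))) (λ h k → from f₁ (h (to e₁ k)))
    support {V} (∀ᶠ s φ) =
      let l , φ₀ , e = support φ
          ρ : Ren (sub {V = V ▷ s} l) (sub {V = V} (mapMaybe id l) ▷ s)
          ρ = ren (λ { (just v , p) → just (v , isTrue (justs l (holds p))) ; (nothing , p) → nothing })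
                  (λ { (just v , p) → refl ; (nothing , p) → refl })
      in mapMaybe id l , ∀ᶠ s (rename ρ φ₀) , λ M x →
        let eq : ∀ a → restrict {V = V ▷ s} l (x ⋈₁ a) ≋ pull M ρ (restrict {V = V} (mapMaybe id l) x ⋈₁ a)
            eq a = λ { (just v , p) → Setoid.refl (carrier M _) ; (nothing , p) → Setoid.refl (carrier M _) }
            e₁ = λ a → e M (x ⋈₁ a) ⇔∘ ⊨-resp⇔ M φ₀ (eq a) ⇔∘ ⇔-sym (⊨-rename M ρ φ₀ _)
        in mk⇔ (λ h a → to (e₁ a) (h a)) (λ h a → from (e₁ a) (h a))
      where
      justs : ∀ l {v} → just v ∈ l → v ∈ mapMaybe id l
      justs (just v  ∷ l) (here refl) = here refl
      justs (just v  ∷ l) (there p)   = there (justs l p)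
      justs (nothing ∷ l) (there p)   = justs l p

    -- Positions in the list serve as variables, which makes `φ` fit where finite arities are
    -- demanded: in the relation symbols of the torsor, in Skolem functions and in the independence
    -- property.
    support-fin : ∀ {V} (φ : Formula L V) →
      Σ[ n ∈ ℕ ] Σ[ v ∈ (Fin n → Var V) ] Σ[ φ′ ∈ Formula L (fin (n , λ i → sortOf V (v i))) ]
        (∀ M (x : Tuple M V) → M ⊨ φ [ x ] ⇔ M ⊨ φ′ [ tuple (λ (lift i) → at x (v i)) ])
    support-fin {V} φ =
      let l , φ₀ , e = support φ
          ρ : Ren (sub {V = V} l) (fin (length l , λ i → sortOf V (lookup l i)))
          ρ = ren (λ (v , p) → lift (Any.index (holds p)))
                  (λ (v , p) → cong (sortOf V) (sym (lookup-index (holds p))))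
      in length l , lookup l , rename ρ φ₀ , λ M x →
        e M x ⇔∘ ⊨-resp⇔ M φ₀ (λ (v , p) → Setoid.reflexive (carrier M _)
                                  (moved M x (sym (lookup-index (holds p)))))
              ⇔∘ ⇔-sym (⊨-rename M ρ φ₀ _)
      where
      moved : ∀ M (x : Tuple M V) {u v} (q : u ≡ v) → at x v ≡ subst ∥ M ∥ (cong (sortOf V) q) (at x u)
      moved M x refl = refl

-- Relations definable over a tuple of parameters

module Definability (cl : Classical) {ℓ} {L : Signature ℓ} (M : Structure L) where
  open Choice cl
  open Supports cl

  private
    module C s = Setoid (carrier M s)

  -- ι x is the tuple that represents x.
  record Cut {a p} {X : Set a} {V : Vars (Sort L)} (ι : X → Tuple M V) (R : Pred X p) : Set (a ⊔ ℓ ⊔ p) where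
    constructor cut
    field
      formula : Formula L V
      defines : ∀ x → R x ⇔ M ⊨ formula [ ι x ]

  open Cut public

  module _ {a} {X : Set a} {V : Vars (Sort L)} {ι : X → Tuple M V} where

    private variable
      p q : Level
      D : Pred X p
      E : Pred X q

    def-resp : Cut ι D → ∀ {x y} → ι x ≋ ι y → D x → D y
    def-resp (cut φ e) p d = from (e _) (⊨-resp M φ p (to (e _) d))

    def-⇔ : (∀ x → D x ⇔ E x) → Cut ι D → Cut ι E
    def-⇔ f (cut φ e) = cut φ λ x → ⇔-sym (f x) ⇔∘ e x

    def-⇒ : Cut ι D → Cut ι E → Cut ι (λ x → D x → E x)
    def-⇒ (cut φ e) (cut ψ f) = cut (φ ⇒ᶠ ψ) λ x →
      mk⇔ (λ h k → to (f x) (h (from (e x) k))) (λ h k → from (f x) (h (to (e x) k)))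

    def-const : (P : Set p) → Cut ι (λ _ → P)
    def-const P with dec P
    ... | yes p = cut (⊥ᶠ ⇒ᶠ ⊥ᶠ) λ x → mk⇔ (λ _ → id) (λ _ → p)
    ... | no n  = cut ⊥ᶠ λ x → mk⇔ (λ p → ⊥-elim (n p)) (λ ())

    def-¬ : Cut ι D → Cut ι (λ x → ¬ D x)
    def-¬ d = def-⇒ d (def-const ⊥)

    def-⊎ : Cut ι D → Cut ι E → Cut ι (λ x → D x ⊎ E x)
    def-⊎ d e = def-⇔ (λ x → mk⇔ (λ h → dne λ n → n (inj₂ (h λ d → n (inj₁ d))))
                                 [ (λ d n → ⊥-elim (n d)) , (λ e _ → e) ]′)
                  (def-⇒ (def-¬ d) e)

    def-× : Cut ι D → Cut ι E → Cut ι (λ x → D x × E x)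
    def-× d e = def-⇔ (λ x → mk⇔ (λ h → dne (λ n → h λ a b → n (a , b))) λ (a , b) h → h a b)
                  (def-¬ (def-⇒ d (def-¬ e)))

    def-all : ∀ {i} {I : Set i} {D : I → Pred X p} → (∀ i → Cut ι (D i)) →
              (l : List I) → Cut ι (λ x → All (λ i → D i x) l)
    def-all d []      = def-⇔ (λ x → mk⇔ (λ _ → []) (λ _ → _)) (def-const ⊤)
    def-all d (i ∷ l) = def-⇔ (λ x → mk⇔ (λ (p , ps) → p ∷ ps) λ { (p ∷ ps) → p , ps })
                          (def-× (d i) (def-all d l))

    def-Fin : ∀ {n} {D : Fin n → Pred X p} → (∀ i → Cut ι (D i)) → Cut ι (λ x → ∀ i → D i x)
    def-Fin {n = zero}  d = def-⇔ (λ x → mk⇔ (λ _ ()) (λ _ → _)) (def-const ⊤)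
    def-Fin {n = suc n} d =
      def-⇔ (λ x → mk⇔ (λ { (p , ps) zero → p ; (p , ps) (suc i) → ps i }) λ h → h zero , h ∘ suc)
        (def-× (d zero) (def-Fin (d ∘ suc)))

  Def : ∀ {p} {W} (w : Tuple M W) (V : Vars (Sort L)) → Pred (Tuple M V) p → Set (ℓ ⊔ p)
  Def w V = Cut {V = V ⊕ _} (_⋈ w)

  private variable
    p q : Level
    V V′ W W′ U : Vars (Sort L)
    w : Tuple M W
    w′ : Tuple M W′
    D : Pred (Tuple M V) p

  def-respᵗ : Def w V D → ∀ {x y} → x ≋ y → D x → D y
  def-respᵗ d p = def-resp d (⋈-cong M p (≋-refl M))

  def-≈ : (v v′ : Var (V ⊕ W)) (e : sortOf (V ⊕ W) v ≡ sortOf (V ⊕ W) v′) →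
          Def w V (λ x → Eq M (subst ∥ M ∥ e (at (x ⋈ w) v)) (at (x ⋈ w) v′))
  def-≈ {V = V} {W = W} {w = w} v v′ e = cut (subst (Term L (V ⊕ W)) e (var v) ≐ᶠ var v′) λ x →
    let q = C.reflexive _ (eval-subst M e (x ⋈ w) (var v))
    in mk⇔ (C.trans _ q) (C.trans _ (C.sym _ q))

  def-subst : Def w V D → (ρ : Ren (V ⊕ W) (V′ ⊕ W′)) (f : Tuple M V′ → Tuple M V) →
              (∀ x → f x ⋈ w ≋ pull M ρ (x ⋈ w′)) → Def w′ V′ (λ x → D (f x))
  def-subst (cut φ e) ρ f eq = cut (rename ρ φ) λ x →
    e (f x) ⇔∘ ⊨-resp⇔ M φ (eq x) ⇔∘ ⇔-sym (⊨-rename M ρ φ _)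

  def-pull : (ρ : Ren V V′) → Def w V D → Def w V′ (λ x → D (pull M ρ x))
  def-pull ρ d = def-subst d
    (ren (λ { (inj₁ v) → inj₁ (var↦ ρ v) ; (inj₂ v) → inj₂ v }) (λ { (inj₁ v) → sort ρ v ; (inj₂ v) → refl }))
    (pull M ρ) (λ { x (inj₁ v) → C.refl _ ; x (inj₂ v) → C.refl _ })

  def-∀₁ : ∀ {W V s} {w : Tuple M W} {D : Pred (Tuple M (V ▷ s)) p} → Def w (V ▷ s) D →
      Def w V (λ x → ∀ e → D (x ⋈₁ e))
  def-∀₁ {W = W} {V = V} {s = s} {w = w} (cut φ e) = cut (∀ᶠ s (rename ρ φ)) λ x →
    mk⇔ (λ h a → to (eq x a) (h a)) (λ h a → from (eq x a) (h a))
    where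
    ρ : Ren ((V ▷ s) ⊕ W) ((V ⊕ W) ▷ s)
    ρ = ren (λ { (inj₁ (just v)) → just (inj₁ v) ; (inj₁ nothing) → nothing ; (inj₂ v) → just (inj₂ v) })
            (λ { (inj₁ (just v)) → refl ; (inj₁ nothing) → refl ; (inj₂ v) → refl })
    eq : ∀ x a → _ ⇔ _
    eq x a = e (x ⋈₁ a) ⇔∘
      ⊨-resp⇔ M φ (λ { (inj₁ (just v)) → C.refl _ ; (inj₁ nothing) → C.refl _ ; (inj₂ v) → C.refl _ })
      ⇔∘ ⇔-sym (⊨-rename M ρ φ (x ⋈ w ⋈₁ a))

  def-∃₁ : ∀ {s} {D : Pred (Tuple M (V ▷ s)) p} → Def w (V ▷ s) D → Def w V (λ x → ∃[ e ] D (x ⋈₁ e))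
  def-∃₁ d = def-⇔ (λ x → mk⇔ (λ h → dne λ n → h λ e k → n (e , k)) λ (e , k) h → h e k)
               (def-¬ (def-∀₁ (def-¬ d)))

  private
    module _ {U : Vars (Sort L)} where

      -- One quantifier for each list entry. If `v₀` occurs again in the tail, `target` still reads
      -- it from the outer quantifier, and the repeated one is idle.
      def-∃sub : (l : List (Var U)) {V W : Vars (Sort L)} {w : Tuple M W} {D : Pred (Tuple M (V ⊕ sub {V = U} l)) p} →
                 Def w (V ⊕ sub {V = U} l) D →
                 Def w V (λ x → ∃[ u ] D (x ⋈ u))
      def-∃sub [] {V} {D = D} d =
        def-⇔ (λ x → mk⇔ (λ k → nil , def-respᵗ d (eq₁ x) k) λ (u , k) → def-respᵗ d (eq₂ x u) k)
          (def-pull ρ d)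
        where
        none : ∀ {a} {A : Set a} {v : Var U} → truth (v ∈ []) ≡ true → A
        none {v = v} p with holds {P = v ∈ []} p
        ... | ()
        nil : Tuple M (sub {V = U} [])
        nil = tuple λ (v , p) → none {v = v} p
        ρ : Ren (V ⊕ sub {V = U} []) V
        ρ = ren (λ { (inj₁ v) → v ; (inj₂ (v , p)) → none {v = v} p })
                (λ { (inj₁ v) → refl ; (inj₂ (v , p)) → none {v = v} p })
        eq₁ : ∀ x → pull M ρ x ≋ x ⋈ nil
        eq₁ x (inj₁ v)       = C.refl _
        eq₁ x (inj₂ (v , p)) = none {v = v} p
        eq₂ : ∀ x u → x ⋈ u ≋ pull M ρ x
        eq₂ x u (inj₁ v)       = C.refl _
        eq₂ x u (inj₂ (v , p)) = none {v = v} p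
      def-∃sub (v₀ ∷ l) {V} {D = D} d =
        def-⇔ {D = λ x → ∃[ e ] ∃[ u ] D (pull M ρ (x ⋈₁ e ⋈ u))}
              (λ x → mk⇔ (λ (e , u , k) → extend e u , def-respᵗ d (eq₁ x e u) k)
                         (λ (u , k) → at u (v₀ , isTrue (here refl)) ,
                             tuple (λ (v , p) → at u (v , isTrue (there (holds p)))) ,
                                      def-respᵗ d (eq₂ x u) k))
          step
        where
        s₀ = sortOf U v₀
        tail : ∀ {v} → ¬ v ≡ v₀ → truth (v ∈ v₀ ∷ l) ≡ true → truth (v ∈ l) ≡ true
        tail {v} n p with holds {P = v ∈ v₀ ∷ l} p
        ... | here e  = ⊥-elim (n e)
        ... | there q = isTrue q
        target : (v : Var U) → truth (v ∈ v₀ ∷ l) ≡ true →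
                 Σ[ t ∈ Var ((V ▷ s₀) ⊕ sub {V = U} l) ] sortOf ((V ▷ s₀) ⊕ sub {V = U} l) t ≡ sortOf U v
        target v p with dec (v ≡ v₀)
        ... | yes refl = inj₁ nothing , refl
        ... | no n     = inj₂ (v , tail n p) , refl
        ρ : Ren (V ⊕ sub {V = U} (v₀ ∷ l)) ((V ▷ s₀) ⊕ sub {V = U} l)
        ρ = ren (λ { (inj₁ v) → inj₁ (just v) ; (inj₂ (v , p)) → proj₁ (target v p) })
                (λ { (inj₁ v) → refl ; (inj₂ (v , p)) → proj₂ (target v p) })
        step : Def _ V (λ x → ∃[ e ] ∃[ u ] D (pull M ρ (x ⋈₁ e ⋈ u)))
        step = def-∃₁ {D = λ y → ∃[ u ] D (pull M ρ (y ⋈ u))} (def-∃sub l (def-pull ρ d))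
        extend : ∥ M ∥ s₀ → Tuple M (sub {V = U} l) → Tuple M (sub {V = U} (v₀ ∷ l))
        at (extend e u) (v , p) with dec (v ≡ v₀)
        ... | yes refl = e
        ... | no n     = at u (v , tail n p)
        eq₁ : ∀ x e u → pull M ρ (x ⋈₁ e ⋈ u) ≋ x ⋈ extend e u
        eq₁ x e u (inj₁ v) = C.refl _
        eq₁ x e u (inj₂ (v , p)) with dec (v ≡ v₀)
        ... | yes refl = C.refl _
        ... | no n     = C.refl _
        eq₂ : ∀ x u → x ⋈ u ≋ pull M ρ (x ⋈₁ at u (v₀ , isTrue (here refl)) ⋈ tuple
            (λ (v , p) → at u (v , isTrue (there (holds p)))))
        eq₂ x u (inj₁ v) = C.refl _
        eq₂ x u (inj₂ (v , p)) with dec (v ≡ v₀)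
        ... | yes refl = C.reflexive _ (cong (λ q → at u (v , q)) (UIP _ _))
        ... | no n     = C.reflexive _ (cong (λ q → at u (v , q)) (UIP _ _))

  private
    -- A formula mentions only finitely many of the variables U; the default values u₀ guard against empty sorts
    -- among the others.
    ∃-over : ∀ {W V U} {w : Tuple M W} (u₀ : Tuple M U) {D : Pred (Tuple M (V ⊕ U)) p} → Def w (V ⊕ U) D →
        Def w V (λ x → ∃[ u ] D (x ⋈ u))
    ∃-over {W = W} {V = V} {U = U} {w = w} u₀ {D} (cut φ e) =
      def-⇔ (λ x → mk⇔ (λ (u , k) → extend u , from (eq x (extend u))
                           (⊨-resp M φ₁ (⋈-cong M (⋈-cong M (≋-refl M) (extends u)) (≋-refl M)) k))
                       (λ (u , k) → restrict lU u , to (eq x u) k))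
        (def-∃sub {U = U} lU {V = V} {w = w} {D = λ y → M ⊨ φ₁ [ y ⋈ w ]} (cut φ₁ λ y → ⇔-refl))
      where
      l  = proj₁ (support φ)
      φ₀ = proj₁ (proj₂ (support φ))
      pick : List (Var (V ⊕ U ⊕ W)) → List (Var U)
      pick []                  = []
      pick (inj₁ (inj₁ _) ∷ l) = pick l
      pick (inj₁ (inj₂ u) ∷ l) = u ∷ pick l
      pick (inj₂ _ ∷ l)        = pick l
      picked : ∀ l {u} → inj₁ (inj₂ u) ∈ l → u ∈ pick l
      picked (inj₁ (inj₁ _) ∷ l) (there p)   = picked l p
      picked (inj₁ (inj₂ u) ∷ l) (here refl) = here refl
      picked (inj₁ (inj₂ u) ∷ l) (there p)   = there (picked l p)
      picked (inj₂ _ ∷ l)        (there p)   = picked l p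
      lU = pick l
      ρ : Ren (sub {V = V ⊕ U ⊕ W} l) (V ⊕ sub {V = U} lU ⊕ W)
      ρ = ren (λ { (inj₁ (inj₁ v) , p) → inj₁ (inj₁ v) ; (inj₁ (inj₂ u) , p) →
          inj₁ (inj₂ (u , isTrue (picked l (holds p))))
                 ; (inj₂ v , p) → inj₂ v })
              (λ { (inj₁ (inj₁ v) , p) → refl ; (inj₁ (inj₂ u) , p) → refl ; (inj₂ v , p) → refl })
      φ₁ = rename ρ φ₀
      eq : ∀ x u → D (x ⋈ u) ⇔ M ⊨ φ₁ [ x ⋈ restrict lU u ⋈ w ]
      eq x u = e (x ⋈ u) ⇔∘ proj₂ (proj₂ (support φ)) M (x ⋈ u ⋈ w) ⇔∘
        ⊨-resp⇔ M φ₀ (λ { (inj₁ (inj₁ v) , p) → C.refl _ ; (inj₁ (inj₂ u) , p) → C.refl _ ; (inj₂ v , p) → C.refl _ })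
        ⇔∘ ⇔-sym (⊨-rename M ρ φ₀ (x ⋈ restrict lU u ⋈ w))
      extend : Tuple M (sub {V = U} lU) → Tuple M U
      at (extend u) v with dec (v ∈ lU)
      ... | yes p = at u (v , isTrue p)
      ... | no _  = at u₀ v
      extends : ∀ u → u ≋ restrict lU (extend u)
      extends u (v , p) with dec (v ∈ lU)
      ... | yes q = C.reflexive _ (cong (λ r → at u (v , r)) (UIP _ _))
      ... | no n  = ⊥-elim (n (holds p))

  abstract
    def-∃ : ∀ {W V U} {w : Tuple M W} (u₀ : Tuple M U) {D : Pred (Tuple M (V ⊕ U)) p} → Def w (V ⊕ U) D →
        Def w V (λ x → ∃[ u ] D (x ⋈ u))
    def-∃ = ∃-over

-- Compactness

module Compactness (cl : Classical) {ℓ} {L : Signature ℓ} {T : Theory L} {κ : Cardinal ℓ}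
                   {ℭ : Structure L} (monster : IsMonster T κ ℭ) where
  open Choice cl
  open Supports cl
  open Cardinality cl
  open Definability cl ℭ
  open IsMonster monster

  small-ℕ : setoid (Lift ℓ ℕ) <ᶜ κ
  small-ℕ = ≤<-trans {X = setoid (Lift ℓ ℕ)} {∣ T ∣ᵀ} {κ} (mk-embed (inj₁ ∘ lower) λ { refl → refl }) ∣T∣<κ
    where
    mk-embed : ∀ {X Y : Set ℓ} (f : X → Y) → (∀ {x y} → f x ≡ f y → x ≡ y) → setoid X ≤ᶜ setoid Y
    mk-embed f inj = mk↣ inj

  open SmallSets κ strongLimit small-ℕ public

  private
    module C s = Setoid (carrier ℭ s)

  saturated₁ : ∀ {p} {U s} {u : Tuple ℭ U} → Small (Var U) →
               {I : Set ℓ} {D : I → Pred (Tuple ℭ (single s)) p} → (∀ i → Def u (single s) (D i)) →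
               (∀ is → ∃[ x ] All (λ i → D i x) is) → ∃[ x ] (∀ i → D i x)
  saturated₁ {U = U} {s} {u} small {I} {D} d sat = x , λ i → from (holds⇔ i x) (realizes _ (i , refl))
    where
    A : Subset ℭ
    A e = ∃[ v ] e ≡ (sortOf U v , at u v)
    ρ : Ren (single s ⊕ U) (single s ⊕ params ℭ A)
    ρ = ren (λ { (inj₁ v) → inj₁ v ; (inj₂ v) → inj₂ ((sortOf U v , at u v) , v , refl) })
            (λ { (inj₁ v) → refl ; (inj₂ v) → refl })
    φ : I → FormulaOver ℭ A (single s)
    φ i = rename ρ (formula (d i))
    holds⇔ : ∀ i x → D i x ⇔ Holds ℭ A (φ i) x
    holds⇔ i x = defines (d i) x ⇔∘ ⊨-resp⇔ ℭ (formula (d i)) (λ { (inj₁ v) → C.refl _ ; (inj₂ v) → C.refl _ })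
                 ⇔∘ ⇔-sym (⊨-rename ℭ ρ (formula (d i)) _)
    small-A : ∣ ℭ ∋ A ∣ <ᶜ κ
    small-A = ≤<-trans {X = ∣ ℭ ∋ A ∣} {setoid (Var U)} {κ}
      (surjection⇒≤ ∣ ℭ ∋ A ∣ (λ v → (sortOf U v , at u v) , v , refl)
        λ { (_ , v , refl) → v , same (C.refl _) }) small
    type : Pred (FormulaOver ℭ A (single s)) ℓ
    type ψ = ∃[ i ] ψ ≡ φ i
    indices : ∀ {Φ} → All type Φ → ∃[ is ] (∀ {x} → All (λ i → D i x) is → All (λ ψ → Holds ℭ A ψ x) Φ)
    indices []                = [] , λ _ → []
    indices ((i , refl) ∷ ts) = let is , h = indices ts
                                in i ∷ is , λ { (k ∷ ks) → to (holds⇔ i _) k ∷ h ks }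
    realized : Realized ℭ A type
    realized = saturated A small-A s type λ Φ ts →
      let is , h = indices ts ; x , k = sat is in x , h k
    x = proj₁ realized
    realizes = proj₂ realized

  module _ {p V W} {w : Tuple ℭ W} (small-V : Small (Var V)) (small-W : Small (Var W))
           {I : Set ℓ} {D : I → Pred (Tuple ℭ V) p} (d : ∀ i → Def w V (D i))
           (sat : ∀ is → ∃[ x ] All (λ i → D i x) is) where

    private
      Entry : Set ℓ
      Entry = Σ[ v ∈ Var V ] ∥ ℭ ∥ (sortOf V v)

      Agrees : Tuple ℭ V → Entry → Set ℓ
      Agrees x (v , e) = Eq ℭ (at x v) e

      Consistent : List Entry → Set (ℓ ⊔ p)
      Consistent l = (∀ {a b} → a ∈ l → b ∈ l → proj₁ a ≡ proj₁ b → a ≡ b) ×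
                     (∀ is → ∃[ x ] All (λ i → D i x) is × All (Agrees x) l)

      -- By saturation in one variable a maximal finitely consistent partial assignment is total.
      max = tukey Consistent ((λ ()) , λ is → let x , h = sat is in x , h , [])
      S : Entry → Bool
      S = proj₁ max

      good : ∀ l → All (S ∋_) l → Consistent l
      good = proj₁ (proj₂ max)

      maximal : ∀ a → (∀ l → All (λ b → S ∋ b ⊎ b ≡ a) l → Consistent l) → S ∋ a
      maximal = proj₂ (proj₂ max)

      functional : ∀ {a b} → S ∋ a → S ∋ b → proj₁ a ≡ proj₁ b → a ≡ b
      functional p q = proj₁ (good _ (p ∷ q ∷ [])) (here refl) (there (here refl))

      assigned : Vars (Sort L)
      assigned = vars (Σ[ a ∈ Entry ] S a ≡ true) λ ((v , _) , _) → sortOf V v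

      value : Tuple ℭ assigned
      value = tuple λ ((_ , e) , _) → e

      small-assigned : Small (Var assigned)
      small-assigned = small-↣ (mk↣ {to = λ ((v , _) , _) → v} λ {a} {b} e →
        Σ-≡ (functional (proj₂ a) (proj₂ b) e)) small-V

      module Extend (v : Var V) where

        Extendable : List I × List (Var assigned) → Pred (Tuple ℭ (single (sortOf V v))) (ℓ ⊔ p)
        Extendable (is , as) y = ∃[ x ] All (λ i → D i x) is × All (λ (a , _) → Agrees x a) as ×
            Eq ℭ (at x v) (at y _)

        extendable-def : ∀ j → Def (w ⋈ value) (single (sortOf V v)) (Extendable j)
        extendable-def (is , as) = def-∃ (proj₁ (sat [])) (def-× inD
            (def-× agrees (def-≈ (inj₁ (inj₂ v)) (inj₁ (inj₁ _)) refl)))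
          where
          inD : Def (w ⋈ value) (single (sortOf V v) ⊕ V) (λ y → All (λ i → D i (tuple λ v → at y (inj₂ v))) is)
          inD = def-subst (def-all d is)
            (ren (λ { (inj₁ v) → inj₁ (inj₂ v) ; (inj₂ v) → inj₂ (inj₁ v) })
                (λ { (inj₁ v) → refl ; (inj₂ v) → refl }))
            (λ y → tuple λ v → at y (inj₂ v)) (λ { y (inj₁ v) → C.refl _ ; y (inj₂ v) → C.refl _ })
          agrees : Def (w ⋈ value) (single (sortOf V v) ⊕ V) (λ y →
              All (λ (a , _) → Agrees (tuple λ v → at y (inj₂ v)) a) as)
          agrees = def-all (λ (a , q) → def-≈ (inj₁ (inj₂ (proj₁ a))) (inj₂ (inj₂ (a , q))) refl) as

        -- Each condition hides its own witness tuple. A witness for the concatenated lists serves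
        -- all of them, so finitely many conditions reduce to one.
        collect : ∀ js → ∃[ j ] (∀ {y} → Extendable j y → All (λ j → Extendable j y) js)
        collect []               = ([] , []) , λ _ → []
        collect ((is , as) ∷ js) =
          let (is′ , as′) , h = collect js
          in (is ++ is′ , as ++ as′) , λ (x , p , q , r) →
               (x , Allₚ.++⁻ˡ is p , Allₚ.++⁻ˡ as q , r) ∷ h (x , Allₚ.++⁻ʳ is p , Allₚ.++⁻ʳ as q , r)

        all-S : ∀ (as : List (Var assigned)) → All (S ∋_) (map proj₁ as)
        all-S []             = []
        all-S ((_ , p) ∷ as) = p ∷ all-S as

        satisfiable : ∀ js → ∃[ y ] All (λ j → Extendable j y) js
        satisfiable js =
          let (is , as) , h = collect js
              x , p , q = proj₂ (good (map proj₁ as) (all-S as)) is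
          in tuple (λ _ → at x v) , h (x , p , Allₚ.map⁻ q , C.refl _)

        module _ (new : ¬ (∃[ e ] S ∋ (v , e))) (e : ∥ ℭ ∥ (sortOf V v))
                 (ext : ∀ j → Extendable j (tuple λ _ → e)) where

          Extended : Entry → Set ℓ
          Extended a = S ∋ a ⊎ a ≡ (v , e)

          unique : ∀ {a b} → Extended a → Extended b → proj₁ a ≡ proj₁ b → a ≡ b
          unique (inj₁ p)    (inj₁ q)    r    = functional p q r
          unique (inj₁ p)    (inj₂ refl) refl = ⊥-elim (new (_ , p))
          unique (inj₂ refl) (inj₁ q)    refl = ⊥-elim (new (_ , q))
          unique (inj₂ refl) (inj₂ refl) r    = refl

          entries : ∀ {l} → All Extended l → List (Var assigned)
          entries []              = []
          entries (inj₁ p ∷ ps)   = (_ , p) ∷ entries ps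
          entries (inj₂ _ ∷ ps)   = entries ps

          entries-agree : ∀ {l} (ps : All Extended l) {x} → All (λ (a , _) → Agrees x a) (entries ps) →
                          Eq ℭ (at x v) e → All (Agrees x) l
          entries-agree []               ks       r = []
          entries-agree (inj₁ p ∷ ps)    (k ∷ ks) r = k ∷ entries-agree ps ks r
          entries-agree (inj₂ refl ∷ ps) ks       r = r ∷ entries-agree ps ks r

          consistent : ∀ l → All Extended l → Consistent l
          consistent l ps = (λ p q → unique (All.lookup ps p) (All.lookup ps q)) , λ is →
              agree (ext (is , entries ps))
            where
            agree : ∀ {is} → Extendable (is , entries ps) (tuple λ _ → e) →
                    ∃[ x ] All (λ i → D i x) is × All (Agrees x) l
            agree (x , k , k′ , r) = x , k , entries-agree ps k′ r

        defined : ∃[ e ] S ∋ (v , e)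
        defined with dec (∃[ e ] S ∋ (v , e))
        ... | yes p  = p
        ... | no new = extend (saturated₁ (small-⊎ small-W small-assigned) {D = Extendable} extendable-def
            satisfiable)
          where
          extend : (∃[ y ] (∀ j → Extendable j y)) → ∃[ e ] S ∋ (v , e)
          extend (y , ext) = at y _ , maximal (v , at y _) (consistent new (at y _) ext)

      solution : Tuple ℭ V
      solution = tuple λ v → proj₁ (Extend.defined v)

      -- The formula of `D i` mentions only finitely many variables; on these the solution agrees
      -- with some tuple that satisfies `D i`, by finite consistency.
      solves : ∀ i → D i solution
      solves i = finish (proj₂ (good (map (λ v → v , at solution v) vs)
                           (Allₚ.map⁺ (All.universal (λ v → proj₂ (Extend.defined v)) vs))) (i ∷ []))
        where
        φ = formula (d i)
        l = proj₁ (support φ)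
        φ₀ = proj₁ (proj₂ (support φ))
        pick : List (Var (V ⊕ W)) → List (Var V)
        pick []           = []
        pick (inj₁ v ∷ l) = v ∷ pick l
        pick (inj₂ _ ∷ l) = pick l
        picked : ∀ l {v} → inj₁ v ∈ l → v ∈ pick l
        picked (inj₁ v ∷ l) (here refl) = here refl
        picked (inj₁ v ∷ l) (there p)   = there (picked l p)
        picked (inj₂ _ ∷ l) (there p)   = picked l p
        vs = pick l
        reduce : ∀ x → D i x ⇔ ℭ ⊨ φ₀ [ restrict l (x ⋈ w) ]
        reduce x = defines (d i) x ⇔∘ proj₂ (proj₂ (support φ)) ℭ (x ⋈ w)
        finish : (∃[ x ] All (λ i → D i x) (i ∷ []) × All (Agrees x) (map (λ v → v , at solution v) vs)) →
            D i solution
        finish (x , k ∷ [] , agree) = from (reduce solution) (⊨-resp ℭ φ₀ eq (to (reduce x) k))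
          where
          eq : restrict l (x ⋈ w) ≋ restrict l (solution ⋈ w)
          eq (inj₁ v , p) = All.lookup (Allₚ.map⁻ agree) (picked l (holds p))
          eq (inj₂ v , p) = C.refl _

    abstract
      compactness : ∃[ x ] (∀ i → D i x)
      compactness = solution , solves

-- Groups over a tuple of parameters

length-filters : ∀ {a p} {X : Set a} {P : Pred X p} (P? : Decidable P) (l : List X) →
                 length (filter P? l) + length (filter (λ x → ¬? (P? x)) l) ≡ length l
length-filters P? []      = refl
length-filters P? (x ∷ l) with P? x
... | yes _ = cong suc (length-filters P? l)
... | no _  = trans (ℕₚ.+-suc (length (filter P? l)) _) (cong suc (length-filters P? l))

module Ramsey (cl : Classical) {a p} {X : Set a} (A B : X → X → Set p) where
  open Choice cl

  Homogeneous : (X → X → Set p) → ℕ → List X → Set (a ⊔ p)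
  Homogeneous R n l = ∃[ l′ ] (∀ {x} → x ∈ l′ → x ∈ l) × AllPairs R l′ × n ≤ length l′

  -- `A` and `B` need not be symmetric; the order of the list decides their direction. The tail is
  -- split into the entries related by `A` to the head and the rest, and one part is long enough for
  -- the induction.
  ramsey : ∀ m n → ∃[ N ] (∀ l → AllPairs (λ x y → A x y ⊎ B x y) l → N ≤ length l →
           Homogeneous A m l ⊎ Homogeneous B n l)
  ramsey zero    n       = 0 , λ l _ _ → inj₁ ([] , (λ ()) , [] , z≤n)
  ramsey (suc m) zero    = 0 , λ l _ _ → inj₂ ([] , (λ ()) , [] , z≤n)
  ramsey (suc m) (suc n) = suc (N₁ + N₂) , find
    where
    N₁ = proj₁ (ramsey m (suc n))
    N₂ = proj₁ (ramsey (suc m) n)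
    find : ∀ l → AllPairs (λ x y → A x y ⊎ B x y) l → suc (N₁ + N₂) ≤ length l →
           Homogeneous A (suc m) l ⊎ Homogeneous B (suc n) l
    find (x ∷ l) (c ∷ cs) (s≤s le) = choose-side (N₁ ℕₚ.≤? length (filter near? l))
      where
      near? = λ y → dec (A x y)
      far? = λ y → ¬? (near? y)
      far : All (B x) (filter far? l)
      far = All.zipWith (λ { (inj₁ p , n) → ⊥-elim (n p) ; (inj₂ q , _) → q })
              (Allₚ.filter⁺ far? c , Allₚ.all-filter far? l)
      stay : ∀ {R n k} → (∀ {y} → y ∈ k → y ∈ l) → Homogeneous R n k → Homogeneous R n (x ∷ l)
      stay i (h , u , v , z) = h , there ∘ i ∘ u , v , z
      grow : ∀ {R n k} → (∀ {y} → y ∈ k → y ∈ l) → All (R x) k → Homogeneous R n k → Homogeneous R (suc n) (x ∷ l)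
      grow i q (h , u , v , z) =
        x ∷ h , (λ { (here e) → here e ; (there y) → there (i (u y)) }) , All.tabulate (All.lookup q ∘ u) ∷ v , s≤s z
      choose-side : Dec (N₁ ≤ length (filter near? l)) → Homogeneous A (suc m) (x ∷ l) ⊎ Homogeneous B (suc n) (x ∷ l)
      choose-side (yes le₁) = [ inj₁ ∘ grow sub (Allₚ.all-filter near? l) , inj₂ ∘ stay sub ]′
          (proj₂ (ramsey m (suc n)) (filter near? l) (AllPairsₚ.filter⁺ near? cs) le₁)
        where
        sub : ∀ {y} → y ∈ filter near? l → y ∈ l
        sub = proj₁ ∘ ∈-filter⁻ near?
      choose-side (no nle) = [ inj₁ ∘ stay sub , inj₂ ∘ grow sub far ]′
          (proj₂ (ramsey (suc m) n) (filter far? l) (AllPairsₚ.filter⁺ far? cs)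
            (ℕₚ.+-cancelˡ-≤ (length (filter near? l)) N₂ _ (ℕₚ.≤-trans (ℕₚ.+-monoˡ-≤ N₂ (ℕₚ.<⇒≤ (ℕₚ.≰⇒> nle)))
              (ℕₚ.≤-trans le (ℕₚ.≤-reflexive (sym (length-filters near? l)))))))
        where
        sub : ∀ {y} → y ∈ filter far? l → y ∈ l
        sub = proj₁ ∘ ∈-filter⁻ far?

module QuotientLemmas {c ℓ} (G : Group c ℓ) where
  open Group G renaming (refl to ≈-refl; sym to ≈-sym; trans to ≈-trans)
  open GroupProperties G

  solve-quotient : ∀ x y z → x ∙ y ≈ z → y ≈ x ⁻¹ ∙ z
  solve-quotient x y z e = ≈-trans (≈-sym (\\-leftDividesʳ x y)) (∙-congˡ e)

  identity⇒idempotent : ∀ x → x ≈ ε → x ∙ x ≈ x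
  identity⇒idempotent x e = ≈-trans (∙-congʳ e) (identityˡ x)

  quotient-cong : ∀ {x x′ y y′} → x ≈ x′ → y ≈ y′ → x ⁻¹ ∙ y ≈ x′ ⁻¹ ∙ y′
  quotient-cong p q = ∙-cong (⁻¹-cong p) q

  quotient-identity : ∀ x y → y ≈ ε → x ⁻¹ ∙ y ≈ x ⁻¹
  quotient-identity x y e = ≈-trans (∙-congˡ e) (identityʳ (x ⁻¹))

  module Homomorphism (f : Carrier → Carrier) (f-cong : ∀ x y → x ≈ y → f x ≈ f y)
                      (f-∙ : ∀ x y → f (x ∙ y) ≈ f x ∙ f y) where

    f-ε : f ε ≈ ε
    f-ε = identityʳ-unique (f ε) (f ε) (≈-trans (≈-sym (f-∙ ε ε)) (f-cong _ _ (identityˡ ε)))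

    f-⁻¹ : ∀ x → f (x ⁻¹) ≈ f x ⁻¹
    f-⁻¹ x = inverseˡ-unique (f (x ⁻¹)) (f x) (≈-trans (≈-sym (f-∙ (x ⁻¹) x)) (≈-trans (f-cong _ _ (inverseˡ x)) f-ε))

    f-quotient : ∀ x y → f (x ⁻¹ ∙ y) ≈ f x ⁻¹ ∙ f y
    f-quotient x y = ≈-trans (f-∙ (x ⁻¹) y) (∙-congʳ (f-⁻¹ x))

module GroupOver (cl : Classical) {ℓ} {L : Signature ℓ} {T : Theory L} {κ : Cardinal ℓ}
                 {ℭ : Structure L} (monster : IsMonster T κ ℭ) (G : GroupIn ℭ) where
  open Definability cl ℭ
  open Compactness cl monster
  open GroupIn G

  ar : Vars (Sort L)
  ar = fin arity

  -- A tuple instead of a subset: tuples can be concatenated, and moving `w` by an automorphism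
  -- keeps the formulas that refer to it.
  record Parameters : Set (Level.suc ℓ) where
    field
      {W}     : Vars (Sort L)
      w       : Tuple ℭ W
      small-W : Small (Var W)
      member  : Def w ar Member
      product : Cut {X = (Elt × Elt) × Elt} (λ ((g , h) , k) → proj₁ g ⋈ proj₁ h ⋈ proj₁ k ⋈ w)
                    (λ ((g , h) , k) → g ∙ h ≈ k)

  module Gr = Group group
  module Gp = GroupProperties group
  module Q = QuotientLemmas group

module DefinableSets (cl : Classical) {ℓ} {L : Signature ℓ} {T : Theory L} {κ : Cardinal ℓ}
                     {ℭ : Structure L} (monster : IsMonster T κ ℭ) (G : GroupIn ℭ)
                     (parameters : GroupOver.Parameters cl monster G) where
  open Choice cl
  open Definability cl ℭ
  open Compactness cl monster
  open GroupIn G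
  open GroupOver cl monster G
  open Parameters parameters

  private
    module C s = Setoid (carrier ℭ s)

    variable
      p : Level
      J K : Set ℓ

  ⟦_⟧ : Formula L (ar ⊕ W) → Pred Elt ℓ
  ⟦ θ ⟧ g = ℭ ⊨ θ [ proj₁ g ⋈ w ]

  DefG : Pred Elt p → Set (ℓ ⊔ p)
  DefG = Cut {V = ar ⊕ W} (λ g → proj₁ g ⋈ w)

  code : (θ : Formula L (ar ⊕ W)) → DefG ⟦ θ ⟧
  code θ = cut θ λ g → ⇔-refl

  resp : ∀ {D : Pred Elt p} → DefG D → ∀ {g h} → g ≈ h → D g → D h
  resp d e = def-resp d (⋈-cong ℭ e (≋-refl ℭ))

  -- Pw J are the variables for a family of group elements indexed by J.

  Pw : Set ℓ → Vars (Sort L)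
  Pw J = ⨁ {I = J} λ _ → ar

  flat : (J → Elt) → Tuple ℭ (Pw J)
  flat x = tuple λ (j , v) → at (proj₁ (x j)) v

  DefE : (J : Set ℓ) → Pred (J → Elt) p → Set (ℓ ⊔ p)
  DefE J = Cut {X = J → Elt} {V = Pw J ⊕ W} (λ x → flat x ⋈ w)

  E-resp : {R : Pred (J → Elt) p} → DefE J R → ∀ {x y} → (∀ j → x j ≈ y j) → R x → R y
  E-resp d e = def-resp d (⋈-cong ℭ (λ (j , v) → e j v) (≋-refl ℭ))

  renameVia : ∀ {a b q} {X : Set a} {Y : Set b} {U U′ : Vars (Sort L)} {ι : X → Tuple ℭ U} {ι′ : Y → Tuple ℭ U′}
      {R : Pred X q} →
              Cut ι R → (f : Y → X) (ρ : Ren U U′) → (∀ y → ι (f y) ≋ pull ℭ ρ (ι′ y)) → Cut ι′ (λ y → R (f y))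
  renameVia (cut φ e) f ρ eq = cut (rename ρ φ) λ y →
    e (f y) ⇔∘ ⊨-resp⇔ ℭ φ (eq y) ⇔∘ ⇔-sym (⊨-rename ℭ ρ φ _)

  E-pull : {R : Pred (J → Elt) p} (f : J → K) → DefE J R → DefE K (λ x → R (x ∘ f))
  E-pull f d = renameVia d (_∘ f)
    (ren (λ { (inj₁ (j , v)) → inj₁ (f j , v) ; (inj₂ v) → inj₂ v }) (λ { (inj₁ (j , v)) → refl ; (inj₂ v) → refl }))
    λ { y (inj₁ (j , v)) → C.refl _ ; y (inj₂ v) → C.refl _ }

  E-≈ : (i j : J) → DefE J (λ x → x i ≈ x j)
  E-≈ i j = def-⇔ (λ x → mk⇔ (λ h (lift k) → h k) (λ h k → h (lift k)))
    (def-Fin λ k → cut (var (inj₁ (i , lift k)) ≐ᶠ var (inj₁ (j , lift k))) λ x → ⇔-refl)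

  E-∙ : (i j k : J) → DefE J (λ x → x i ∙ x j ≈ x k)
  E-∙ i j k = renameVia product (λ x → (x i , x j) , x k)
    (ren (λ { (inj₁ (inj₁ (inj₁ v))) → inj₁ (i , v) ; (inj₁ (inj₁ (inj₂ v))) → inj₁ (j , v)
            ; (inj₁ (inj₂ v)) → inj₁ (k , v) ; (inj₂ v) → inj₂ v })
         (λ { (inj₁ (inj₁ (inj₁ v))) → refl ; (inj₁ (inj₁ (inj₂ v))) → refl ; (inj₁ (inj₂ v)) → refl ; (inj₂ v) →
             refl }))
    λ { x (inj₁ (inj₁ (inj₁ v))) → C.refl _ ; x (inj₁ (inj₁ (inj₂ v))) → C.refl _
      ; x (inj₁ (inj₂ v)) → C.refl _ ; x (inj₂ v) → C.refl _ }

  E-unary : {D : Pred Elt p} → DefG D → (j : J) → DefE J (λ x → D (x j))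
  E-unary d j = renameVia d (λ x → x j)
    (ren (λ { (inj₁ v) → inj₁ (j , v) ; (inj₂ v) → inj₂ v }) (λ { (inj₁ v) → refl ; (inj₂ v) → refl }))
    λ { x (inj₁ v) → C.refl _ ; x (inj₂ v) → C.refl _ }

  One : Set ℓ
  One = Lift ℓ ⊤

  G-unary : {D : Pred Elt p} → DefE One (λ x → D (x _)) → DefG D
  G-unary d = renameVia d (λ g _ → g)
    (ren (λ { (inj₁ (_ , v)) → inj₁ v ; (inj₂ v) → inj₂ v }) (λ { (inj₁ v) → refl ; (inj₂ v) → refl }))
    λ { x (inj₁ v) → C.refl _ ; x (inj₂ v) → C.refl _ }

  private
    memberAt : ∀ {U : Vars (Sort L)} {J : Set ℓ} (j : J) →
               Def w (U ⊕ Pw J) (λ z → Member (tuple λ v → at z (inj₂ (j , v))))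
    memberAt j = def-subst member
      (ren (λ { (inj₁ v) → inj₁ (inj₂ (j , v)) ; (inj₂ v) → inj₂ v }) (λ { (inj₁ v) → refl ; (inj₂ v) → refl }))
      (λ z → tuple λ v → at z (inj₂ (j , v))) λ { z (inj₁ v) → C.refl _ ; z (inj₂ v) → C.refl _ }

  E-∃ : ∀ {n} {R : Pred (J ⊎ Lift ℓ (Fin n) → Elt) p} → DefE (J ⊎ Lift ℓ (Fin n)) R →
        DefE J (λ x → ∃[ y ] R [ x , y ]′)
  E-∃ {J = J} {n = n} {R} (cut φ e) = cut (formula ∃-def) λ x → eq x ⇔∘ defines ∃-def (flat x)
    where
    K′ = Lift ℓ (Fin n)
    ρ : Ren (Pw (J ⊎ K′) ⊕ W) (Pw J ⊕ Pw K′ ⊕ W)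
    ρ = ren (λ { (inj₁ (inj₁ j , v)) → inj₁ (inj₁ (j , v)) ; (inj₁ (inj₂ k , v)) →
        inj₁ (inj₂ (k , v)) ; (inj₂ v) → inj₂ v })
            (λ { (inj₁ (inj₁ j , v)) → refl ; (inj₁ (inj₂ k , v)) → refl ; (inj₂ v) → refl })
    Body : Pred (Tuple ℭ (Pw J ⊕ Pw K′)) ℓ
    Body z = (∀ i → Member (tuple λ v → at z (inj₂ (lift i , v)))) × ℭ ⊨ rename ρ φ [ z ⋈ w ]
    ∃-def : Def w (Pw J) (λ z → ∃[ u ] Body (z ⋈ u))
    ∃-def = def-∃ (flat {J = K′} λ _ → ε) {D = Body} (def-× (def-Fin λ i → memberAt (lift i))
        (cut (rename ρ φ) λ z → ⇔-refl))
    split : ∀ x y u → u ≋ flat y → ℭ ⊨ rename ρ φ [ flat x ⋈ u ⋈ w ] ⇔ R [ x , y ]′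
    split x y u q = ⊨-rename ℭ ρ φ _ ⇔∘
      ⊨-resp⇔ ℭ φ (λ { (inj₁ (inj₁ j , v)) → C.refl _ ; (inj₁ (inj₂ k , v)) → q (k , v) ; (inj₂ v) → C.refl _ })
      ⇔∘ ⇔-sym (e [ x , y ]′)
    eq : ∀ x → (∃[ y ] R [ x , y ]′) ⇔ (∃[ u ] Body (flat x ⋈ u))
    eq x = mk⇔ (λ (y , r) → flat y , (λ i → proj₂ (y (lift i))) , from (split x y (flat y) (≋-refl ℭ)) r)
               (λ (u , m , h) → let y = λ (lift i) → tuple (λ v → at u (lift i , v)) , m i
                                in y , to (split x y u (≋-refl ℭ)) h)

  -- Only the graph of the product is given by a formula, so the quotient enters as the unique
  -- solution `y` of `x i ∙ y ≈ x j`.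
  E-quotient : {D : Pred Elt p} → DefG D → (i j : J) → DefE J (λ x → D (x i ⁻¹ ∙ x j))
  E-quotient {D = D} d i j = def-⇔
    (λ x → mk⇔ (λ (y , e , h) → resp d (Q.solve-quotient (x i) (y _) (x j) e) h)
               (λ h → (λ _ → x i ⁻¹ ∙ x j) , Gp.\\-leftDividesˡ (x i) (x j) , h))
    (E-∃ {n = 1} {R = λ z → z (inj₁ i) ∙ z (inj₂ (lift zero)) ≈ z (inj₁ j) × D (z (inj₂ (lift zero)))}
      (def-× (E-∙ (inj₁ i) (inj₂ (lift zero)) (inj₁ j)) (E-unary d (inj₂ (lift zero)))))

  -- The identity is the only idempotent, hence definable from the product.
  E-identity : (i : J) → DefE J (λ x → x i ≈ ε)
  E-identity i = def-⇔ (λ x → mk⇔ (λ e → Gp.identityʳ-unique (x i) (x i) e)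
                                  (Q.identity⇒idempotent (x i)))
                       (E-∙ i i i)

  G-⁻¹ : {D : Pred Elt p} → DefG D → DefG (λ g → D (g ⁻¹))
  G-⁻¹ {D = D} d = G-unary (def-⇔ (λ x → mk⇔ (λ (y , e , h) → resp d (Q.quotient-identity (x _) (y _) e) h)
                                             (λ h → (λ _ → ε) , Gr.refl {ε} ,
                                                 resp d (≋-sym ℭ (Gr.identityʳ (x _ ⁻¹))) h))
    (E-∃ {n = 1} {R = λ z → z (inj₂ (lift zero)) ≈ ε × D (z (inj₁ _) ⁻¹ ∙ z (inj₂ (lift zero)))}
      (def-× (E-identity (inj₂ (lift zero))) (E-quotient d (inj₁ _) (inj₂ (lift zero))))))

  small-Fin : ∀ {n} → Small (Lift ℓ (Fin n))
  small-Fin = small-↣ (mk↣ {to = λ (lift i) → lift (toℕ i)}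
                λ e → cong lift (toℕ-injective (cong lower e))) small-ℕ

  small-Pw : Small J → Small (Var (Pw J))
  small-Pw s = small-× s small-Fin

  private
    ∃-realization : {I : Set ℓ} → Small J → Small K → (k : K → Elt) {R : I → Pred (J ⊎ K → Elt) p} →
               (∀ i → DefE (J ⊎ K) (R i)) → (∀ is → ∃[ x ] All (λ i → R i [ x , k ]′) is) →
               ∃[ x ] (∀ i → R i [ x , k ]′)
    ∃-realization {J = J} {K} {I = I} small-J small-K k {R} d sat = x , λ i →
        to (split x i (proj₁ realized) (≋-refl ℭ)) (proj₂ realized (inj₁ i))
      where
      ρ : Ren (Pw (J ⊎ K) ⊕ W) (Pw J ⊕ (Pw K ⊕ W))
      ρ = ren (λ { (inj₁ (inj₁ j , v)) → inj₁ (j , v) ; (inj₁ (inj₂ k , v)) → inj₂ (inj₁ (k , v)) ; (inj₂ v) →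
          inj₂ (inj₂ v) })
              (λ { (inj₁ (inj₁ j , v)) → refl ; (inj₁ (inj₂ k , v)) → refl ; (inj₂ v) → refl })
      Condition : I ⊎ J → Pred (Tuple ℭ (Pw J)) ℓ
      Condition (inj₁ i) z = ℭ ⊨ rename ρ (formula (d i)) [ z ⋈ (flat k ⋈ w) ]
      Condition (inj₂ j) z = Member (tuple λ v → at z (j , v))
      definable : ∀ i → Def (flat k ⋈ w) (Pw J) (Condition i)
      definable (inj₁ i) = cut (rename ρ (formula (d i))) λ z → ⇔-refl
      definable (inj₂ j) = def-subst member
        (ren (λ { (inj₁ v) → inj₁ (j , v) ; (inj₂ v) → inj₂ (inj₂ v) }) (λ { (inj₁ v) → refl ; (inj₂ v) → refl }))
        (λ z → tuple λ v → at z (j , v)) λ { z (inj₁ v) → C.refl _ ; z (inj₂ v) → C.refl _ }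
      split : ∀ x i z → z ≋ flat x → Condition (inj₁ i) z ⇔ R i [ x , k ]′
      split x i z q = ⊨-rename ℭ ρ (formula (d i)) _ ⇔∘
        ⊨-resp⇔ ℭ (formula (d i)) (λ { (inj₁ (inj₁ j , v)) → q (j , v) ; (inj₁ (inj₂ k , v)) →
            C.refl _ ; (inj₂ v) → C.refl _ })
        ⇔∘ ⇔-sym (defines (d i) [ x , k ]′)
      indices : List (I ⊎ J) → List I
      indices []           = []
      indices (inj₁ i ∷ l) = i ∷ indices l
      indices (inj₂ _ ∷ l) = indices l
      conditions : ∀ x l → All (λ i → R i [ x , k ]′) (indices l) → All (λ i → Condition i (flat x)) l
      conditions x []           rs       = []
      conditions x (inj₁ i ∷ l) (r ∷ rs) = from (split x i (flat x) (≋-refl ℭ)) r ∷ conditions x l rs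
      conditions x (inj₂ j ∷ l) rs       = proj₂ (x j) ∷ conditions x l rs
      realized : ∃[ z ] (∀ i → Condition i z)
      realized = compactness (small-Pw small-J) (small-⊎ (small-Pw small-K) small-W) definable
                   λ l → let x , h = sat (indices l) in flat x , conditions x l h
      x : J → Elt
      x j = tuple (λ v → at (proj₁ realized) (j , v)) , proj₂ realized (inj₂ j)

  abstract
    -- `J` indexes the unknown group elements, and those indexed by `K` are fixed and become
    -- parameters. That each unknown belongs to the group is one more definable condition on tuples.
    compactE : {I : Set ℓ} → Small J → Small K → (k : K → Elt) {R : I → Pred (J ⊎ K → Elt) p} →
               (∀ i → DefE (J ⊎ K) (R i)) → (∀ is → ∃[ x ] All (λ i → R i [ x , k ]′) is) →
               ∃[ x ] (∀ i → R i [ x , k ]′)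
    compactE = ∃-realization

  module Action (σ : Automorphism ℭ) (fixes : Automorphism.apply σ w ≋ w) where
    open Automorphism σ

    act : Elt → Elt
    act (g , m) = apply g , from (defines member _)
      (⊨-resp ℭ (formula member) (≋-trans ℭ (apply-⋈ σ g w) (⋈-cong ℭ (≋-refl ℭ) fixes))
        (to (⊨-apply σ (formula member) (g ⋈ w)) (to (defines member g) m)))

    act-cong : ∀ {g h} → g ≈ h → act g ≈ act h
    act-cong = apply-cong σ

    act-invariant : {D : Pred Elt p} → DefG D → ∀ g → D g ⇔ D (act g)
    act-invariant (cut φ e) g = e g ⇔∘ ⊨-apply σ φ _ ⇔∘
      ⊨-resp⇔ ℭ φ (≋-trans ℭ (apply-⋈ σ (proj₁ g) w) (⋈-cong ℭ (≋-refl ℭ) fixes)) ⇔∘ ⇔-sym (e (act g))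

    act-invariantE : {R : Pred (J → Elt) p} → DefE J R → ∀ x → R x ⇔ R (act ∘ x)
    act-invariantE (cut φ e) x = e x ⇔∘ ⊨-apply σ φ _ ⇔∘
      ⊨-resp⇔ ℭ φ (λ { (inj₁ v) → C.refl _ ; (inj₂ v) → fixes v }) ⇔∘ ⇔-sym (e (act ∘ x))

    act-∙ : ∀ g h → act (g ∙ h) ≈ act g ∙ act h
    act-∙ g h = ≋-sym ℭ (to (act-invariantE (E-∙ (lift zero) (lift (suc zero)) (lift (suc (suc zero)))) triple)
        (Gr.refl {g ∙ h}))
      where
      triple : Lift ℓ (Fin 3) → Elt
      triple (lift zero)             = g
      triple (lift (suc zero))       = h
      triple (lift (suc (suc zero))) = g ∙ h

    open Q.Homomorphism act (λ g h → act-cong {g} {h}) act-∙ public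
      renaming (f-ε to act-ε; f-⁻¹ to act-⁻¹; f-quotient to act-quotient)

  homogeneousE : Small J → (x y : J → Elt) →
                 (∀ (φ : Formula L (Pw J ⊕ W)) → ℭ ⊨ φ [ flat x ⋈ w ] → ℭ ⊨ φ [ flat y ⋈ w ]) →
                 Σ[ σ ∈ Automorphism ℭ ] Automorphism.apply σ w ≋ w ×
                     (∀ j → Automorphism.apply σ (proj₁ (x j)) ≋ proj₁ (y j))
  homogeneousE {J = J} small-J x y h =
    let σ , e = IsMonster.homogeneous monster (Pw J ⊕ W) (small-⊎ (small-Pw small-J) small-W)
                  (flat x ⋈ w) (flat y ⋈ w)
                  λ φ → mk⇔ (h φ) (λ q → dne λ n → lower (h (¬ᶠ φ) (λ p → lift (n p)) q))
    in σ , (λ v → e (inj₂ v)) , λ j v → e (inj₁ (j , v))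

-- Thick sets

module Powers {ℓ} (G : Group ℓ ℓ) where
  open Group G renaming (refl to ≈-refl; sym to ≈-sym; trans to ≈-trans)
  open GroupProperties G

  -- The set Dⁿ of n-fold products. The last factor is expressed as a quotient, the form in which
  -- `E-quotient` gives definability and in which steps in the torsor appear.
  pow : Pred Carrier ℓ → ℕ → Pred Carrier ℓ
  pow D zero    g = g ≈ ε
  pow D (suc n) g = ∃[ h ] pow D n h × D (h ⁻¹ ∙ g)

  generated : Pred Carrier ℓ → Pred Carrier ℓ
  generated D g = ∃[ n ] pow D n g

  pow-mono : ∀ {D E} n → D ⊆ E → pow D n ⊆ pow E n
  pow-mono zero    i p           = p
  pow-mono (suc n) i (h , p , q) = h , pow-mono n i p , i q

  cancel-inner : ∀ g h k → (g ∙ h) ⁻¹ ∙ (g ∙ k) ≈ h ⁻¹ ∙ k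
  cancel-inner g h k = ≈-trans (∙-congʳ (⁻¹-anti-homo-∙ g h))
    (≈-trans (assoc _ _ _) (∙-congˡ (\\-leftDividesʳ g k)))

  quotient-⁻¹ : ∀ g h → (g ⁻¹ ∙ h) ⁻¹ ≈ h ⁻¹ ∙ g
  quotient-⁻¹ g h = ≈-trans (⁻¹-anti-homo-∙ (g ⁻¹) h) (∙-congˡ (⁻¹-involutive g))

  quotient-chain : ∀ g h k → (g ⁻¹ ∙ h) ⁻¹ ∙ (g ⁻¹ ∙ k) ≈ h ⁻¹ ∙ k
  quotient-chain g h k = cancel-inner (g ⁻¹) h k

  module _ {D : Pred Carrier ℓ} (D-resp : ∀ {x y} → x ≈ y → D x → D y) where

    pow-resp : ∀ n {x y} → x ≈ y → pow D n x → pow D n y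
    pow-resp zero    e p           = ≈-trans (≈-sym e) p
    pow-resp (suc n) e (h , p , q) = h , p , D-resp (∙-congˡ e) q

    pow-1 : ∀ {g} → D g → pow D 1 g
    pow-1 d = ε , ≈-refl , D-resp (≈-sym (≈-trans (∙-congʳ ε⁻¹≈ε) (identityˡ _))) d

    pow-quotient : ∀ {g h k} → D (g ⁻¹ ∙ h) → D (h ⁻¹ ∙ k) → pow D 2 (g ⁻¹ ∙ k)
    pow-quotient {g} {h} {k} p q = g ⁻¹ ∙ h , pow-1 p , D-resp (≈-sym (quotient-chain g h k)) q

    pow-+ : ∀ m n {g h} → pow D m g → pow D n h → pow D (n + m) (g ∙ h)
    pow-+ m zero    p e           = pow-resp m (≈-sym (≈-trans (∙-congˡ e) (identityʳ _))) p
    pow-+ m (suc n) {g} {h} p (k , q , r) =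
      g ∙ k , pow-+ m n p q , D-resp (≈-sym (cancel-inner g k h)) r

    pow-pow : ∀ m n {g} → pow (pow D m) n g → pow D (n * m) g
    pow-pow m zero    e           = e
    pow-pow m (suc n) {g} (h , p , q) =
      pow-resp (m + n * m) (\\-leftDividesˡ h g) (pow-+ (n * m) m (pow-pow m n p) q)

    pow-≤ : D ε → ∀ {m n} → m ≤ n → pow D m ⊆ pow D n
    pow-≤ dε {n = zero}  z≤n     p = p
    pow-≤ dε {n = suc n} z≤n {g} p = g , pow-≤ dε {n = n} z≤n p , D-resp (≈-sym (inverseˡ g)) dε
    pow-≤ dε (s≤s le) (h , p , q) = h , pow-≤ dε le p , q

    module _ (D-⁻¹ : ∀ {x} → D x → D (x ⁻¹)) where

      pow-⁻¹ : ∀ n {g} → pow D n g → pow D n (g ⁻¹)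
      pow-⁻¹ zero        e           = ≈-trans (⁻¹-cong e) ε⁻¹≈ε
      pow-⁻¹ (suc n) {g} (h , p , q) = subst (λ k → pow D k (g ⁻¹)) (ℕₚ.+-comm n 1)
        (pow-resp (n + 1) eq (pow-+ 1 n (pow-1 (D-⁻¹ q)) (pow-⁻¹ n p)))
        where
        eq : (h ⁻¹ ∙ g) ⁻¹ ∙ h ⁻¹ ≈ g ⁻¹
        eq = ≈-trans (∙-congʳ (quotient-⁻¹ h g)) (//-rightDividesʳ h (g ⁻¹))

      generated-isSubgroup : IsSubgroup G (generated D)
      generated-isSubgroup = record
        { resp      = λ e (n , p) → n , pow-resp n e p
        ; ε-closed  = 0 , ≈-refl
        ; ∙-closed  = λ (m , p) (n , q) → n + m , pow-+ m n p q
        ; ⁻¹-closed = λ (n , p) → n , pow-⁻¹ n p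
        }

  module _ {H : Pred Carrier ℓ} (isSub : IsSubgroup G H) where
    open IsSubgroup isSub

    quotient-closed : ∀ {g h} → H (g ⁻¹ ∙ h) → H g → H h
    quotient-closed {g} {h} q p = resp (\\-leftDividesˡ g h) (∙-closed p q)

    pow⊆ : ∀ {D} → D ⊆ H → ∀ n → pow D n ⊆ H
    pow⊆ i zero    e           = resp (≈-sym e) ε-closed
    pow⊆ i (suc n) (h , p , q) = quotient-closed (i q) (pow⊆ i n p)

    quotient-swap : ∀ {g h} → H (g ⁻¹ ∙ h) → H (h ⁻¹ ∙ g)
    quotient-swap {g} {h} p = resp (quotient-⁻¹ g h) (⁻¹-closed p)

module ThickSets (cl : Classical) {ℓ} {L : Signature ℓ} {T : Theory L} {κ : Cardinal ℓ}
                 {ℭ : Structure L} (monster : IsMonster T κ ℭ) (G : GroupIn ℭ)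
                 (parameters : GroupOver.Parameters cl monster G) where
  open Choice cl
  open Cardinality cl
  open Definability cl ℭ
  open Compactness cl monster
  open GroupIn G
  open GroupOver cl monster G
  open Parameters parameters
  open DefinableSets cl monster G parameters
  open Powers group

  Code : Set ℓ
  Code = Formula L (ar ⊕ W)

  code-resp : ∀ θ {g h} → g ≈ h → ⟦ θ ⟧ g → ⟦ θ ⟧ h
  code-resp θ {g} {h} = resp (code θ) {g} {h}

  Antichain : Code → List Elt → Set ℓ
  Antichain θ = AllPairs (λ x y → ¬ ⟦ θ ⟧ (x ⁻¹ ∙ y))

  record Thick (θ : Code) : Set ℓ where
    field
      symmetric : ∀ {g} → ⟦ θ ⟧ g → ⟦ θ ⟧ (g ⁻¹)
      bound     : ℕ
      short     : ∀ l → Antichain θ l → length l < bound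

  open Thick

  -- Antichains are lists with possible repetitions: if ε were missing from `θ`, a constant list
  -- would be an antichain of any length.
  thick-ε : ∀ {θ} → Thick θ → ⟦ θ ⟧ ε
  thick-ε {θ} t = dne λ n → ℕₚ.<-irrefl (Listₚ.length-replicate (bound t))
      (short t (replicate (bound t) ε) (constant n (bound t)))
    where
    constant : ¬ ⟦ θ ⟧ ε → ∀ k → Antichain θ (replicate k ε)
    constant n zero    = []
    constant n (suc k) = Allₚ.replicate⁺ k (n ∘ code-resp θ {ε ⁻¹ ∙ ε} {ε} (Gr.inverseˡ ε)) ∷ constant n k

  ThickCode : Set ℓ
  ThickCode = ∃ Thick

  _≼_ : Code → Code → Set ℓ
  θ ≼ χ = ∀ g → ⟦ θ ⟧ g → ⟦ χ ⟧ g

  thick-∧ : ∀ {θ χ} → Thick θ → Thick χ → ∃[ ψ ] Thick ψ × ψ ≼ θ × ψ ≼ χ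
  thick-∧ {θ} {χ} t u = formula d , record
    { symmetric = λ {g} p →
        let q , r = from (defines d g) p in to (defines d (g ⁻¹)) (symmetric t {g} q , symmetric u {g} r)
    ; bound     = N
    ; short     = λ l a → ℕₚ.≰⇒> λ le → absurd (find l (AllPairs.map weaken a) le)
    } , (λ g p → proj₁ (from (defines d g) p)) , (λ g p → proj₂ (from (defines d g) p))
    where
    d : DefG (λ g → ⟦ θ ⟧ g × ⟦ χ ⟧ g)
    d = def-× (code θ) (code χ)
    A B : Elt → Elt → Set ℓ
    A x y = ¬ ⟦ θ ⟧ (x ⁻¹ ∙ y)
    B x y = ¬ ⟦ χ ⟧ (x ⁻¹ ∙ y)
    open Ramsey cl A B
    N = proj₁ (ramsey (bound t) (bound u))
    find = proj₂ (ramsey (bound t) (bound u))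
    weaken : ∀ {x y} → ¬ ⟦ formula d ⟧ (x ⁻¹ ∙ y) → A x y ⊎ B x y
    weaken {x} {y} n with dec (⟦ θ ⟧ (x ⁻¹ ∙ y))
    ... | no m  = inj₁ m
    ... | yes p = inj₂ λ q → n (to (defines d (x ⁻¹ ∙ y)) (p , q))
    absurd : ∀ {l} → ¬ (Homogeneous A (bound t) l ⊎ Homogeneous B (bound u) l)
    absurd (inj₁ (l′ , _ , a , le)) = ℕₚ.<⇒≱ (short t l′ a) le
    absurd (inj₂ (l′ , _ , a , le)) = ℕₚ.<⇒≱ (short u l′ a) le

  thick-⊤ : ∃[ θ ] Thick θ
  thick-⊤ = formula d , record
    { symmetric = λ {g} _ → to (defines d (g ⁻¹)) tt
    ; bound     = 2
    ; short     = λ { [] _ → s≤s z≤n ; (x ∷ []) _ → s≤s (s≤s z≤n)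
                    ; (x ∷ y ∷ l) ((n ∷ _) ∷ _) → ⊥-elim (n (to (defines d (x ⁻¹ ∙ y)) tt)) } }
    where
    d : DefG (λ _ → ⊤)
    d = def-const ⊤

  meet : (θs : List ThickCode) → ∃[ ψ ] Thick ψ × All (λ (θ , _) → ψ ≼ θ) θs
  meet []             = let ψ , t = thick-⊤ in ψ , t , []
  meet ((θ , t) ∷ θs) =
    let ψ , u , a = meet θs
        χ , v , i , j = thick-∧ t u
    in χ , v , i ∷ All.map (λ k g p → k g (j g p)) a

  Core : Pred Elt ℓ
  Core g = ∀ θ → Thick θ → ⟦ θ ⟧ g

  core-resp : ∀ {g h} → g ≈ h → Core g → Core h
  core-resp {g} {h} e c θ t = code-resp θ {g} {h} e (c θ t)

  core-⁻¹ : ∀ {g} → Core g → Core (g ⁻¹)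
  core-⁻¹ {g} c θ t = symmetric t {g} (c θ t)

  pow-def : ∀ {D : Pred Elt ℓ} → DefG D → ∀ n → DefG (pow D n)
  pow-def d zero = G-unary (E-identity _)
  pow-def {D} d (suc n) = G-unary (def-⇔ (λ x → mk⇔ (λ (y , p , q) → y _ , p , q) (λ (h , p , q) → (λ _ → h) , p , q))
    (E-∃ {n = 1} {R = λ z → pow D n (z (inj₂ (lift zero))) × D (z (inj₂ (lift zero)) ⁻¹ ∙ z (inj₁ _))}
      (def-× (E-unary (pow-def d n) (inj₂ (lift zero))) (E-quotient d (inj₂ (lift zero)) (inj₁ _)))))

  small-One : Small One
  small-One = small-↣ (mk↣ {to = λ _ → lift 0} λ _ → refl) small-ℕ

  -- Intersection commutes with powers: thick sets are directed downwards by `meet`, so compactness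
  -- finds one intermediate element that works for all of them.
  pow-core : ∀ n {g} → (∀ θ → Thick θ → pow ⟦ θ ⟧ n g) → pow Core n g
  pow-core zero    h = let θ , t = thick-⊤ in h θ t
  pow-core (suc n) {g} h =
    let x , k = compactE small-One small-One (λ _ → g) {R = R}
                  (λ (θ , _) → def-× (E-unary (pow-def (code θ) n) (inj₁ _))
                      (E-quotient (code θ) (inj₁ _) (inj₂ _))) sat
    in x _ , pow-core n (λ θ t → proj₁ (k (θ , t))) , λ θ t → proj₂ (k (θ , t))
    where
    R : ThickCode → Pred (One ⊎ One → Elt) ℓ
    R (θ , _) z = pow ⟦ θ ⟧ n (z (inj₁ _)) × ⟦ θ ⟧ (z (inj₁ _) ⁻¹ ∙ z (inj₂ _))
    sat : ∀ θs → ∃[ x ] All (λ θ → R θ [ x , (λ _ → g) ]′) θs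
    sat θs = let ψ , u , a = meet θs
                 x , p , q = h ψ u
             in (λ _ → x) , All.map (λ i → pow-mono n (λ {y} → i y) p , i (x ⁻¹ ∙ g) q) a

  -- `extend` prolongs an antichain as long as possible, and `n` bounds the remaining steps. New
  -- elements come in front, so failure to prolong yields x⁻¹m in `θ`, which symmetry turns into
  -- m⁻¹x.
  net : ∀ {θ} → Thick θ → ∃[ l ] (∀ x → ∃[ m ] m ∈ l × ⟦ θ ⟧ (m ⁻¹ ∙ x))
  net {θ} t = extend (bound t) [] [] (ℕₚ.≤-reflexive (sym (ℕₚ.+-identityʳ (bound t))))
    where
    extend : ∀ n l → Antichain θ l → bound t ≤ n + length l → ∃[ l ] (∀ x → ∃[ m ] m ∈ l × ⟦ θ ⟧ (m ⁻¹ ∙ x))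
    extend zero    l a le = ⊥-elim (ℕₚ.<⇒≱ (short t l a) le)
    extend (suc n) l a le with dec (∃[ x ] All (λ m → ¬ ⟦ θ ⟧ (x ⁻¹ ∙ m)) l)
    ... | yes (x , ps) = extend n (x ∷ l) (ps ∷ a) (subst (bound t ≤_) (sym (ℕₚ.+-suc n (length l))) le)
    ... | no n         = l , λ x → dne λ k → n (x , All.tabulate λ {m} i p → k (m , i ,
                           code-resp θ {(x ⁻¹ ∙ m) ⁻¹} {m ⁻¹ ∙ x} (quotient-⁻¹ x m) (symmetric t {x ⁻¹ ∙ m} p)))

  -- Equality of types over `w`; one implication suffices, since formulas can be negated.
  Similar : Elt → Elt → Set ℓ
  Similar g h = ∀ θ → ⟦ θ ⟧ g → ⟦ θ ⟧ h

  similar-sym : ∀ {g h} → Similar g h → Similar h g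
  similar-sym s θ p = dne λ n → lower (s (¬ᶠ θ) (λ q → lift (n q)) p)

  similar⇒conjugate : ∀ {g h} → Similar g h →
    Σ[ σ ∈ Automorphism ℭ ] Automorphism.apply σ w ≋ w × Automorphism.apply σ (proj₁ g) ≋ proj₁ h
  similar⇒conjugate {g} {h} s =
    let σ , e , f = homogeneousE small-One (λ _ → g) (λ _ → h)
                      λ φ p → let d = G-unary {D = λ x → ℭ ⊨ φ [ flat (λ _ → x) ⋈ w ]} (cut φ λ x → ⇔-refl)
                              in from (defines d h) (s (formula d) (to (defines d g) p))
    in σ , e , f _

  -- If Φ holds of g then ¬Φ ∩ (¬Φ)⁻¹ does not contain g, hence is not thick, and there are arbitrarily long finite
  -- families whose quotients satisfy Φ up to inversion; compactness makes them infinite.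

  private
    module Spread {g} (c : Core g) (I : Set ℓ) (small-I : Small I) where
      Condition : Set ℓ
      Condition = Σ[ i ∈ I ] Σ[ j ∈ I ] ¬ i ≡ j × Σ[ θ ∈ Code ] ⟦ θ ⟧ g
      R : Condition → Pred (I ⊎ Lift ℓ ⊥ → Elt) ℓ
      R (i , j , _ , θ , _) z = ⟦ θ ⟧ (z (inj₁ i) ⁻¹ ∙ z (inj₁ j)) ⊎ ⟦ θ ⟧ (z (inj₁ j) ⁻¹ ∙ z (inj₁ i))
      k : Lift ℓ ⊥ → Elt
      k ()
      points : List Condition → List I
      points []                    = []
      points ((i , j , _) ∷ cs) = i ∷ j ∷ points cs
      -- A repeated index takes the element at its first occurrence; ε is a default for indices that
      -- no condition mentions.
      assign : List I → List Elt → I → Elt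
      assign []       _        j = ε
      assign (_ ∷ _)  []       j = ε
      assign (i ∷ is) (x ∷ xs) j with dec (j ≡ i)
      ... | yes _ = x
      ... | no _  = assign is xs j
      assign-∈ : ∀ is xs → length is ≤ length xs → ∀ {j} → j ∈ is → assign is xs j ∈ xs
      assign-∈ (i ∷ is) (x ∷ xs) (s≤s le) {j} p with dec (j ≡ i)
      ... | yes _ = here refl
      assign-∈ (i ∷ is) (x ∷ xs) (s≤s le) {j} (here e)  | no n = ⊥-elim (n e)
      assign-∈ (i ∷ is) (x ∷ xs) (s≤s le) {j} (there p) | no n = there (assign-∈ is xs le p)
      tail : ∀ {k is} {j : I} → ¬ j ≡ k → j ∈ k ∷ is → j ∈ is
      tail m (here e)  = ⊥-elim (m e)
      tail m (there q) = q
      related : ∀ {q} {Rel : Elt → Elt → Set q} is xs → length is ≤ length xs → AllPairs Rel xs →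
                ∀ {i j} → i ∈ is → j ∈ is → ¬ i ≡ j →
                Rel (assign is xs i) (assign is xs j) ⊎ Rel (assign is xs j) (assign is xs i)
      related (k ∷ is) (x ∷ xs) (s≤s le) (r ∷ rs) {i} {j} p q n with dec (i ≡ k) | dec (j ≡ k)
      ... | yes refl | yes refl = ⊥-elim (n refl)
      ... | yes refl | no m     = inj₁ (All.lookup r (assign-∈ is xs le (tail m q)))
      ... | no m     | yes refl = inj₂ (All.lookup r (assign-∈ is xs le (tail m p)))
      ... | no m     | no m′    = related is xs le rs (tail m p) (tail m′ q) n
      All-conditions : List Condition → Pred Elt ℓ
      All-conditions cs h = All (λ (_ , _ , _ , θ , _) → ⟦ θ ⟧ h) cs
      abstract
        conditions-def : ∀ cs → DefG (All-conditions cs)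
        conditions-def cs = def-all (λ (_ , _ , _ , θ , _) → code θ) cs
        unrelated-def : ∀ cs → DefG (λ h → ¬ All-conditions cs h × ¬ All-conditions cs (h ⁻¹))
        unrelated-def cs = def-× (def-¬ (conditions-def cs)) (def-¬ (G-⁻¹ (conditions-def cs)))
      module _ (cs : List Condition) where
        θ = formula (unrelated-def cs)
        conditions-g : All-conditions cs g
        conditions-g = All.tabulate λ {(_ , _ , _ , _ , p)} _ → p
        θ⇔ : ∀ h → (¬ All-conditions cs h × ¬ All-conditions cs (h ⁻¹)) ⇔ ⟦ θ ⟧ h
        θ⇔ = defines (unrelated-def cs)
        long : ∃[ l ] Antichain θ l × length (points cs) ≤ length l
        long = dne λ n → proj₁ (from (θ⇔ g) (c θ (record
          { symmetric = λ {h} p → let q , r = from (θ⇔ h) p in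
              to (θ⇔ (h ⁻¹)) (r , λ s → q (resp (conditions-def cs) {h ⁻¹ ⁻¹} {h} (Gp.⁻¹-involutive h) s))
          ; bound = length (points cs)
          ; short = λ l a → ℕₚ.≰⇒> λ le → n (l , a , le) }))) conditions-g
        holds-or : ∀ {h} → ¬ ⟦ θ ⟧ h → All-conditions cs h ⊎ All-conditions cs (h ⁻¹)
        holds-or {h} n with dec (All-conditions cs h)
        ... | yes p = inj₁ p
        ... | no m  = inj₂ (dne λ m′ → n (to (θ⇔ h) (m , m′)))
        module _ (l : List Elt) (anti : Antichain θ l) (le : length (points cs) ≤ length l) where
          x = assign (points cs) l
          quotients : ∀ {i j} → ¬ ⟦ θ ⟧ (x i ⁻¹ ∙ x j) → All-conditions cs (x i ⁻¹ ∙ x j) ⊎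
              All-conditions cs (x j ⁻¹ ∙ x i)
          quotients {i} {j} n with holds-or {x i ⁻¹ ∙ x j} n
          ... | inj₁ p = inj₁ p
          ... | inj₂ p = inj₂ (resp (conditions-def cs) {(x i ⁻¹ ∙ x j) ⁻¹} {x j ⁻¹ ∙ x i}
              (quotient-⁻¹ (x i) (x j)) p)
          either : ∀ {i j} → i ∈ points cs → j ∈ points cs → ¬ i ≡ j →
                   All-conditions cs (x i ⁻¹ ∙ x j) ⊎ All-conditions cs (x j ⁻¹ ∙ x i)
          either {i} {j} p q n with related (points cs) l le anti p q n
          ... | inj₁ r = quotients {i} {j} r
          ... | inj₂ r = [ inj₂ , inj₁ ]′ (quotients {j} {i} r)
          member-points : ∀ {cs′ cd} → cd ∈ cs′ → proj₁ cd ∈ points cs′ × proj₁ (proj₂ cd) ∈ points cs′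
          member-points (here refl) = here refl , there (here refl)
          member-points (there p)   = let q , r = member-points p in there (there q) , there (there r)
          satisfied : All (λ cd → R cd [ x , k ]′) cs
          satisfied = All.tabulate λ {cd} i → let p , q = member-points i in
            [ (λ s → inj₁ (All.lookup s i)) , (λ s → inj₂ (All.lookup s i)) ]′ (either p q (proj₁ (proj₂ (proj₂ cd))))
        sat : ∃[ x ] All (λ cd → R cd [ x , k ]′) cs
        sat = let l , a , le = long in x l a le , satisfied l a le
      abstract
        realized : ∃[ a ] (∀ cd → R cd [ a , k ]′)
        realized = compactE small-I small-⊥ k {R = R}
          (λ (i , j , _ , θ , _) → def-⊎ (E-quotient (code θ) (inj₁ i) (inj₁ j))
              (E-quotient (code θ) (inj₁ j) (inj₁ i))) sat
      abstract
        both : ∀ θ χ → DefG (λ h → ⟦ θ ⟧ h × ⟦ χ ⟧ h)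
        both θ χ = def-× (code θ) (code χ)
      a : I → Elt
      a = proj₁ realized
      -- Compactness gives each formula of the type in one direction, which could vary with the
      -- formula. If θ failed in one direction and χ in the other, the condition for their
      -- conjunction would fail in both.
      decide : ∀ i j → ¬ i ≡ j → Similar g (a i ⁻¹ ∙ a j) ⊎ Similar g (a j ⁻¹ ∙ a i)
      decide i j n with dec (Similar g (a i ⁻¹ ∙ a j))
      ... | yes s = inj₁ s
      ... | no ns = inj₂ λ χ q → dne λ nχ → ns λ θ p → dne λ nθ →
              absurd θ χ (to (defines (both θ χ) g) (p , q)) nθ nχ
                  (proj₂ realized (i , j , n , formula (both θ χ) , to (defines (both θ χ) g) (p , q)))
        where
        absurd : ∀ θ χ p → ¬ ⟦ θ ⟧ (a i ⁻¹ ∙ a j) → ¬ ⟦ χ ⟧ (a j ⁻¹ ∙ a i) →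
                 ¬ R (i , j , n , formula (both θ χ) , p) [ a , k ]′
        absurd θ χ _ nθ nχ (inj₁ s) = nθ (proj₁ (from (defines (both θ χ) (a i ⁻¹ ∙ a j)) s))
        absurd θ χ _ nθ nχ (inj₂ s) = nχ (proj₂ (from (defines (both θ χ) (a j ⁻¹ ∙ a i)) s))

  spread : ∀ {g} → Core g → (I : Set ℓ) → Small I → ∃[ a ] (∀ (i j : I) → ¬ i ≡ j →
           Similar g (a i ⁻¹ ∙ a j) ⊎ Similar g (a j ⁻¹ ∙ a i))
  spread {g} c I small-I = Spread.a {g} c I small-I , Spread.decide {g} c I small-I

  -- The spread family is indexed by the subsets of `Z`. By Cantor's theorem two of its members
  -- share a coset, so H contains their quotient in both directions, and one of these has the type
  -- of `g`.
  core⊆ : (H : Pred Elt ℓ) (isSub : IsSubgroup group H) → (∀ {g h} → Similar g h → H g → H h) →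
          {Z : Set ℓ} → cosets group H isSub ≤ᶜ setoid Z → Small Z → Core ⊆ H
  core⊆ H isSub invariant {Z} f small-Z {g} c = dne λ n → cantor (mk↣ {to = Injection.to f ∘ a} (inj n))
    where
    spread-g = spread {g} c (Z → Bool) (small-2^ small-Z)
    a : (Z → Bool) → Elt
    a = proj₁ spread-g
    inj : ¬ H g → ∀ {i j} → Injection.to f (a i) ≡ Injection.to f (a j) → i ≡ j
    inj n {i} {j} e = dne λ m → absurd (proj₂ spread-g i j m)
      where
      same-coset : H (a i ⁻¹ ∙ a j)
      same-coset = Injection.injective f e
      absurd : ¬ (Similar g (a i ⁻¹ ∙ a j) ⊎ Similar g (a j ⁻¹ ∙ a i))
      absurd (inj₁ s) = n (invariant {a i ⁻¹ ∙ a j} {g} (similar-sym {g} {a i ⁻¹ ∙ a j} s) same-coset)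
      absurd (inj₂ s) = n (invariant {a j ⁻¹ ∙ a i} {g} (similar-sym {g} {a j ⁻¹ ∙ a i} s)
          (quotient-swap isSub {a i} {a j} same-coset))

-- Counting formulas and cosets

tabulate-injective : ∀ {a} {X : Set a} {n} {f g : Fin n → X} → tabulate f ≡ tabulate g → ∀ i → f i ≡ g i
tabulate-injective e zero    = ∷-injectiveˡ e
tabulate-injective e (suc i) = tabulate-injective (∷-injectiveʳ e) i

module Coding (cl : Classical) {ℓ} {L : Signature ℓ} {X : Set ℓ} (ν : ℕ ↣ X)
              (sortCode : Sort L ↣ X) (funCode : FunSym L ↣ X) (relCode : RelSym L ↣ X) where
  open Choice cl
  open Cardinality cl
  open Pairing ν using (listCode)

  private
    variable
      V : Vars (Sort L)

    ⟨_⟩ : List X → X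
    ⟨ l ⟩ = Injection.to listCode l

    ⟨⟩-inj : ∀ {l l′} → ⟨ l ⟩ ≡ ⟨ l′ ⟩ → l ≡ l′
    ⟨⟩-inj = Injection.injective listCode

    ι : ℕ → X
    ι = Injection.to ν

    tag : ∀ {m n l l′} → ⟨ ι m ∷ l ⟩ ≡ ⟨ ι n ∷ l′ ⟩ → m ≡ n
    tag e = Injection.injective ν (∷-injectiveˡ (⟨⟩-inj e))

    args : ∀ {x y l l′} → ⟨ x ∷ l ⟩ ≡ ⟨ y ∷ l′ ⟩ → l ≡ l′
    args e = ∷-injectiveʳ (⟨⟩-inj e)

  pairCode : (X × X) ↣ X
  pairCode = mk↣ {to = λ (x , y) → ⟨ x ∷ y ∷ [] ⟩} λ e →
    cong₂ _,_ (∷-injectiveˡ (⟨⟩-inj e)) (∷-injectiveˡ (args e))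

  ⊎Code : ∀ {a b} {A : Set a} {B : Set b} → A ↣ X → B ↣ X → (A ⊎ B) ↣ X
  ⊎Code f g = mk↣ {to = [ (λ a → ⟨ ι 0 ∷ Injection.to f a ∷ [] ⟩) , (λ b → ⟨ ι 1 ∷ Injection.to g b ∷ [] ⟩) ]′}
    λ { {inj₁ _} {inj₁ _} e → cong inj₁ (Injection.injective f (∷-injectiveˡ (args e)))
      ; {inj₂ _} {inj₂ _} e → cong inj₂ (Injection.injective g (∷-injectiveˡ (args e)))
      ; {inj₁ _} {inj₂ _} e → ⊥-elim (ℕₚ.0≢1+n (tag e))
      ; {inj₂ _} {inj₁ _} e → ⊥-elim (ℕₚ.1+n≢0 (tag e)) }

  private
    extend : ∀ {A : Set ℓ} → A ↣ X → Maybe A ↣ X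
    extend e = mk↣ {to = λ { nothing → ⟨ ι 0 ∷ [] ⟩ ; (just v) → ⟨ ι 1 ∷ Injection.to e v ∷ [] ⟩ }}
      λ { {nothing} {nothing} _ → refl
        ; {just _} {just _} p → cong just (Injection.injective e (∷-injectiveˡ (args p)))
        ; {nothing} {just _} p → ⊥-elim (ℕₚ.0≢1+n (tag p))
        ; {just _} {nothing} p → ⊥-elim (ℕₚ.1+n≢0 (tag p)) }

    term : Var V ↣ X → ∀ {s} → Term L V s → X
    term e (var v)    = ⟨ ι 0 ∷ Injection.to e v ∷ [] ⟩
    term e (app f ts) = ⟨ ι 1 ∷ Injection.to funCode f ∷ tabulate (λ i → term e (ts (lift i))) ⟩

    Σ-injective : ∀ {s} {t u : Term L V s} → _≡_ {A = Σ (Sort L) (Term L V)} (s , t) (s , u) → t ≡ u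
    Σ-injective refl = refl

    -- The code of a term does not record its sort, so equality of the sorts has to be part of the
    -- conclusion.
    term-inj : (e : Var V ↣ X) → ∀ {s s′} (t : Term L V s) (u : Term L V s′) → term e t ≡ term e u →
               _≡_ {A = Σ (Sort L) (Term L V)} (s , t) (s′ , u)
    term-inj e (var v) (var v′) p with Injection.injective e (∷-injectiveˡ (args p))
    ... | refl = refl
    term-inj e (var v) (app f us) p with tag p
    ... | ()
    term-inj e (app f ts) (var v) p with tag p
    ... | ()
    term-inj e (app f ts) (app g us) p with ∷-injective (args p)
    ... | q , r with Injection.injective funCode q
    ...   | refl = cong (λ ts → _ , app f ts) (extensionality λ (lift i) →
                     Σ-injective (term-inj e (ts (lift i)) (us (lift i)) (tabulate-injective r i)))

    encode : Var V ↣ X → Formula L V → X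
    encode e (_≐ᶠ_ {s} t u) = ⟨ ι 0 ∷ Injection.to sortCode s ∷ term e t ∷ term e u ∷ [] ⟩
    encode e (rel r ts)     = ⟨ ι 1 ∷ Injection.to relCode r ∷ tabulate (λ i → term e (ts (lift i))) ⟩
    encode e ⊥ᶠ             = ⟨ ι 2 ∷ [] ⟩
    encode e (φ ⇒ᶠ ψ)       = ⟨ ι 3 ∷ encode e φ ∷ encode e ψ ∷ [] ⟩
    encode e (∀ᶠ s φ)       = ⟨ ι 4 ∷ Injection.to sortCode s ∷ encode (extend e) φ ∷ [] ⟩

    -- Comparing the leading tags beforehand disposes of all pairs of distinct constructors, so that
    -- `go` meets only the five diagonal cases.
    kind : Formula L V → ℕ
    kind (t ≐ᶠ u)   = 0
    kind (rel r ts) = 1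
    kind ⊥ᶠ         = 2
    kind (φ ⇒ᶠ ψ)   = 3
    kind (∀ᶠ s φ)   = 4

    kind-encode : (e : Var V ↣ X) (φ : Formula L V) → ∃[ l ] encode e φ ≡ ⟨ ι (kind φ) ∷ l ⟩
    kind-encode e (t ≐ᶠ u)   = _ , refl
    kind-encode e (rel r ts) = _ , refl
    kind-encode e ⊥ᶠ         = _ , refl
    kind-encode e (φ ⇒ᶠ ψ)   = _ , refl
    kind-encode e (∀ᶠ s φ)   = _ , refl

    same-kind : (e : Var V ↣ X) (φ ψ : Formula L V) → encode e φ ≡ encode e ψ → kind φ ≡ kind ψ
    same-kind e φ ψ p = tag (trans (sym (proj₂ (kind-encode e φ))) (trans p (proj₂ (kind-encode e ψ))))

    encode-inj : (e : Var V ↣ X) (φ ψ : Formula L V) → encode e φ ≡ encode e ψ → φ ≡ ψ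
    encode-inj e φ ψ p = go φ ψ (same-kind e φ ψ p) p
      where
      go : ∀ φ ψ → kind φ ≡ kind ψ → encode e φ ≡ encode e ψ → φ ≡ ψ
      go (_≐ᶠ_ {s} t u) (_≐ᶠ_ {s′} t′ u′) _ p with Injection.injective sortCode (∷-injectiveˡ (args p))
      ... | refl = cong₂ _≐ᶠ_
        (Σ-injective (term-inj e t t′ (∷-injectiveˡ (∷-injectiveʳ (args p)))))
        (Σ-injective (term-inj e u u′ (∷-injectiveˡ (∷-injectiveʳ (∷-injectiveʳ (args p))))))
      go (rel r ts) (rel r′ us) _ p with ∷-injective (args p)
      ... | q , q′ with Injection.injective relCode q
      ...   | refl = cong (rel r) (extensionality λ (lift i) →
                       Σ-injective (term-inj e (ts (lift i)) (us (lift i)) (tabulate-injective q′ i)))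
      go ⊥ᶠ ⊥ᶠ _ p = refl
      go (φ ⇒ᶠ ψ) (φ′ ⇒ᶠ ψ′) _ p = cong₂ _⇒ᶠ_ (encode-inj e φ φ′ (∷-injectiveˡ (args p)))
                                          (encode-inj e ψ ψ′ (∷-injectiveˡ (∷-injectiveʳ (args p))))
      go (∀ᶠ s φ) (∀ᶠ s′ φ′) _ p with Injection.injective sortCode (∷-injectiveˡ (args p))
      ... | refl = cong (∀ᶠ s) (encode-inj (extend e) φ φ′ (∷-injectiveˡ (∷-injectiveʳ (args p))))

  formulaCode : Var V ↣ X → Formula L V ↣ X
  formulaCode e = mk↣ {to = encode e} λ {φ} {ψ} → encode-inj e φ ψ

module SmallSyntax (cl : Classical) {ℓ} (κ : Cardinal ℓ) (strongLimit : StrongLimit κ)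
                   (small-ℕ : setoid (Lift ℓ ℕ) <ᶜ κ) where
  open Cardinality cl
  open SmallSets κ strongLimit small-ℕ

  small-Formula : {L : Signature ℓ} {V : Vars (Sort L)} → Small (Sort L) → Small (FunSym L) →
                  Small (RelSym L) → Small (Var V) → Small (Formula L V)
  small-Formula {L} {V} s f r v = small-↣ (formulaCode (mk↣ {to = inj₂ ∘ inj₂ ∘ inj₂ ∘ inj₂} λ { refl → refl }))
      (small-⊎ small-ℕ (small-⊎ s (small-⊎ f (small-⊎ r v))))
    where
    X : Set ℓ
    X = Lift ℓ ℕ ⊎ Sort L ⊎ FunSym L ⊎ RelSym L ⊎ Var V
    number : ℕ ↣ X
    number = mk↣ {to = inj₁ ∘ lift} λ { refl → refl }
    sort′ : Sort L ↣ X
    sort′ = mk↣ {to = inj₂ ∘ inj₁} λ { refl → refl }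
    function : FunSym L ↣ X
    function = mk↣ {to = inj₂ ∘ inj₂ ∘ inj₁} λ { refl → refl }
    relation′ : RelSym L ↣ X
    relation′ = mk↣ {to = inj₂ ∘ inj₂ ∘ inj₂ ∘ inj₁} λ { refl → refl }
    open Coding cl {L = L} number sort′ function relation′

module SmallLanguage (cl : Classical) {ℓ} {L : Signature ℓ} {T : Theory L} {κ : Cardinal ℓ}
                     {ℭ : Structure L} (monster : IsMonster T κ ℭ) where
  open Choice cl
  open Compactness cl monster
  open SmallSyntax cl κ (IsMonster.strongLimit monster) small-ℕ public

  private
    small-lang : ∀ {X : Set ℓ} → X ↣ Setoid.Carrier ∣ T ∣ᵀ → Small X
    small-lang {X} f = ≤<-trans {X = setoid X} {∣ T ∣ᵀ} {κ} f (IsMonster.∣T∣<κ monster)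

  small-formula : ∀ {U : Vars (Sort L)} → Small (Var U) → Small (Formula L U)
  small-formula = small-Formula (small-lang (mk↣ {to = λ s → inj₂ (inj₁ s)} λ { refl → refl }))
    (small-lang (mk↣ {to = λ s → inj₂ (inj₂ (inj₁ s))} λ { refl → refl }))
    (small-lang (mk↣ {to = λ s → inj₂ (inj₂ (inj₂ s))} λ { refl → refl }))

-- The parameters of A, one for each element of ℭ that A meets.
module Parameter (cl : Classical) {ℓ} {L : Signature ℓ} (T : Theory L) (ℭ : Structure L) (A : Subset ℭ) where
  open Choice cl

  repVars : Vars (Sort L)
  repVars = vars (Representative ∣ ℭ ∋ A ∣) λ (((s , _) , _) , _) → s

  repTuple : Tuple ℭ repVars
  repTuple = tuple λ (((_ , x) , _) , _) → x

  Symbols : Cardinal ℓ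
  Symbols = ∣ T ∣ᵀ ⊎ₛ ∣ ℭ ∋ A ∣

  private
    X : Set ℓ
    X = Representative Symbols

    represent-inj : ∀ {x y} → represent Symbols x ≡ represent Symbols y → Setoid._≈_ Symbols x y
    represent-inj = Injection.injective (≤Rep Symbols)

    symbol : ∀ {a} {Y : Set a} (f : Y → Setoid.Carrier ∣ T ∣ᵀ) → (∀ {x y} → f x ≡ f y → x ≡ y) → Y ↣ X
    symbol f inj = mk↣ {to = represent Symbols ∘ inj₁ ∘ f} λ e → strip (represent-inj e)
      where
      strip : ∀ {x y} → Setoid._≈_ Symbols (inj₁ (f x)) (inj₁ (f y)) → x ≡ y
      strip (Pointwise.inj₁ e) = inj e

    parameter : Var repVars ↣ X
    parameter = mk↣ {to = represent Symbols ∘ inj₂ ∘ proj₁} λ e → strip (represent-inj e)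
      where
      strip : ∀ {x y : Var repVars} → Setoid._≈_ Symbols (inj₂ (proj₁ x)) (inj₂ (proj₁ y)) → x ≡ y
      strip (Pointwise.inj₂ e) = Injection.injective (Rep≤ ∣ ℭ ∋ A ∣) e

    naturals : ℕ ↣ X
    naturals = symbol inj₁ λ { refl → refl }

    sorts : Sort L ↣ X
    sorts = symbol (inj₂ ∘ inj₁) λ { refl → refl }

    functions : FunSym L ↣ X
    functions = symbol (inj₂ ∘ inj₂ ∘ inj₁) λ { refl → refl }

    relations : RelSym L ↣ X
    relations = symbol (inj₂ ∘ inj₂ ∘ inj₂) λ { refl → refl }

    open Coding cl {L = L} naturals sorts functions relations

  -- A coset will be recorded as a set of pairs of a thick set and a position in its net. The exact
  -- bound 2^(|T|+|A|) on the index, and not merely smallness, rests on this embedding.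
  formulas×ℕ : ∀ {n} {σ : Fin n → Sort L} → (Formula L (fin (n , σ) ⊕ repVars) × Lift ℓ ℕ) ↣ Representative Symbols
  formulas×ℕ {n} = pairCode ↣∘ mk↣ {to = λ (φ , lift k) → Injection.to code φ , Injection.to naturals k}
      λ e → cong₂ _,_ (Injection.injective code (cong proj₁ e))
          (cong lift (Injection.injective naturals (cong proj₂ e)))
    where
    code = formulaCode (⊎Code (naturals ↣∘ mk↣ {to = λ (lift i) → toℕ i} λ e → cong lift (toℕ-injective e)) parameter)

  subsets≤ : setoid (Representative Symbols → Bool) ≤ᶜ 2^ Symbols
  subsets≤ = record
    { to        = λ f → record { to = f ∘ represent Symbols ; cong = cong f ∘ Injection.cong (≤Rep Symbols) }
    ; cong      = λ { refl _ → refl }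
    ; injective = λ {f} {g} e → extensionality λ (s , p) →
        subst (λ x → f x ≡ g x) (Rep-≡ Symbols p) (e s)
    }

module Index (cl : Classical) {ℓ} {L : Signature ℓ} {T : Theory L} {κ : Cardinal ℓ}
             {ℭ : Structure L} (monster : IsMonster T κ ℭ) (G : GroupIn ℭ)
             (parameters : GroupOver.Parameters cl monster G) where
  open Choice cl
  open GroupIn G
  open GroupOver.Parameters parameters using (small-W)
  open Compactness cl monster
  open SmallLanguage cl monster using (small-formula)
  open DefinableSets cl monster G parameters
  open ThickSets cl monster G parameters
  open Powers group

  Component : Pred Elt ℓ
  Component = generated Core

  small-Code : Small Code
  small-Code = small-formula (small-⊎ small-Fin small-W)

  component-isSubgroup : IsSubgroup group Component
  component-isSubgroup = generated-isSubgroup (λ {x} {y} → core-resp {x} {y}) (λ {x} → core-⁻¹ {x})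

  private
    nth : List Elt → ℕ → Elt
    nth []      _       = ε
    nth (x ∷ l) zero    = x
    nth (x ∷ l) (suc n) = nth l n

    nth-∈ : ∀ {l m} → m ∈ l → ∃[ i ] nth l i ≡ m
    nth-∈ (here refl) = 0 , refl
    nth-∈ (there p)   = let i , e = nth-∈ p in suc i , e

    -- Attached to the code and not to a proof of thickness, so that any two elements are tested
    -- against the same net.
    centres : Code → List Elt
    centres θ with dec (Thick θ)
    ... | yes t = proj₁ (net t)
    ... | no _  = []

    centres-cover : ∀ {θ} → Thick θ → ∀ x → ∃[ i ] ⟦ θ ⟧ (nth (centres θ) i ⁻¹ ∙ x)
    centres-cover {θ} t x with dec (Thick θ)
    ... | no n   = ⊥-elim (n t)
    ... | yes t′ = at-index (proj₂ (net t′) x)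
      where
      at-index : (∃[ m ] m ∈ proj₁ (net t′) × ⟦ θ ⟧ (m ⁻¹ ∙ x)) → ∃[ i ] ⟦ θ ⟧ (nth (proj₁ (net t′)) i ⁻¹ ∙ x)
      at-index (m , p , q) = let i , e = nth-∈ p in i , subst (λ m → ⟦ θ ⟧ (m ⁻¹ ∙ x)) (sym e) q

    cells : Elt → Code × Lift ℓ ℕ → Bool
    cells x (θ , lift i) = truth (⟦ θ ⟧ (nth (centres θ) i ⁻¹ ∙ x))

    -- For each thick θ both elements lie in one translate mθ of the net, so their quotient is in θ²
    -- by symmetry; `pow-core` brings it into the square of the core.
    cells-inj : ∀ x y → cells x ≡ cells y → Component (x ⁻¹ ∙ y)
    cells-inj x y e = 2 , pow-core 2 {x ⁻¹ ∙ y} λ θ t →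
      let i , p = centres-cover t x
          m = nth (centres θ) i
          q = holds (trans (cong (λ c → c (θ , lift i)) (sym e)) (isTrue p))
      in pow-quotient (λ {g} {h} → code-resp θ {g} {h}) {x} {m} {y}
           (code-resp θ {(m ⁻¹ ∙ x) ⁻¹} {x ⁻¹ ∙ m} (quotient-⁻¹ m x) (Thick.symmetric t {m ⁻¹ ∙ x} p)) q

  coset-cells : Representative (cosets group Component component-isSubgroup) ↣ (Code × Lift ℓ ℕ → Bool)
  coset-cells = mk↣ {to = cells ∘ proj₁} λ {x} {y} e →
    Injection.injective (Rep≤ (cosets group Component component-isSubgroup)) (cells-inj (proj₁ x) (proj₁ y) e)

-- The torsor and Lascar distance

-- Lets formulas with variables numbered by ℕ be read at any finite arity; numbers beyond `k` are
-- read as `k`.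
clamp : ∀ k → ℕ → Fin (suc k)
clamp k       zero    = zero
clamp zero    (suc i) = zero
clamp (suc k) (suc i) = suc (clamp k i)

clamp-toℕ : ∀ {k} (i : Fin (suc k)) → clamp k (toℕ i) ≡ i
clamp-toℕ {k}     zero    = refl
clamp-toℕ {suc k} (suc i) = cong suc (clamp-toℕ i)

-- The group as a torsor over itself: a single sort on which the relations definable over w in terms of the
-- quotients x₀⁻¹xᵢ are named, so that left translations become automorphisms.
module TorsorStructure (cl : Classical) {ℓ} {L : Signature ℓ} {T : Theory L} {κ : Cardinal ℓ}
                       {ℭ : Structure L} (monster : IsMonster T κ ℭ) (G : GroupIn ℭ)
                       (parameters : GroupOver.Parameters cl monster G) where
  open Choice cl
  open Supports cl
  open Definability cl ℭ
  open Compactness cl monster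
  open GroupIn G
  open GroupOver cl monster G
  open Parameters parameters
  open DefinableSets cl monster G parameters
  open ThickSets cl monster G parameters
  open Powers group

  private
    module C s = Setoid (carrier ℭ s)

  -- A relation symbol of arity k + 1; the variables beyond the arity are read as x₀⁻¹x₀.
  torsorSig : Signature ℓ
  torsorSig = record
    { Sort = One ; FunSym = Lift ℓ ⊥ ; dom = λ () ; cod = λ ()
    ; RelSym = Lift ℓ ℕ × Formula L (Pw (Lift ℓ ℕ) ⊕ W) ; relArity = λ (lift k , _) → suc k , λ _ → _ }

  quotients : ∀ {k} → (Fin (suc k) → Elt) → Lift ℓ ℕ → Elt
  quotients {k} x (lift i) = x zero ⁻¹ ∙ x (clamp k i)

  quotient-≈ : ∀ {g g′ h h′} → g ≈ g′ → h ≈ h′ → g ⁻¹ ∙ h ≈ g′ ⁻¹ ∙ h′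
  quotient-≈ {g} {g′} {h} {h′} = Q.quotient-cong {g} {g′} {h} {h′}

  N : Structure torsorSig
  N = record
    { carrier       = λ _ → Group.setoid group
    ; fun           = λ ()
    ; fun-cong      = λ ()
    ; relation      = λ (lift k , φ) x → ℭ ⊨ φ [ flat (quotients λ i → at x (lift i)) ⋈ w ]
    ; relation-resp = λ (lift k , φ) {x} {y} e → ⊨-resp ℭ φ (⋈-cong ℭ
        (λ (lift i , v) → quotient-≈ {at x (lift zero)} {at y (lift zero)} {at x (lift (clamp k i))}
            {at y (lift (clamp k i))}
                            (e (lift zero)) (e (lift (clamp k i))) v)
        (≋-refl ℭ))
    }

  private
    variable
      V V′ : Vars One

  termVar : ∀ {s} → Term torsorSig V s → Var V
  termVar (var v)    = v
  termVar (app () _)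

  eval-termVar : ∀ {s} (x : Tuple N V) (t : Term torsorSig V s) → eval N x t ≡ at x (termVar t)
  eval-termVar x (var v)    = refl
  eval-termVar x (app () _)

  E-∀ : ∀ {p} {J : Set ℓ} {R : Pred (J ⊎ One → Elt) p} → DefE (J ⊎ One) R → DefE J (λ x → ∀ e → R [ x , (λ _ → e) ]′)
  E-∀ {J = J} {R} d = def-⇔
    (λ x → mk⇔ (λ n e → dne λ m → n ((λ _ → e) , λ r → m (E-resp d (pointwise x (λ _ → e)) r)))
               (λ h (y , m) → m (E-resp d (λ j → ≋-sym ℭ (pointwise x y j)) (h (y (lift zero))))))
    (def-¬ (E-∃ {n = 1} {R = λ z → ¬ R (z ∘ only)} (def-¬ (E-pull only d))))
    where
    only : J ⊎ One → J ⊎ Lift ℓ (Fin 1)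
    only = [ inj₁ , (λ _ → inj₂ (lift zero)) ]′
    pointwise : ∀ x y j → [ x , y ]′ (only j) ≈ [ x , (λ _ → y (lift zero)) ]′ j
    pointwise x y (inj₁ j) = ≋-refl ℭ
    pointwise x y (inj₂ _) = ≋-refl ℭ

  private
    translation-of : (φ : Formula torsorSig V) → DefE (Var V) (λ x → N ⊨ φ [ tuple x ])
    translation-of (t ≐ᶠ u) = def-⇔ (λ x → mk⇔
      (subst₂′ (sym (eval-termVar (tuple x) t)) (sym (eval-termVar (tuple x) u)))
      (subst₂′ (eval-termVar (tuple x) t) (eval-termVar (tuple x) u))) (E-≈ (termVar t) (termVar u))
      where
      subst₂′ : ∀ {g g′ h h′ : Elt} → g ≡ g′ → h ≡ h′ → g ≈ h → g′ ≈ h′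
      subst₂′ refl refl e = e
    translation-of {V} (rel (lift k , φ) ts) = def-⇔
      (λ x → mk⇔ (λ (y , e , h) → ⊨-resp ℭ φ (⋈-cong ℭ (λ (lift i , v) → eq x y e (clamp k i) v) (≋-refl ℭ)) h)
                 (λ h → (λ (lift i) → x₀ x ⁻¹ ∙ element x i) , (λ i → eq′ x i) , h))
      (E-∃ {n = suc k} {R = λ z → (∀ i → z (inj₁ (v₀ zero)) ∙ z (inj₂ (lift i)) ≈ z (inj₁ (v₀ i))) ×
          ℭ ⊨ φ [ flat (λ (lift i) → z (inj₂ (lift (clamp k i)))) ⋈ w ]}
        (def-× (def-Fin λ i → E-∙ (inj₁ (v₀ zero)) (inj₂ (lift i)) (inj₁ (v₀ i)))
               (E-pull (λ (lift i) → inj₂ (lift (clamp k i))) (cut {R = λ y → ℭ ⊨ φ [ flat y ⋈ w ]} φ λ y → ⇔-refl))))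
      where
      v₀ : Fin (suc k) → Var V
      v₀ i = termVar (ts (lift i))
      element : (Var V → Elt) → Fin (suc k) → Elt
      element x i = eval N (tuple x) (ts (lift i))
      x₀ : (Var V → Elt) → Elt
      x₀ x = element x zero
      same-element : ∀ x i → element x i ≈ x (v₀ i)
      same-element x i = subst (λ g → element x i ≈ g) (eval-termVar (tuple x) (ts (lift i))) (≋-refl ℭ)
      eq : ∀ x y → (∀ i → x (v₀ zero) ∙ y (lift i) ≈ x (v₀ i)) → ∀ i → y (lift i) ≈ x₀ x ⁻¹ ∙ element x i
      eq x y e i = ≋-trans ℭ (Q.solve-quotient (x (v₀ zero)) (y (lift i)) (x (v₀ i)) (e i))
        (quotient-≈ {x (v₀ zero)} {x₀ x} {x (v₀ i)} {element x i} (≋-sym ℭ (same-element x zero))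
            (≋-sym ℭ (same-element x i)))
      eq′ : ∀ x i → x (v₀ zero) ∙ (x₀ x ⁻¹ ∙ element x i) ≈ x (v₀ i)
      eq′ x i = ≋-trans ℭ (Gr.∙-congˡ {x (v₀ zero)} {x₀ x ⁻¹ ∙ element x i} {x (v₀ zero) ⁻¹ ∙ x (v₀ i)}
          (quotient-≈ {x₀ x} {x (v₀ zero)} {element x i} {x (v₀ i)} (same-element x zero) (same-element x i)))
        (Gp.\\-leftDividesˡ (x (v₀ zero)) (x (v₀ i)))
    translation-of ⊥ᶠ = def-const (Lift ℓ ⊥)
    translation-of (φ ⇒ᶠ ψ) = def-⇒ (translation-of φ) (translation-of ψ)
    translation-of {V} (∀ᶠ s φ) = def-⇔
      (λ x → mk⇔ (λ h e → ⊨-resp N φ (eq x e) (h e)) (λ h e → ⊨-resp N φ (eq⁻¹ x e) (h e)))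
      (E-∀ {R = λ z → N ⊨ φ [ tuple (z ∘ place) ]} (E-pull place (translation-of φ)))
      where
      place : Maybe (Var V) → Var V ⊎ One
      place (just v) = inj₁ v
      place nothing  = inj₂ _
      eq : ∀ x e → tuple {C = carrier N} {V = V ▷ s} ([ x , (λ _ → e) ]′ ∘ place) ≋ tuple x ⋈₁ e
      eq x e (just v) = ≋-refl ℭ
      eq x e nothing  = ≋-refl ℭ
      eq⁻¹ : ∀ x e → tuple x ⋈₁ e ≋ tuple {C = carrier N} {V = V ▷ s} ([ x , (λ _ → e) ]′ ∘ place)
      eq⁻¹ x e (just v) = ≋-refl ℭ
      eq⁻¹ x e nothing  = ≋-refl ℭ

  abstract
    -- Through this the torsor inherits saturation from `ℭ`: a type in `N` becomes a family of
    -- definable conditions on group elements, open to `compactE`.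
    translate : (φ : Formula torsorSig V) → DefE (Var V) (λ x → N ⊨ φ [ tuple x ])
    translate = translation-of

  over : ∀ {a p} {X : Set a} {U : Vars (Sort L)} {ι : X → Tuple ℭ U} {R : Pred X p} → Cut (λ x → ι x ⋈ w) R →
         Σ[ φ ∈ FormulaOver ℭ (everything ℭ) U ] (∀ x → R x ⇔ Holds ℭ (everything ℭ) φ (ι x))
  over {X = X} {U} {ι} d = formula d′ , defines d′
    where
    d′ = renameVia {ι′ = λ x → ι x ⋈ enum ℭ (everything ℭ)} d id
      (ren {V = U ⊕ W} {W = U ⊕ params ℭ (everything ℭ)}
           (λ { (inj₁ v) → inj₁ v ; (inj₂ v) → inj₂ ((sortOf W v , at w v) , _) })
           (λ { (inj₁ v) → refl ; (inj₂ v) → refl }))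
      λ { x (inj₁ v) → C.refl _ ; x (inj₂ v) → C.refl _ }

  private
    abstract
      domain : Σ[ φ ∈ FormulaOver ℭ (everything ℭ) ar ] (∀ x → Member x ⇔ Holds ℭ (everything ℭ) φ x)
      domain = over member
      equality : Σ[ φ ∈ FormulaOver ℭ (everything ℭ) (ar ⊕ ar) ]
                 (∀ ((x , y) : Tuple ℭ ar × Tuple ℭ ar) → x ≋ y ⇔ Holds ℭ (everything ℭ) φ (x ⋈ y))
      equality = over (def-⇔ (λ x → mk⇔ (λ h (lift i) → h i) (λ h i → h (lift i)))
        (def-Fin λ i → cut (var (inj₁ (inj₁ (lift i))) ≐ᶠ var (inj₁ (inj₂ (lift i)))) λ x → ⇔-refl))
      relations : ∀ r → Σ[ φ ∈ FormulaOver ℭ (everything ℭ) (Pw (Lift ℓ (Fin (suc (lower (proj₁ r)))))) ]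
        (∀ (x : Lift ℓ (Fin (suc (lower (proj₁ r)))) → Elt) → relation N r (tuple x) ⇔
            Holds ℭ (everything ℭ) φ (flat x))
      relations r = over (translate (rel r λ i → var i))
    element : (∃[ x ] Holds ℭ (everything ℭ) (proj₁ domain) x) → Elt
    element (x , h) = x , from (proj₂ domain x) h

  interpretation : Interpretation ℭ N
  interpretation = record
    { dim              = λ _ → arity
    ; domain           = λ _ → proj₁ domain
    ; quot             = λ _ → element
    ; surjective       = λ _ (y , m) → (y , to (proj₂ domain y) m) , ≋-refl ℭ
    ; equality         = λ _ → proj₁ equality
    ; equality-defines = λ _ x y → ⇔-sym (proj₂ equality (proj₁ x , proj₁ y))
    ; graph            = λ ()
    ; graph-defines    = λ ()
    ; relationFormula  = λ r → proj₁ (relations r)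
    ; relation-defines = λ r x → ⇔-sym (proj₂ (relations r) (λ v → element (x v)))
    }

  module Translation (σ : Automorphism ℭ) (fixes : Automorphism.apply σ w ≋ w) (a b : Elt) where
    open Action σ fixes
    open Action (σ ⁻¹ᴬ) (fixes-⁻¹ σ fixes) using () renaming (act to act⁻¹; act-cong to act⁻¹-cong)

    -- Relations of `N` depend on quotients only. Left translations leave these unchanged, and `act`
    -- moves them by an automorphism over `w`; the composite is arranged to send `a` to `b`.
    τ τ⁻¹ : Elt → Elt
    τ x = b ∙ act (a ⁻¹ ∙ x)
    τ⁻¹ x = a ∙ act⁻¹ (b ⁻¹ ∙ x)

    τ-cong : ∀ {x y} → x ≈ y → τ x ≈ τ y
    τ-cong {x} {y} e = Gr.∙-congˡ {b} {act (a ⁻¹ ∙ x)} {act (a ⁻¹ ∙ y)}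
      (act-cong {a ⁻¹ ∙ x} {a ⁻¹ ∙ y} (Gr.∙-congˡ {a ⁻¹} {x} {y} e))

    τ⁻¹-cong : ∀ {x y} → x ≈ y → τ⁻¹ x ≈ τ⁻¹ y
    τ⁻¹-cong {x} {y} e = Gr.∙-congˡ {a} {act⁻¹ (b ⁻¹ ∙ x)} {act⁻¹ (b ⁻¹ ∙ y)}
      (act⁻¹-cong {b ⁻¹ ∙ x} {b ⁻¹ ∙ y} (Gr.∙-congˡ {b ⁻¹} {x} {y} e))

    τ-τ⁻¹ : ∀ x → τ (τ⁻¹ x) ≈ x
    τ-τ⁻¹ x = ≋-trans ℭ (Gr.∙-congˡ {b} {act (a ⁻¹ ∙ τ⁻¹ x)} {b ⁻¹ ∙ x} (≋-trans ℭ
        (act-cong {a ⁻¹ ∙ τ⁻¹ x} {act⁻¹ (b ⁻¹ ∙ x)} (Gp.\\-leftDividesʳ a (act⁻¹ (b ⁻¹ ∙ x))))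
        (apply-⁻¹ʳ σ (proj₁ (b ⁻¹ ∙ x)))))
      (Gp.\\-leftDividesˡ b x)

    τ⁻¹-τ : ∀ x → τ⁻¹ (τ x) ≈ x
    τ⁻¹-τ x = ≋-trans ℭ (Gr.∙-congˡ {a} {act⁻¹ (b ⁻¹ ∙ τ x)} {a ⁻¹ ∙ x} (≋-trans ℭ
        (act⁻¹-cong {b ⁻¹ ∙ τ x} {act (a ⁻¹ ∙ x)} (Gp.\\-leftDividesʳ b (act (a ⁻¹ ∙ x))))
        (apply-⁻¹ˡ σ (proj₁ (a ⁻¹ ∙ x)))))
      (Gp.\\-leftDividesˡ a x)

    τ-quotient : ∀ x y → act (x ⁻¹ ∙ y) ≈ τ x ⁻¹ ∙ τ y
    τ-quotient x y = ≋-sym ℭ (≋-trans ℭ (cancel-inner b (act (a ⁻¹ ∙ x)) (act (a ⁻¹ ∙ y)))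
      (≋-trans ℭ (≋-sym ℭ (act-quotient (a ⁻¹ ∙ x) (a ⁻¹ ∙ y)))
        (act-cong {(a ⁻¹ ∙ x) ⁻¹ ∙ (a ⁻¹ ∙ y)} {x ⁻¹ ∙ y} (quotient-chain a x y))))

    τ-base : τ a ≈ b
    τ-base = ≋-trans ℭ (Gr.∙-congˡ {b} {act (a ⁻¹ ∙ a)} {ε}
        (≋-trans ℭ (act-cong {a ⁻¹ ∙ a} {ε} (Gr.inverseˡ a)) act-ε)) (Gr.identityʳ b)

    τ-value : ∀ {x y} → act (a ⁻¹ ∙ x) ≈ b ⁻¹ ∙ y → τ x ≈ y
    τ-value {x} {y} e = ≋-trans ℭ (Gr.∙-congˡ {b} {act (a ⁻¹ ∙ x)} {b ⁻¹ ∙ y} e) (Gp.\\-leftDividesˡ b y)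

    translation : Automorphism N
    translation = record
      { bijection = λ _ → record
        { to = τ ; from = τ⁻¹ ; to-cong = λ {x} {y} → τ-cong {x} {y} ; from-cong = λ {x} {y} → τ⁻¹-cong {x} {y}
        ; inverse = (λ {x} {y} e → ≋-trans ℭ (τ-cong {y} {τ⁻¹ x} e) (τ-τ⁻¹ x))
                  , (λ {x} {y} e → ≋-trans ℭ (τ⁻¹-cong {y} {τ x} e) (τ⁻¹-τ x)) }
      ; preserves-fun = λ ()
      ; preserves-rel = λ (lift k , φ) x →
          act-invariantE (cut {R = λ y → ℭ ⊨ φ [ flat y ⋈ w ]} φ λ y → ⇔-refl) (quotients λ i → at x (lift i)) ⇔∘
          ⊨-resp⇔ ℭ φ (⋈-cong ℭ (λ (lift i , v) → τ-quotient (at x (lift zero)) (at x (lift (clamp k i))) v)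
              (≋-refl ℭ))
      }

  private
    open SmallLanguage cl monster

    small-RelSym : Small (RelSym torsorSig)
    small-RelSym = small-× small-ℕ (small-formula (small-⊎ (small-Pw small-ℕ) small-W))

  small-torsorFormula : ∀ {V : Vars One} → Small (Var V) → Small (Formula torsorSig V)
  small-torsorFormula = small-Formula small-One small-⊥ small-RelSym

  private
    small-Th : ∣ Th N ∣ᵀ <ᶜ κ
    small-Th = ≤<-trans {X = ∣ Th N ∣ᵀ} {setoid (Lift ℓ ℕ ⊎ One ⊎ Lift ℓ ⊥ ⊎ RelSym torsorSig)} {κ}
      (mk↣ {to = [ inj₁ ∘ lift , inj₂ ]′} λ { {inj₁ _} {inj₁ _} refl → refl ; {inj₂ _} {inj₂ _} refl →
          refl ; {inj₁ _} {inj₂ _} () ; {inj₂ _} {inj₁ _} () })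
      (small-⊎ small-ℕ (small-⊎ small-One (small-⊎ small-⊥ small-RelSym)))

  private
    module Saturation (A : Subset N) (small-A : ∣ N ∋ A ∣ <ᶜ κ) (s : One) (p : Pred (FormulaOver N A (single s)) ℓ)
                      (sat : FinitelySatisfiable N A p) where
      R = Representative ∣ N ∋ A ∣
      value : R → Elt
      value (((_ , e) , _) , _) = e
      value-≈ : ∀ c → at (enum N A) c ≈ value (represent ∣ N ∋ A ∣ c)
      value-≈ c = strip (rep-≈ ∣ N ∋ A ∣ c)
        where
        strip : ∀ {x y} → EqElement N x y → proj₂ y ≈ proj₂ x
        strip (same e) = ≋-sym ℭ e
      place : Var (single s) ⊎ ∃ A → One ⊎ R
      place (inj₁ _) = inj₁ _
      place (inj₂ c) = inj₂ (represent ∣ N ∋ A ∣ c)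
      Condition : ∃ p → Pred (One ⊎ R → Elt) ℓ
      Condition (φ , _) z = N ⊨ φ [ tuple (z ∘ place) ]
      move : ∀ (φ : FormulaOver N A (single s)) (x : Tuple N (single s)) (z : One → Elt) → (∀ i → at x i ≈ z _) →
             Holds N A φ x ⇔ N ⊨ φ [ tuple ([ z , value ]′ ∘ place) ]
      move φ x z e = ⊨-resp⇔ N φ λ { (inj₁ i) → e i ; (inj₂ c) → value-≈ c }
      conditions : (is : List (∃ p)) → ∃[ z ] All (λ i → Condition i [ z , value ]′) is
      conditions is = let x , h = sat (map proj₁ is) (ps is) in (λ _ → at x _) , transfer x is h
        where
        ps : ∀ is → All p (map proj₁ is)
        ps []             = []
        ps ((_ , q) ∷ is) = q ∷ ps is
        transfer : ∀ x is → All (λ φ → Holds N A φ x) (map proj₁ is) →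
            All (λ i → Condition i [ (λ _ → at x _) , value ]′) is
        transfer x []             []       = []
        transfer x ((φ , _) ∷ is) (h ∷ hs) = to (move φ x (λ _ → at x _) λ _ → ≋-refl ℭ) h ∷ transfer x is hs
      realized : ∃[ z ] (∀ i → Condition i [ z , value ]′)
      realized = compactE small-One (≤<-trans {X = setoid R} {∣ N ∋ A ∣} {κ} (Rep≤ ∣ N ∋ A ∣) small-A) value
          {R = Condition}
        (λ (φ , _) → E-pull place (translate φ)) conditions
      result : Realized N A p
      result = tuple (λ _ → proj₁ realized _) , λ φ q →
        from (move φ (tuple λ _ → proj₁ realized _) (proj₁ realized) λ _ → ≋-refl ℭ) (proj₂ realized (φ , q))

    module Homogeneity (V : Vars One) (small-V : Small (Var V)) (a b : Tuple N V)
                       (types : ∀ (φ : Formula torsorSig V) → N ⊨ φ [ a ] ⇔ N ⊨ φ [ b ]) (v₀ : Var V) where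
      from-base : Tuple N V → Var V → Elt
      from-base x v = at x v₀ ⁻¹ ∙ at x v
      module _ (φ : Formula L (Pw (Var V) ⊕ W)) where
        n = proj₁ (support-fin φ)
        vs : Fin n → Var (Pw (Var V) ⊕ W)
        vs = proj₁ (proj₂ (support-fin φ))
        φ₀ = proj₁ (proj₂ (proj₂ (support-fin φ)))
        point : Var (Pw (Var V) ⊕ W) → Var V
        point (inj₁ (j , _)) = j
        point (inj₂ _)       = v₀
        -- The base point occupies position 0, as a relation of `N` divides by its first argument;
        -- the variables of `φ₀` therefore move up by one.
        points : Fin (suc n) → Var V
        points zero    = v₀
        points (suc i) = point (vs i)
        place : ℕ → Var (Pw (Var V) ⊕ W) → Var (Pw (Lift ℓ ℕ) ⊕ W)
        place i (inj₁ (_ , v)) = inj₁ (lift i , v)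
        place i (inj₂ v)       = inj₂ v
        place-sort : ∀ i u → sortOf (Pw (Lift ℓ ℕ) ⊕ W) (place i u) ≡ sortOf (Pw (Var V) ⊕ W) u
        place-sort i (inj₁ _) = refl
        place-sort i (inj₂ _) = refl
        ρ : Ren (fin (n , λ i → sortOf (Pw (Var V) ⊕ W) (vs i))) (Pw (Lift ℓ ℕ) ⊕ W)
        ρ = ren (λ (lift i) → place (suc (toℕ i)) (vs i)) (λ (lift i) → place-sort (suc (toℕ i)) (vs i))
        relationSymbol : RelSym torsorSig
        relationSymbol = lift n , rename ρ φ₀
        placed : ∀ (x : Tuple N V) u i → clamp n (toℕ i) ≡ i → points i ≡ point u →
                 Eq ℭ (at (flat (from-base x) ⋈ w) u)
                      (subst ∥ ℭ ∥ (place-sort (toℕ i) u) (at (flat (quotients λ i → at x (points i)) ⋈ w)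
                          (place (toℕ i) u)))
        placed x (inj₁ (j , v)) i c e = C.reflexive _ (cong (λ k → at (proj₁ (from-base x k)) v)
            (sym (trans (cong points c) e)))
        placed x (inj₂ v)       i c e = C.refl _
        express : ∀ x → ℭ ⊨ φ [ flat (from-base x) ⋈ w ] ⇔ N ⊨ rel relationSymbol (λ (lift i) → var (points i)) [ x ]
        express x = proj₂ (proj₂ (proj₂ (support-fin φ))) ℭ (flat (from-base x) ⋈ w) ⇔∘
          ⊨-resp⇔ ℭ φ₀ (λ (lift i) → placed x (vs i) (suc i) (clamp-toℕ (suc i)) refl) ⇔∘
          ⇔-sym (⊨-rename ℭ ρ φ₀ _)
      similar : ∀ φ → ℭ ⊨ φ [ flat (from-base a) ⋈ w ] → ℭ ⊨ φ [ flat (from-base b) ⋈ w ]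
      similar φ h = from (express φ b) (to (types (rel (relationSymbol φ) λ (lift i) → var (points φ i)))
          (to (express φ a) h))
      result : Σ[ σ ∈ Automorphism N ] Automorphism.apply σ a ≋ b
      result = let σ , fixes , e = homogeneousE small-V (from-base a) (from-base b) similar
                   open Translation σ fixes (at a v₀) (at b v₀)
               in translation , λ v → τ-value {at a v} {at b v} (e v)

    homogeneous : (V : Vars One) → Small (Var V) → (a b : Tuple N V) →
                  (∀ (φ : Formula torsorSig V) → N ⊨ φ [ a ] ⇔ N ⊨ φ [ b ]) →
                  Σ[ σ ∈ Automorphism N ] Automorphism.apply σ a ≋ b
    homogeneous V small-V a b types with dec (Var V)
    ... | yes v₀ = Homogeneity.result V small-V a b types v₀
    -- Without variables there is no base point, and any automorphism will do.
    ... | no n   = idAut , λ v → ⊥-elim (n v)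

  torsor-monster : IsMonster (Th N) κ N
  torsor-monster = record
    { isModel     = id
    ; strongLimit = IsMonster.strongLimit monster
    ; ∣T∣<κ       = small-Th
    ; saturated   = Saturation.result
    ; homogeneous = homogeneous
    }

-- Types over models of the torsor and Lascar distance

module LascarDistance (cl : Classical) {ℓ} {L : Signature ℓ} {T : Theory L} {κ : Cardinal ℓ}
                      {ℭ : Structure L} (monster : IsMonster T κ ℭ) (G : GroupIn ℭ)
                      (parameters : GroupOver.Parameters cl monster G) where
  open Choice cl
  open Supports cl
  open Cardinality cl
  open Compactness cl monster
  open GroupIn G
  open GroupOver cl monster G
  open Parameters parameters
  open DefinableSets cl monster G parameters
  open ThickSets cl monster G parameters
  open TorsorStructure cl monster G parameters
  open Index cl monster G parameters using (Component)
  open Powers group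
  open ElementarySubstructures cl N
  private
    module DN = Definability cl N

    variable
      V : Vars One

  -- A binary symbol: `lift 1` gives arity two, and variable number 1 stands for x₀⁻¹x₁.
  quotientSymbol : Code → RelSym torsorSig
  quotientSymbol θ = lift 1 , rename
    (ren {V = ar ⊕ W} {W = Pw (Lift ℓ ℕ) ⊕ W} (λ { (inj₁ v) → inj₁ (lift 1 , v) ; (inj₂ v) → inj₂ v })
        (λ { (inj₁ v) → refl ; (inj₂ v) → refl })) θ

  two : ∀ {a} {X : Set a} → X → X → Fin 2 → X
  two u v zero    = u
  two u v (suc _) = v

  quotientFormula : Code → (u v : Var V) → Formula torsorSig V
  quotientFormula θ u v = rel (quotientSymbol θ) λ (lift i) → var (two u v i)

  quotientFormula⇔ : ∀ θ (u v : Var V) (x : Tuple N V) → ⟦ θ ⟧ (at x u ⁻¹ ∙ at x v) ⇔ N ⊨ quotientFormula θ u v [ x ]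
  quotientFormula⇔ θ u v x =
    ⊨-resp⇔ ℭ θ (λ { (inj₁ _) → Setoid.refl (carrier ℭ _) ; (inj₂ _) → Setoid.refl (carrier ℭ _) }) ⇔∘
        ⇔-sym (⊨-rename ℭ _ θ _)

  Single : Elt → Tuple N (single _)
  Single g = tuple λ _ → g

  module _ {M : Subset N} (elementary : IsElementarySubstructure N M) where

    private
      Point : Set ℓ
      Point = ∃[ e ] M (_ , e)

      V-M : Vars One
      V-M = vars Point λ _ → _

      Far : Code → List Point → Elt → Set ℓ
      Far θ l e = All (λ (m , _) → ¬ ⟦ θ ⟧ (e ⁻¹ ∙ m)) l

      far-def : ∀ θ l → DN.Cut {V = V-M ▷ _} (λ e → tuple (λ (m , _) → m) ⋈₁ e) (Far θ l)
      far-def θ l = DN.def-all (λ m → DN.def-¬ (DN.cut (quotientFormula θ nothing (just m))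
        λ e → quotientFormula⇔ θ nothing (just m) (tuple (λ (m , _) → m) ⋈₁ e))) l

      far-in-M : ∀ θ l → ∃ (Far θ l) → Σ[ p ∈ Point ] Far θ l (proj₁ p)
      far-in-M θ l (e , f) =
        let e′ , e′∈M , h = elementary⇒TarskiVaught elementary (DN.formula (far-def θ l)) (tuple λ (m , _) → m) proj₂
                              (e , to (DN.defines (far-def θ l) e) f)
        in (e′ , e′∈M) , from (DN.defines (far-def θ l) e′) h

      -- An antichain with points in M that cannot be prolonged inside M cannot be prolonged at all:
      -- a far point of `N` would be matched by one in M, by the Tarski-Vaught property.
      net-in-M : ∀ {θ} → Thick θ → ∃[ l ] (∀ x → Σ[ m ∈ Point ] m ∈ l × ⟦ θ ⟧ (x ⁻¹ ∙ proj₁ m))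
      net-in-M {θ} t = extend (Thick.bound t) [] [] (ℕₚ.≤-reflexive (sym (ℕₚ.+-identityʳ (Thick.bound t))))
        where
        Spread : List Point → Set ℓ
        Spread = AllPairs λ x y → ¬ ⟦ θ ⟧ (proj₁ x ⁻¹ ∙ proj₁ y)
        extend : ∀ n l → Spread l → Thick.bound t ≤ n + length l →
            ∃[ l ] (∀ x → Σ[ m ∈ Point ] m ∈ l × ⟦ θ ⟧ (x ⁻¹ ∙ proj₁ m))
        extend zero l a le = ⊥-elim (ℕₚ.<⇒≱ (Thick.short t (map proj₁ l) (AllPairsₚ.map⁺ a))
          (subst (Thick.bound t ≤_) (sym (Listₚ.length-map proj₁ l)) le))
        extend (suc n) l a le with dec (∃ (Far θ l))
        ... | yes f = let p , ps = far-in-M θ l f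
                      in extend n (p ∷ l) (ps ∷ a) (subst (Thick.bound t ≤_) (sym (ℕₚ.+-suc n (length l))) le)
        ... | no n′ = l , λ x → dne λ k → n′ (x , All.tabulate λ {m} i p → k (m , i , p))

    -- Let m be a point of M from the net with x⁻¹m in θ. The type over M transfers this to y⁻¹m, so
    -- the quotient of x and y lies in θ² for every thick θ.
    same-type⇒core² : ∀ {x y} → SameTypeOver N M (Single x) (Single y) → pow Core 2 (x ⁻¹ ∙ y)
    same-type⇒core² {x} {y} s = pow-core 2 {x ⁻¹ ∙ y} λ θ t → close θ t (proj₂ (net-in-M t) x)
      where
      close : ∀ θ (t : Thick θ) → (Σ[ m ∈ Point ] m ∈ proj₁ (net-in-M t) × ⟦ θ ⟧ (x ⁻¹ ∙ proj₁ m)) →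
          pow ⟦ θ ⟧ 2 (x ⁻¹ ∙ y)
      close θ t ((m , m∈M) , _ , p) = pow-quotient (λ {g} {h} → code-resp θ {g} {h}) {x} {m} {y} p
          (code-resp θ {(y ⁻¹ ∙ m) ⁻¹} {m ⁻¹ ∙ y} (quotient-⁻¹ y m) (Thick.symmetric t {y ⁻¹ ∙ m} q))
        where
        φ : FormulaOver N M (single _)
        φ = quotientFormula θ (inj₁ _) (inj₂ ((_ , m) , m∈M))
        q : ⟦ θ ⟧ (y ⁻¹ ∙ m)
        q = from (quotientFormula⇔ θ _ _ (Single y ⋈ enum N M))
            (to (s φ) (to (quotientFormula⇔ θ _ _ (Single x ⋈ enum N M)) p))

  -- Skolem terms over ε. As syntax they are counted by `small-Hull` without reference to the size
  -- of `N`; there is always at least one argument, so that `clamp` has a target.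
  data Hull : Set ℓ where
    base   : Hull
    skolem : (n : ℕ) → Formula torsorSig (vars (Lift ℓ ℕ) (λ _ → _) ▷ _) → (Fin (suc n) → Hull) → Hull

  witness : {n : ℕ} → Formula torsorSig (vars (Lift ℓ ℕ) (λ _ → _) ▷ _) → (Fin (suc n) → Elt) → Elt
  witness {n} φ x with dec (∃[ e ] N ⊨ φ [ tuple (λ (lift i) → x (clamp n i)) ⋈₁ e ])
  ... | yes (e , _) = e
  ... | no _        = ε

  witness-holds : ∀ {n} φ (x : Fin (suc n) → Elt) → (∃[ e ] N ⊨ φ [ tuple (λ (lift i) → x (clamp n i)) ⋈₁ e ]) →
                  N ⊨ φ [ tuple (λ (lift i) → x (clamp n i)) ⋈₁ witness φ x ]
  witness-holds {n} φ x k with dec (∃[ e ] N ⊨ φ [ tuple (λ (lift i) → x (clamp n i)) ⋈₁ e ])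
  ... | yes (_ , h) = h
  ... | no n′       = ⊥-elim (n′ k)

  value : Hull → Elt
  value base            = ε
  value (skolem n φ hs) = witness φ (λ i → value (hs i))

  small-Hull : Small Hull
  small-Hull = small-↣ (mk↣ {to = code-of} λ {x} {y} → code-inj x y)
      (small-⊎ small-ℕ (small-torsorFormula {V = vars (Lift ℓ ℕ) (λ _ → _) ▷ _}
          (small-↣ maybe↣ (small-⊎ small-ℕ small-One))))
    where
    maybe↣ : Maybe (Lift ℓ ℕ) ↣ (Lift ℓ ℕ ⊎ One)
    maybe↣ = mk↣ {to = λ { (just n) → inj₁ n ; nothing → inj₂ _ }}
      λ { {just _} {just _} refl → refl ; {nothing} {nothing} _ →
          refl ; {just _} {nothing} () ; {nothing} {just _} () }
    X : Set ℓ
    X = Lift ℓ ℕ ⊎ Formula torsorSig (vars (Lift ℓ ℕ) (λ _ → _) ▷ _)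
    number : ℕ ↣ X
    number = mk↣ {to = inj₁ ∘ lift} λ { refl → refl }
    open Pairing {X = X} number
    ⟨_⟩ : List X → X
    ⟨ l ⟩ = Injection.to listCode l
    code-of : Hull → X
    code-of base            = ⟨ [] ⟩
    code-of (skolem n φ hs) = ⟨ inj₁ (lift n) ∷ inj₂ φ ∷ tabulate (λ i → code-of (hs i)) ⟩
    code-inj : ∀ x y → code-of x ≡ code-of y → x ≡ y
    code-inj base base e = refl
    code-inj base (skolem n φ hs) e with Injection.injective listCode e
    ... | ()
    code-inj (skolem n φ hs) base e with Injection.injective listCode e
    ... | ()
    code-inj (skolem n φ hs) (skolem m ψ ks) e =
      same-node (∷-injectiveˡ lists) (∷-injectiveˡ (∷-injectiveʳ lists)) (∷-injectiveʳ (∷-injectiveʳ lists))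
      where
      lists = Injection.injective listCode e
      same-node : ∀ {m ψ} {ks : Fin (suc m) → Hull} → _≡_ {A = X} (inj₁ (lift n)) (inj₁ (lift m)) →
          _≡_ {A = X} (inj₂ φ) (inj₂ ψ) →
                  tabulate (λ i → code-of (hs i)) ≡ tabulate (λ i → code-of (ks i)) → skolem n φ hs ≡ skolem m ψ ks
      same-node {ks = ks} refl refl q = cong (skolem n φ) (extensionality λ i →
          code-inj (hs i) (ks i) (tabulate-injective {f = λ i → code-of (hs i)} {g = λ i → code-of (ks i)} q i))

  hull-TarskiVaught : ∀ {V} (φ : Formula torsorSig (V ▷ _)) (h : Var V → Hull) →
                      (∃[ e ] N ⊨ φ [ tuple (value ∘ h) ⋈₁ e ]) → ∃[ c ] N ⊨ φ [ tuple (value ∘ h) ⋈₁ value c ]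
  hull-TarskiVaught {V} φ h (e , k) = skolem n φ₁ hs , from (reduce (value (skolem n φ₁ hs)))
      (witness-holds φ₁ (value ∘ hs) (e , to (reduce e) k))
    where
    n = proj₁ (support-fin φ)
    vs : Fin n → Maybe (Var V)
    vs = proj₁ (proj₂ (support-fin φ))
    φ₀ = proj₁ (proj₂ (proj₂ (support-fin φ)))
    place : ℕ → Maybe (Var V) → Maybe (Lift ℓ ℕ)
    place i (just _) = just (lift i)
    place i nothing  = nothing
    ρ : Ren (fin (n , λ i → sortOf (V ▷ _) (vs i))) (vars (Lift ℓ ℕ) (λ _ → _) ▷ _)
    ρ = ren (λ (lift i) → place (suc (toℕ i)) (vs i)) (λ _ → refl)
    φ₁ = rename ρ φ₀
    hull-of : Maybe (Var V) → Hull
    hull-of (just v) = h v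
    hull-of nothing  = base
    hs : Fin (suc n) → Hull
    hs zero    = base
    hs (suc i) = hull-of (vs i)
    placed : ∀ e u i → hs i ≡ hull-of u →
             at (tuple {C = carrier N} {V = V} (value ∘ h) ⋈₁ e) u ≡
             at (tuple {C = carrier N} {V = vars (Lift ℓ ℕ) (λ _ → _)} (λ (lift j) → value (hs (clamp n j))) ⋈₁ e)
                 (place (toℕ i) u)
    placed e (just v) i p = cong value (trans (sym p) (cong hs (sym (clamp-toℕ i))))
    placed e nothing  i p = refl
    reduce : ∀ e → N ⊨ φ [ tuple (value ∘ h) ⋈₁ e ] ⇔ N ⊨ φ₁ [ tuple (λ (lift j) → value (hs (clamp n j))) ⋈₁ e ]
    reduce e = proj₂ (proj₂ (proj₂ (support-fin φ))) N _ ⇔∘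
      ⊨-resp⇔ N φ₀ (λ (lift i) → Setoid.reflexive (carrier N _)
          (trans (placed e (vs i) (suc i) refl) (sym (subst-const _ _))))
      ⇔∘ ⇔-sym (⊨-rename N ρ φ₀ _)
      where
      subst-const : ∀ {s t : One} (p : s ≡ t) (g : Elt) → subst ∥ N ∥ p g ≡ g
      subst-const refl g = refl

  module HullImage (τ : Automorphism N) where
    private
      t t⁻¹ : Elt → Elt
      t = Inverse.to (Automorphism.bijection τ _)
      t⁻¹ = Inverse.from (Automorphism.bijection τ _)

    Image : Subset N
    Image (_ , e) = ∃[ c ] e ≡ t (value c)

    small-Image : ∣ N ∋ Image ∣ <ᶜ κ
    small-Image = ≤<-trans {X = ∣ N ∋ Image ∣} {setoid Hull} {κ}
      (surjection⇒≤ ∣ N ∋ Image ∣ (λ c → (_ , t (value c)) , c , refl) λ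
          { ((_ , _) , c , refl) → c , same (≋-refl ℭ) }) small-Hull

    image-TarskiVaught : TarskiVaught Image
    image-TarskiVaught {V} φ x x∈ (e , h) = t (value (proj₁ w′)) , (proj₁ w′ , refl) ,
        to (move (value (proj₁ w′))) (proj₂ w′)
      where
      c : Var V → Hull
      c v = proj₁ (x∈ v)
      move : ∀ e → N ⊨ φ [ tuple (value ∘ c) ⋈₁ e ] ⇔ N ⊨ φ [ x ⋈₁ t e ]
      move e = ⊨-apply τ φ (tuple (value ∘ c) ⋈₁ e) ⇔∘
        ⊨-resp⇔ N φ λ { (just v) → Setoid.reflexive (carrier N _) (sym (proj₂ (x∈ v))) ; nothing → ≋-refl ℭ }
      w′ : ∃[ d ] N ⊨ φ [ tuple (value ∘ c) ⋈₁ value d ]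
      w′ = hull-TarskiVaught φ c (t⁻¹ e , from (move (t⁻¹ e))
        (⊨-resp N φ (λ { (just v) → ≋-refl ℭ ; nothing → ≋-sym ℭ
            (Inverse.strictlyInverseˡ (Automorphism.bijection τ _) e) }) h))

    image-elementary : IsElementarySubstructure N Image
    image-elementary = TarskiVaught⇒elementary (λ ()) image-TarskiVaught

  Original : Subset N
  Original (_ , e) = ∃[ c ] e ≡ value c

  private
    small-original : Small (Formula torsorSig (single _ ⊕ params N Original))
    small-original = small-torsorFormula {V = single _ ⊕ params N Original}
        (small-⊎ small-One (small-↣ (mk↣ {to = λ (_ , c , _) → c} inj) small-Hull))
      where
      inj : ∀ {x y : ∃ Original} → proj₁ (proj₂ x) ≡ proj₁ (proj₂ y) → x ≡ y
      inj {_ , c , refl} {_ , .c , refl} refl = refl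

    typeOf : Elt → FormulaOver N Original (single _) → Bool
    typeOf x φ = truth (Holds N Original φ (Single x))

    OneStep : Elt → Elt → Set (Level.suc ℓ)
    OneStep x y = ∃[ M ] ∣ N ∋ M ∣ <ᶜ κ × IsElementarySubstructure N M × SameTypeOver N M (Single x) (Single y)

    -- An automorphism of the torsor sends a to x and b to xg, since it can carry the quotient a⁻¹b
    -- to g. Equality of types over the hull then becomes equality of types over the image of the
    -- hull.
    transport : ∀ {g x} → (a b : Elt) → typeOf a ≡ typeOf b → Similar g (a ⁻¹ ∙ b) → OneStep x (x ∙ g)
    transport {g} {x} a b e s = HullImage.Image τ , HullImage.small-Image τ , HullImage.image-elementary τ , same-type
      where
      conj : Σ[ σ ∈ Automorphism ℭ ] Automorphism.apply σ w ≋ w × Automorphism.apply σ (proj₁ (a ⁻¹ ∙ b)) ≋ proj₁ g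
      conj = similar⇒conjugate {a ⁻¹ ∙ b} {g} (similar-sym {g} {a ⁻¹ ∙ b} s)
      open Translation (proj₁ conj) (proj₁ (proj₂ conj)) a x using (translation; τ-base; τ-value)
      τ : Automorphism N
      τ = translation
      t : Elt → Elt
      t = Inverse.to (Automorphism.bijection τ _)
      τb : t b ≈ x ∙ g
      τb = τ-value {b} {x ∙ g} (≋-trans ℭ (proj₂ (proj₂ conj)) (≋-sym ℭ (Gp.\\-leftDividesʳ x g)))
      M = HullImage.Image τ
      ρ : Ren {S = One} (single _ ⊕ params N M) (single _ ⊕ params N Original)
      ρ = ren (λ { (inj₁ v) → inj₁ v ; (inj₂ (_ , c , _)) → inj₂ ((_ , value c) , c , refl) })
          (λ { (inj₁ v) → refl ; (inj₂ v) → refl })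
      move : ∀ (φ : FormulaOver N M (single _)) u y → t u ≈ y → Holds N Original (rename ρ φ) (Single u) ⇔
          Holds N M φ (Single y)
      move φ u y q = ⊨-rename N ρ φ (Single u ⋈ enum N Original) ⇔∘ ⊨-apply τ φ _ ⇔∘
        ⊨-resp⇔ N φ λ { (inj₁ _) → q ; (inj₂ (_ , c , r)) → Setoid.reflexive (carrier N _) (sym r) }
      same-type : SameTypeOver N M (Single x) (Single (x ∙ g))
      same-type φ = ⇔-sym (move φ a x τ-base) ⇔∘
        mk⇔ (λ h → holds (trans (cong (λ t → t (rename ρ φ)) (sym e)) (isTrue h)))
            (λ h → holds (trans (cong (λ t → t (rename ρ φ)) e) (isTrue h))) ⇔∘ move φ b (x ∙ g) τb

  -- `I` is the power set of the set of all candidate types over the hull, so two members of the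
  -- spread family have the same type; whichever direction of their quotient is similar to `g` is
  -- transported.
  core⇒same-type : ∀ {g} x → Core g → OneStep x (x ∙ g)
  core⇒same-type {g} x c = step (proj₂ spread-g i j i≢j)
    where
    I : Set ℓ
    I = (FormulaOver N Original (single _) → Bool) → Bool
    spread-g = spread {g} c I (small-2^ (small-2^ small-original))
    a : I → Elt
    a = proj₁ spread-g
    collision : ∃[ i ] ∃[ j ] ¬ i ≡ j × typeOf (a i) ≡ typeOf (a j)
    collision = dne λ n → cantor (mk↣ {to = typeOf ∘ a} λ {i} {j} e → dne λ m → n (i , j , m , e))
    i = proj₁ collision
    j = proj₁ (proj₂ collision)
    i≢j = proj₁ (proj₂ (proj₂ collision))
    eq = proj₂ (proj₂ (proj₂ collision))
    step : Similar g (a i ⁻¹ ∙ a j) ⊎ Similar g (a j ⁻¹ ∙ a i) → OneStep x (x ∙ g)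
    step (inj₁ s) = transport {g} {x} (a i) (a j) eq s
    step (inj₂ s) = transport {g} {x} (a j) (a i) (sym eq) s

  private
    _~[_]_ : Elt → ℕ → Elt → Set (Level.suc ℓ)
    x ~[ n ] y = LascarDistance≤ κ N n (Single x) (Single y)

    same-type-resp : ∀ {M x x′ y y′} → x ≈ x′ → y ≈ y′ → SameTypeOver N M (Single x) (Single y) →
        SameTypeOver N M (Single x′) (Single y′)
    same-type-resp {M} {x} {x′} {y} {y′} p q s φ = ⇔-sym (over-resp {x} {x′} p) ⇔∘ s φ ⇔∘ over-resp {y} {y′} q
      where
      over-resp : ∀ {u v} → u ≈ v → Holds N M φ (Single u) ⇔ Holds N M φ (Single v)
      over-resp e = ⊨-resp⇔ N φ λ { (inj₁ _) → e ; (inj₂ _) → ≋-refl ℭ }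

    snoc : ∀ n {x y z} → x ~[ n ] y → OneStep y z → x ~[ suc n ] z
    snoc zero {x} {y} {z} (lift e) (M , sm , el , s) =
      M , Single z , sm , el , same-type-resp {M} {y} {x} {z} {z} (λ v → ≋-sym ℭ (e _) v) (≋-refl ℭ) s ,
          lift (λ _ → ≋-refl ℭ)
    snoc (suc n) {x} {y} {z} (M , a , sm , el , s , r) st = M , a , sm , el , s , snoc n {at a _} {y} {z} r st

    pow⇒distance : ∀ n {g} → pow Core n g → ε ~[ n ] g
    pow⇒distance zero    {g} e           = lift λ _ → ≋-sym ℭ e
    pow⇒distance (suc n) {g} (h , p , q) = snoc n {ε} {h} {g} (pow⇒distance n p) step
      where
      step : OneStep h g
      step = let M , sm , el , s = core⇒same-type h q
             in M , sm , el , same-type-resp {M} {h} {h} {h ∙ (h ⁻¹ ∙ g)} {g} (≋-refl ℭ) (Gp.\\-leftDividesˡ h g) s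

    -- Each step over a model costs two factors from the core, by `same-type⇒core²`.
    distance⇒pow : ∀ n {x y} → x ~[ n ] y → pow Core (n * 2) (x ⁻¹ ∙ y)
    distance⇒pow zero {x} {y} (lift e) = ≋-trans ℭ (quotient-≈ {x} {x} {y} {x} (≋-refl ℭ) (≋-sym ℭ (e _)))
        (Gr.inverseˡ x)
    distance⇒pow (suc n) {x} {y} (M , a , _ , el , s , r) = subst (λ k → pow Core k (x ⁻¹ ∙ y)) (ℕₚ.+-comm (n * 2) 2)
      (pow-resp (λ {x} {y} → core-resp {x} {y}) (n * 2 + 2) {(x ⁻¹ ∙ z) ∙ (z ⁻¹ ∙ y)} {x ⁻¹ ∙ y} eq
        (pow-+ (λ {x} {y} → core-resp {x} {y}) 2 (n * 2) {x ⁻¹ ∙ z} {z ⁻¹ ∙ y} (same-type⇒core² el {x} {z} s)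
            (distance⇒pow n {z} {y} r)))
      where
      z = at a _
      eq : (x ⁻¹ ∙ z) ∙ (z ⁻¹ ∙ y) ≈ x ⁻¹ ∙ y
      eq = ≋-trans ℭ (Gr.assoc (x ⁻¹) z (z ⁻¹ ∙ y)) (Gr.∙-congˡ {x ⁻¹} {z ∙ (z ⁻¹ ∙ y)} {y} (Gp.\\-leftDividesˡ z y))

  component-bounded : GCompact (Th N) → ∃[ n ] (∀ {g} → Component g → pow Core n g)
  component-bounded gc = n * 2 , λ {g} (m , p) → pow-resp (λ {x} {y} → core-resp {x} {y}) (n * 2) {ε ⁻¹ ∙ g} {g}
      (eq g)
      (distance⇒pow n {ε} {g} (bound (Single g) (m , pow⇒distance m p)))
    where
    compact : ∃[ n ] (∀ b → (∃[ m ] LascarDistance≤ κ N m (Single ε) b) → LascarDistance≤ κ N n (Single ε) b)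
    compact = gc κ N torsor-monster (single _) small-One (Single ε)
    n = proj₁ compact
    bound = proj₂ compact
    eq : ∀ g → ε ⁻¹ ∙ g ≈ g
    eq g = ≋-trans ℭ (Gr.∙-congʳ {g} {ε ⁻¹} {ε} Gp.ε⁻¹≈ε) (Gr.identityˡ g)

-- NIP

module Pigeonhole (cl : Classical) {a b r} {X : Set a} {C : Set b} (InClass : C → X → Set r) where
  open Choice cl

  pigeonhole : ∀ {q s} {Rel : X → X → Set q} {Prop : X → Set s} (n : ℕ) (cs : List C) (l : List X) →
               AllPairs Rel l → All Prop l → All (λ x → ∃[ c ] c ∈ cs × InClass c x) l → length cs * n < length l →
               ∃[ c ] ∃[ k ] AllPairs Rel k × All Prop k × All (InClass c) k × n ≤ length k
  pigeonhole n []       (x ∷ l) _ _ ((_ , () , _) ∷ _) _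
  pigeonhole n (c ∷ cs) l rs ps classes le with n ℕₚ.≤? length (filter (λ x → dec (InClass c x)) l)
  ... | yes n≤ = c , filter in? l , AllPairsₚ.filter⁺ in? rs , Allₚ.filter⁺ in? ps , Allₚ.all-filter in? l , n≤
    where in? = λ x → dec (InClass c x)
  ... | no n≰  = pigeonhole n cs (filter out? l) (AllPairsₚ.filter⁺ out? rs) (Allₚ.filter⁺ out? ps)
      (All.zipWith remaining (Allₚ.filter⁺ out? classes , Allₚ.all-filter out? l))
      (ℕₚ.+-cancelˡ-< (length (filter in? l)) _ _ (ℕₚ.<-≤-trans
        (ℕₚ.≤-<-trans (ℕₚ.+-monoˡ-≤ (length cs * n) (ℕₚ.<⇒≤ (ℕₚ.≰⇒> n≰))) le)
        (ℕₚ.≤-reflexive (sym (length-filters in? l)))))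
    where
    in? = λ x → dec (InClass c x)
    out? = λ x → ¬? (in? x)
    remaining : ∀ {x} → (∃[ d ] d ∈ c ∷ cs × InClass d x) × ¬ InClass c x → ∃[ d ] d ∈ cs × InClass d x
    remaining ((d , here refl , i) , n) = ⊥-elim (n i)
    remaining ((d , there p , i) , n)   = d , p , i

module SubProducts {ℓ} (G : Group ℓ ℓ) where
  open Group G renaming (refl to ≈-refl; sym to ≈-sym; trans to ≈-trans)
  open GroupProperties G
  open Powers G

  select : Bool → Carrier → Carrier
  select b x = if b then x else ε

  module _ {A : Set ℓ} (elt : A → Carrier) where

    subproduct : (l : List A) → (Fin (length l) → Bool) → Carrier
    subproduct []      I = ε
    subproduct (x ∷ l) I = select (I zero) (elt x) ∙ subproduct l (I ∘ suc)

    module _ {D : Pred Carrier ℓ} (D-resp : ∀ {x y} → x ≈ y → D x → D y) (D-ε : D ε)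
             (f : Carrier → Carrier) (f-ε : f ε ≈ ε) (f-∙ : ∀ x y → f (x ∙ y) ≈ f x ∙ f y) where

      private
        select-pow : ∀ b {x} → D (f x) → D (f (select b x))
        select-pow true  d = d
        select-pow false d = D-resp (≈-sym f-ε) D-ε

        cons : ∀ n {x y} → D x → pow D n y → pow D (suc n) (x ∙ y)
        cons n {x} {y} d p = subst (λ k → pow D k (x ∙ y)) (ℕₚ.+-comm n 1) (pow-+ D-resp 1 n (pow-1 D-resp d) p)

      subproduct-pow : ∀ l I → All (λ x → D (f (elt x))) l → pow D (length l) (f (subproduct l I))
      subproduct-pow []      I []       = f-ε
      subproduct-pow (x ∷ l) I (d ∷ ds) = pow-resp D-resp (suc (length l)) (≈-sym (f-∙ _ _))
        (cons (length l) (select-pow (I zero) d) (subproduct-pow l (I ∘ suc) ds))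

      -- Isolates the one factor `f c` that need not be near the identity; u and v collect the
      -- factors before and after it.
      Factored : ℕ → Carrier → Carrier → Set ℓ
      Factored n x c = ∃[ u ] ∃[ v ] pow D n u × pow D n v × x ≈ (u ∙ f c) ∙ v

      AllBut : (l : List A) → Fin (length l) → Set ℓ
      AllBut (x ∷ l) zero    = All (λ y → D (f (elt y))) l
      AllBut (x ∷ l) (suc j) = D (f (elt x)) × AllBut l j

      subproduct-without : ∀ l I j → AllBut l j → I j ≡ false → pow D (length l) (f (subproduct l I))
      subproduct-without (x ∷ l) I zero ds e with I zero | e
      ... | false | refl = pow-resp D-resp (suc (length l)) (≈-sym (≈-trans (f-∙ _ _) (∙-congʳ f-ε)))
                             (cons (length l) D-ε (subproduct-pow l (I ∘ suc) ds))
      subproduct-without (x ∷ l) I (suc j) (d , ds) e = pow-resp D-resp (suc (length l)) (≈-sym (f-∙ _ _))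
        (cons (length l) (select-pow (I zero) d) (subproduct-without l (I ∘ suc) j ds e))

      subproduct-with : ∀ l I j → AllBut l j → I j ≡ true → Factored (length l) (f (subproduct l I))
          (elt (lookup l j))
      subproduct-with (x ∷ l) I zero ds e with I zero | e
      ... | true | refl = ε , f (subproduct l (I ∘ suc)) , pow-≤ D-resp D-ε {m = 0} {n = suc (length l)} z≤n ≈-refl ,
                          pow-≤ D-resp D-ε {m = length l} {n = suc (length l)} (ℕₚ.n≤1+n _)
                              (subproduct-pow l (I ∘ suc) ds) ,
                          ≈-trans (f-∙ _ _) (∙-congʳ (≈-sym (identityˡ _)))
      subproduct-with (x ∷ l) I (suc j) (d , ds) e =
        let u , v , p , q , eq = subproduct-with l (I ∘ suc) j ds e
        in f (select (I zero) (elt x)) ∙ u , v , cons (length l) (select-pow (I zero) d) p ,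
            pow-≤ D-resp D-ε {m = length l} {n = suc (length l)} (ℕₚ.n≤1+n _) q ,
           ≈-trans (f-∙ _ _) (≈-trans (∙-congˡ eq) (≈-trans (≈-sym (assoc _ _ _)) (∙-congʳ (≈-sym (assoc _ _ _)))))

  module _ {D : Pred Carrier ℓ} (D-resp : ∀ {x y} → x ≈ y → D x → D y) (D-⁻¹ : ∀ {x} → D x → D (x ⁻¹)) where

    -- c = u⁻¹xv⁻¹, three factors from Dᵐ.
    middle-factor : ∀ m {x u c v} → x ≈ (u ∙ c) ∙ v → pow D m u → pow D m v → pow D m x → pow D (m + (m + m)) c
    middle-factor m {x} {u} {c} {v} e p q r = pow-resp D-resp (m + (m + m)) eq
      (pow-+ D-resp (m + m) m (pow-+ D-resp m m (pow-⁻¹ D-resp D-⁻¹ m p) r) (pow-⁻¹ D-resp D-⁻¹ m q))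
      where
      eq : (u ⁻¹ ∙ x) ∙ v ⁻¹ ≈ c
      eq = ≈-trans (∙-congʳ (≈-trans (∙-congˡ (≈-trans e (assoc u c v))) (\\-leftDividesʳ u (c ∙ v))))
          (//-rightDividesʳ v c)

    -- y = x(y⁻¹x)⁻¹.
    left-factor : ∀ m n {x y} → pow D m x → pow D n (y ⁻¹ ∙ x) → pow D (n + m) y
    left-factor m n {x} {y} p q = pow-resp D-resp (n + m) eq (pow-+ D-resp m n p (pow-⁻¹ D-resp D-⁻¹ n q))
      where
      eq : x ∙ (y ⁻¹ ∙ x) ⁻¹ ≈ y
      eq = ≈-trans (∙-congˡ (quotient-⁻¹ y x)) (\\-leftDividesˡ x y)

module NipComponents (cl : Classical) {ℓ} {L : Signature ℓ} {T : Theory L} {κ : Cardinal ℓ}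
                     {ℭ : Structure L} (monster : IsMonster T κ ℭ) (G : GroupIn ℭ)
                     (base : GroupOver.Parameters cl monster G)
                     {W′ : Vars (Sort L)} (w′ : Tuple ℭ W′) (small-W′ : Compactness.Small cl monster (Var W′)) where
  open Choice cl
  open Supports cl
  open Definability cl ℭ
  open Compactness cl monster
  open GroupIn G
  open GroupOver cl monster G
  open Parameters base using () renaming (W to W₀; w to w₀)

  -- The parameters of both sets together. The base block `w₀` stays separate because the
  -- automorphisms considered fix only it and move `w′`.
  extended : Parameters
  extended = record
    { w       = w₀ ⋈ w′
    ; small-W = small-⊎ (Parameters.small-W base) small-W′
    ; member  = def-subst (Parameters.member base)
        (ren (λ { (inj₁ v) → inj₁ v ; (inj₂ v) → inj₂ (inj₁ v) }) (λ { (inj₁ v) → refl ; (inj₂ v) → refl }))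
        id λ { x (inj₁ v) → Setoid.refl (carrier ℭ _) ; x (inj₂ v) → Setoid.refl (carrier ℭ _) }
    ; product = DefinableSets.renameVia cl monster G base (Parameters.product base) id
        (ren (λ { (inj₁ v) → inj₁ v ; (inj₂ v) → inj₂ (inj₁ v) }) (λ { (inj₁ v) → refl ; (inj₂ v) → refl }))
        λ { x (inj₁ v) → Setoid.refl (carrier ℭ _) ; x (inj₂ v) → Setoid.refl (carrier ℭ _) }
    }

  open Parameters extended
  open DefinableSets cl monster G extended
  open ThickSets cl monster G extended
  open Index cl monster G extended
  open Powers group
  open SubProducts group
  module Base = ThickSets cl monster G base
  module BaseIndex = Index cl monster G base

  Aut₀ : Set ℓ
  Aut₀ = Σ[ σ ∈ Automorphism ℭ ] Automorphism.apply σ w₀ ≋ w₀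

  open module Act (σ : Aut₀) = DefinableSets.Action cl monster G base (proj₁ σ) (proj₂ σ)
    using (act; act-cong; act-∙; act-ε; act-⁻¹; act-quotient)

  id₀ : Aut₀
  id₀ = idAut , ≋-refl ℭ

  θ-resp : ∀ θ {x y} → x ≈ y → ⟦ θ ⟧ x → ⟦ θ ⟧ y
  θ-resp θ {x} {y} = code-resp θ {x} {y}

  module Bounded (m : ℕ) (bounded : ∀ {g} → Component g → pow Core m g)
                 (nip : ∀ p q φ → ¬ IndependenceProperty ℭ p q φ) where

    component⊆ : ∀ {θ} → Thick θ → ∀ {g} → Component g → pow ⟦ θ ⟧ m g
    component⊆ {θ} t c = pow-mono m (λ k → k θ t) (bounded c)

    -- Over all thick χ the sets χⁿ intersect in the n-th power of the core, which lies in the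
    -- component and so in θᵐ by `bounded`; compactness makes a single χ suffice.
    shrink : ∀ {θ} → Thick θ → ∀ n → ∃[ χ ] Thick χ × (∀ g → pow ⟦ χ ⟧ n g → pow ⟦ θ ⟧ m g)
    shrink {θ} t n = dne λ none → contradiction none
      where
      k : Lift ℓ ⊥ → Elt
      k ()
      R : ThickCode → Pred (One ⊎ Lift ℓ ⊥ → Elt) ℓ
      R (χ , _) z = pow ⟦ χ ⟧ n (z (inj₁ _)) × ¬ pow ⟦ θ ⟧ m (z (inj₁ _))
      contradiction : ¬ ¬ (∃[ χ ] Thick χ × (∀ g → pow ⟦ χ ⟧ n g → pow ⟦ θ ⟧ m g))
      contradiction none = outside (proj₂ realized)
        where
        escape : ∀ χ → Thick χ → ∃[ g ] pow ⟦ χ ⟧ n g × ¬ pow ⟦ θ ⟧ m g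
        escape χ u = dne λ no-g → none (χ , u , λ g p → dne λ q → no-g (g , p , q))
        sat : ∀ χs → ∃[ x ] All (λ χ → R χ [ x , k ]′) χs
        sat χs = let ψ , u , a = meet χs
                     g , p , q = escape ψ u
                 in (λ _ → g) , All.map (λ i → pow-mono n (λ {y} → i y) p , q) a
        abstract
          realized : ∃[ x ] (∀ χ → R χ [ x , k ]′)
          realized = compactE small-One small-⊥ k {R = R}
            (λ (χ , _) → def-× (E-unary (pow-def (code χ) n) (inj₁ _))
                (def-¬ (E-unary (pow-def (code θ) m) (inj₁ _)))) sat
        outside : ¬ (∀ χ → R χ [ proj₁ realized , k ]′)
        outside h = let χ , u = thick-⊤ in proj₂ (h (χ , u))
          (component⊆ t (n , pow-core n λ χ u → proj₁ (h (χ , u))))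

    Item : Set ℓ
    Item = Aut₀ × Elt

    module Independence {θ : Code} (thick-θ : Thick θ)
             (escape : ∀ (l : List Aut₀) → Σ[ (σ , g) ∈ Item ] All (λ τ → Component (act τ g)) l ×
                       ¬ pow ⟦ θ ⟧ m (act σ g)) where

      -- Sequences are built by consing, so the newest item is the head: its element lies in the
      -- conjugates of the items further down the list.
      Later : Item → Item → Set ℓ
      Later (_ , g) (τ , _) = Component (act τ g)

      Escapes : Item → Set ℓ
      Escapes (σ , g) = ¬ pow ⟦ θ ⟧ m (act σ g)

      sequence : ∀ n → ∃[ l ] AllPairs Later l × All Escapes l × length l ≡ n
      sequence zero    = [] , [] , [] , refl
      sequence (suc n) =
        let l , ps , es , e = sequence n
            x , qs , f = escape (map proj₁ l)
        in x ∷ l , Allₚ.map⁻ qs ∷ ps , f ∷ es , cong suc e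

      -- The exponent is what `pairUp` and `pattern-of` consume: m + (m + m) to isolate one factor
      -- of a product by `middle-factor`, and another m to pass from a quotient to its divisor by
      -- `left-factor`.
      θ₂ : Code
      θ₂ = proj₁ (shrink thick-θ (m + (m + m) + m))

      thick-θ₂ : Thick θ₂
      thick-θ₂ = proj₁ (proj₂ (shrink thick-θ (m + (m + m) + m)))

      θ₂⊆θ : ∀ g → pow ⟦ θ₂ ⟧ (m + (m + m) + m) g → pow ⟦ θ ⟧ m g
      θ₂⊆θ = proj₂ (proj₂ (shrink thick-θ (m + (m + m) + m)))

      module Thinning {χ : Code} (thick-χ : Thick χ) where

        Close : Aut₀ → Item → Item → Set ℓ
        Close σ (_ , g) (_ , h) = pow ⟦ χ ⟧ 2 (act σ (g ⁻¹ ∙ h))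

        -- `Later` controls older automorphisms on newer elements. The closeness condition supplies
        -- some control in the opposite direction, where nothing is known at the outset: the newer
        -- automorphism sends all older elements into one cell.
        data Thin : List Item → Set ℓ where
          []  : Thin []
          add : ∀ {x l} → All (Later x) l → Escapes x → (∀ {y z} → y ∈ l → z ∈ l → Close (proj₁ x) y z) → Thin l →
              Thin (x ∷ l)

        centres : List Elt
        centres = proj₁ (net thick-χ)

        -- One entry for the head, and one more than `length centres * required n` to make some cell
        -- hold `required n` of the remaining entries.
        required : ℕ → ℕ
        required zero    = 0
        required (suc n) = suc (suc (length centres * required n))

        thin : ∀ n l → AllPairs Later l → All Escapes l → required n ≤ length l → ∃[ k ] Thin k × length k ≡ n ×
               (∀ {x} → x ∈ k → x ∈ l)
        thin zero    l       ps       es       le = [] , [] , refl , λ ()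
        thin (suc n) ((σ , g) ∷ l) (p ∷ ps) (e ∷ es) (s≤s le) = finish
            (pigeonhole {Prop = λ x → Escapes x × x ∈ l} (required n) centres l ps
                (All.tabulate λ i → All.lookup es i , i)
              (All.tabulate λ {x} _ → proj₂ (net thick-χ) (act σ (proj₂ x))) le)
          where
          InCell : Elt → Item → Set ℓ
          InCell c (_ , h) = ⟦ χ ⟧ (c ⁻¹ ∙ act σ h)
          open Pigeonhole cl InCell
          finish : (∃[ c ] ∃[ k ] AllPairs Later k × All (λ x → Escapes x × x ∈ l) k × All (InCell c) k ×
              required n ≤ length k) →
                   ∃[ k ] Thin k × length k ≡ suc n × (∀ {x} → x ∈ k → x ∈ (σ , g) ∷ l)
          finish (c , k , rs , qs , is , le′) =
            let k′ , t , eq , sub = thin n k rs (All.map proj₁ qs) le′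
            in (σ , g) ∷ k′ ,
               add (All.tabulate λ i → All.lookup p (proj₂ (All.lookup qs (sub i)))) e
                   (λ {y} {z} i j → close y z (All.lookup is (sub i)) (All.lookup is (sub j))) t ,
               cong suc eq ,
               λ { (here q) → here q ; (there i) → there (proj₂ (All.lookup qs (sub i))) }
            where
            close : ∀ y z → InCell c y → InCell c z → Close σ y z
            close (_ , h) (_ , h′) q q′ = pow-resp (λ {x} {y} → θ-resp χ {x} {y}) 2 {act σ h ⁻¹ ∙ act σ h′}
                {act σ (h ⁻¹ ∙ h′)} (≋-sym ℭ (act-quotient σ h h′))
              (pow-quotient (λ {x} {y} → θ-resp χ {x} {y}) {act σ h} {c} {act σ h′}
                (θ-resp χ {(c ⁻¹ ∙ act σ h) ⁻¹} {act σ h ⁻¹ ∙ c} (quotient-⁻¹ c (act σ h))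
                    (Thick.symmetric thick-χ {c ⁻¹ ∙ act σ h} q)) q′)

        -- Large enough for both parts of `Apart`: exponent m for elements of the component, 2 for
        -- quotients of elements in a common cell.
        b : ℕ
        b = m + 2

        D : Pred Elt ℓ
        D = pow ⟦ χ ⟧ b

        D-resp : ∀ {x y} → x ≈ y → D x → D y
        D-resp {x} {y} = pow-resp (λ {x} {y} → θ-resp χ {x} {y}) b {x} {y}

        D-ε : D ε
        D-ε = pow-≤ (λ {x} {y} → θ-resp χ {x} {y}) (thick-ε thick-χ) {m = 0} {n = b} z≤n {ε} (≋-refl ℭ)

        Apart : Item → Item → Set ℓ
        Apart (σ , c) (τ , d) = D (act τ c) × D (act σ d)

        Far : Item → Set ℓ
        Far (σ , c) = ¬ pow ⟦ θ₂ ⟧ (m + (m + m)) (act σ c)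

        -- Of two neighbours (σ, g) and (τ, h) the automorphism τ is kept. It sends h⁻¹g far away,
        -- since τg is in the component while τh escapes. Automorphisms further down send both g and
        -- h into the component, and τ sends the quotients formed there into χ² by closeness.
        pairUp : ∀ n {l} → Thin l → length l ≡ n * 2 → ∃[ k ] AllPairs Apart k × All Far k × length k ≡ n ×
                 All (λ (σ , c) → Σ[ x ∈ Item ] Σ[ y ∈ Item ] x ∈ l × y ∈ l × σ ≡ proj₁ y × c ≡
                     proj₂ y ⁻¹ ∙ proj₂ x) k
        pairUp zero    _ _ = [] , [] , [] , refl , []
        pairUp (suc n) {(σ , g) ∷ (τ , h) ∷ l} (add (p ∷ ps) _ _ (add qs e cs t)) eq =
          let k , as , fs , len , origin = pairUp n t (ℕₚ.suc-injective (ℕₚ.suc-injective eq))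
          in (τ , h ⁻¹ ∙ g) ∷ k , All.map (λ {x} → apart {x}) origin ∷ as , far ∷ fs , cong suc len ,
             ((σ , g) , (τ , h) , here refl , there (here refl) , refl , refl) ∷
             All.map (λ (x , y , i , j , r , s) → x , y , there (there i) , there (there j) , r , s) origin
          where
          far : Far (τ , h ⁻¹ ∙ g)
          far q = e (θ₂⊆θ (act τ h) (left-factor (λ {x} {y} → θ-resp θ₂ {x} {y})
              (λ {x} → Thick.symmetric thick-θ₂ {x}) m (m + (m + m)) {act τ g} {act τ h}
            (component⊆ thick-θ₂ p)
            (pow-resp (λ {x} {y} → θ-resp θ₂ {x} {y}) (m + (m + m)) {act τ (h ⁻¹ ∙ g)} {act τ h ⁻¹ ∙ act τ g}
                (act-quotient τ h g) q)))
          apart : ∀ {x} → (Σ[ y ∈ Item ] Σ[ z ∈ Item ] y ∈ l × z ∈ l × proj₁ x ≡ proj₁ z × proj₂ x ≡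
              proj₂ z ⁻¹ ∙ proj₂ y) →
                  Apart (τ , h ⁻¹ ∙ g) x
          apart {υ , _} (y , z , i , j , refl , refl) =
            pow-≤ (λ {x} {y} → θ-resp χ {x} {y}) (thick-ε thick-χ) {m = m} {n = b} (ℕₚ.m≤m+n m 2)
                {act υ (h ⁻¹ ∙ g)} (component⊆ thick-χ
              (IsSubgroup.resp component-isSubgroup {act υ h ⁻¹ ∙ act υ g} {act υ (h ⁻¹ ∙ g)}
                  (≋-sym ℭ (act-quotient υ h g))
                (IsSubgroup.∙-closed component-isSubgroup {act υ h ⁻¹} {act υ g}
                  (IsSubgroup.⁻¹-closed component-isSubgroup {act υ h} (All.lookup qs j)) (All.lookup ps j)))) ,
            pow-≤ (λ {x} {y} → θ-resp χ {x} {y}) (thick-ε thick-χ) {m = 2} {n = b} (ℕₚ.m≤n+m 2 m)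
                {act τ (proj₂ z ⁻¹ ∙ proj₂ y)} (cs j i)

      ψ : Code
      ψ = formula (pow-def (code θ₂) m)

      ψ⇔ : ∀ g → pow ⟦ θ₂ ⟧ m g ⇔ ⟦ ψ ⟧ g
      ψ⇔ = defines (pow-def (code θ₂) m)

      -- The products c_I of the c_i with i ∈ I realize every pattern of the sets σ_i⁻¹(θ₂ᵐ).
      Shattered : List Item → Set ℓ
      Shattered l = ∀ i I → (¬ pow ⟦ θ₂ ⟧ m (act (proj₁ (lookup l i)) (subproduct proj₂ l I))) ⇔ I i ≡ true

      shattered : ∀ n → ∃[ l ] length l ≡ n × Shattered l
      -- A product over n items has at most n factors from χ^(m + 2) besides the distinguished one;
      -- with this χ such a product is absorbed into θ₂ᵐ.
      shattered n = build (shrink thick-θ₂ (n * (m + 2)))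
        where
        build : ∃[ χ ] Thick χ × (∀ g → pow ⟦ χ ⟧ (n * (m + 2)) g → pow ⟦ θ₂ ⟧ m g) → ∃[ l ] length l ≡ n ×
            Shattered l
        build (χ , thick-χ , χ⊆θ₂) = assemble (sequence (required (n * 2)))
          where
          open Thinning thick-χ
          pattern-of : ∀ l → AllPairs Apart l → All Far l → length l ≡ n → Shattered l
          pattern-of l as fs refl i I = mk⇔ (λ out → selected (I i) refl out) inside
            where
            σ : Aut₀
            σ = proj₁ (lookup l i)
            allBut : ∀ l → AllPairs Apart l → ∀ j → AllBut proj₂ {D} (λ {x} {y} → D-resp {x} {y}) D-ε
                (act (proj₁ (lookup l j))) (act-ε (proj₁ (lookup l j))) (act-∙ (proj₁ (lookup l j))) l j
            allBut (x ∷ l) (a ∷ as) zero    = All.map (λ (_ , d) → d) a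
            allBut (x ∷ l) (a ∷ as) (suc j) = proj₁ (All.lookup a (∈-lookup j)) , allBut l as j
            absorb : ∀ {g} → pow D (length l) g → pow ⟦ θ₂ ⟧ m g
            absorb {g} p = χ⊆θ₂ g (pow-pow (λ {x} {y} → θ-resp χ {x} {y}) b (length l) p)
            selected : ∀ c → I i ≡ c → ¬ pow ⟦ θ₂ ⟧ m (act σ (subproduct proj₂ l I)) → I i ≡ true
            selected true  e out = e
            selected false e out = ⊥-elim (out (absorb (subproduct-without proj₂ {D} (λ {x} {y} → D-resp {x} {y})
                D-ε (act σ) (act-ε σ) (act-∙ σ) l I i (allBut l as i) e)))
            inside : I i ≡ true → ¬ pow ⟦ θ₂ ⟧ m (act σ (subproduct proj₂ l I))
            inside e p =
              let u , v , q , r , eq = subproduct-with proj₂ {D} (λ {x} {y} → D-resp {x} {y}) D-ε (act σ) (act-ε σ) (act-∙ σ)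
                                        l I i (allBut l as i) e
              in All.lookup fs (∈-lookup i) (middle-factor (λ {x} {y} → θ-resp θ₂ {x} {y})
                  (λ {x} → Thick.symmetric thick-θ₂ {x}) m
                   {act σ (subproduct proj₂ l I)} {u} {act σ (proj₂ (lookup l i))} {v} eq (absorb q) (absorb r) p)
          assemble : (∃[ l ] AllPairs Later l × All Escapes l × length l ≡ required (n * 2)) → ∃[ l ] length l ≡
              n × Shattered l
          assemble (l , ps , es , e) =
            let k , t , len , _ = thin (n * 2) l ps es (ℕₚ.≤-reflexive (sym e))
                k′ , as , fs , len′ , _ = pairUp n t len
            in k′ , len′ , pattern-of k′ as fs len′

      contradiction : ⊥
      contradiction = nip (proj₁ (support-fin ψ) , λ i → sortOf (ar ⊕ W) (vs i)) arity (¬ᶠ rename ρ ψ₀) independent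
        where
        N₀ = proj₁ (support-fin ψ)
        vs : Fin N₀ → Var (ar ⊕ W)
        vs = proj₁ (proj₂ (support-fin ψ))
        ψ₀ = proj₁ (proj₂ (proj₂ (support-fin ψ)))
        Ps : Vars (Sort L)
        Ps = fin (N₀ , λ i → sortOf (ar ⊕ W) (vs i))
        place : Var Ps → Var (ar ⊕ W) → Var (Ps ⊕ ar)
        place i (inj₁ v) = inj₂ v
        place i (inj₂ _) = inj₁ i
        place-sort : ∀ i u → vs (lower i) ≡ u → sortOf (Ps ⊕ ar) (place i u) ≡ sortOf (ar ⊕ W) (vs (lower i))
        place-sort i (inj₁ v) e = cong (sortOf (ar ⊕ W)) (sym e)
        place-sort i (inj₂ v) e = refl
        ρ : Ren Ps (Ps ⊕ ar)
        ρ = ren (λ i → place i (vs (lower i))) (λ i → place-sort i (vs (lower i)) refl)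
        -- Slots of ψ₀ for coordinates of the group variable are not read; ε fills them.
        object : Aut₀ → Tuple ℭ Ps
        object (σ , _) = tuple λ i → at (proj₁ ε ⋈ Automorphism.apply (σ ⁻¹ᴬ) w) (vs (lower i))
        placed : ∀ σ (g : Elt) i u (e : vs (lower i) ≡ u) →
                 Eq ℭ (at (proj₁ g ⋈ Automorphism.apply (proj₁ σ ⁻¹ᴬ) w) (vs (lower i)))
                      (subst ∥ ℭ ∥ (place-sort i u e) (at (object σ ⋈ proj₁ g) (place i u)))
        placed σ g i (inj₂ v) e = moved (vs (lower i)) e
          where
          moved : ∀ u → u ≡ inj₂ v → Eq ℭ (at (proj₁ g ⋈ Automorphism.apply (proj₁ σ ⁻¹ᴬ) w) u)
              (at (proj₁ ε ⋈ Automorphism.apply (proj₁ σ ⁻¹ᴬ) w) u)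
          moved _ refl = Setoid.refl (carrier ℭ _)
        placed σ g i (inj₁ v) e = moved (vs (lower i)) e
          where
          moved : ∀ u (e : u ≡ inj₁ v) → Eq ℭ (at (proj₁ g ⋈ Automorphism.apply (proj₁ σ ⁻¹ᴬ) w) u)
                                              (subst ∥ ℭ ∥ (cong (sortOf (ar ⊕ W)) (sym e)) (at (proj₁ g) v))
          moved _ refl = Setoid.refl (carrier ℭ _)
        -- Applying σ turns ψ(g, σ⁻¹w) into ψ(σg, w). Thus all conjugates come from one formula,
        -- with `object σ` supplying the moved parameters.
        evaluate : ∀ σ g → ℭ ⊨ rename ρ ψ₀ [ object σ ⋈ proj₁ g ] ⇔ pow ⟦ θ₂ ⟧ m (act σ g)
        evaluate σ g =
          ⊨-rename ℭ ρ ψ₀ _ ⇔∘ ⇔-sym (⊨-resp⇔ ℭ ψ₀ λ i → placed σ g i (vs (lower i)) refl) ⇔∘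
          ⇔-sym (proj₂ (proj₂ (proj₂ (support-fin ψ))) ℭ (proj₁ g ⋈ Automorphism.apply (proj₁ σ ⁻¹ᴬ) w)) ⇔∘
          ⊨-apply (proj₁ σ) ψ (proj₁ g ⋈ Automorphism.apply (proj₁ σ ⁻¹ᴬ) w) ⇔∘
          ⊨-resp⇔ ℭ ψ (λ { (inj₁ v) → Setoid.refl (carrier ℭ _) ; (inj₂ v) →
              apply-⁻¹ʳ {M = ℭ} (proj₁ σ) {V = W} w v }) ⇔∘ ⇔-sym (ψ⇔ (act σ g))
        independent : IndependenceProperty ℭ _ arity (¬ᶠ rename ρ ψ₀)
        independent n = from-list (shattered n)
          where
          from-list : (∃[ l ] length l ≡ n × Shattered l) →
                      Σ[ a ∈ (Fin n → Tuple ℭ Ps) ] Σ[ b ∈ ((Fin n → Bool) → Tuple ℭ ar) ]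
                      (∀ i I → ℭ ⊨ ¬ᶠ rename ρ ψ₀ [ a i ⋈ b I ] ⇔ I i ≡ true)
          from-list (l , refl , sh) = (λ i → object (proj₁ (lookup l i))) , (λ I → proj₁ (subproduct proj₂ l I)) ,
            λ i I → let e = evaluate (proj₁ (lookup l i)) (subproduct proj₂ l I)
                    in mk⇔ (λ h p → lower (h (from e p))) (λ n h → lift (n (to e h))) ⇔∘ sh i I

    finite-conjugates : ∀ {θ} → Thick θ → ∃[ l ] (∀ g → All (λ τ → Component (act τ g)) l → ∀ σ →
        pow ⟦ θ ⟧ m (act σ g))
    finite-conjugates {θ} t = dne λ none → Independence.contradiction t λ l → dne λ no-item →
      none (l , λ g cs σ → dne λ np → no-item ((σ , g) , cs , np))

    Intersection : Pred Elt ℓ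
    Intersection g = ∀ σ → Component (act σ g)

    open IsSubgroup component-isSubgroup hiding (resp)

    resp-C : ∀ {x y} → x ≈ y → Component x → Component y
    resp-C {x} {y} = IsSubgroup.resp component-isSubgroup {x} {y}

    intersection-isSubgroup : IsSubgroup group Intersection
    intersection-isSubgroup = record
      { resp      = λ {x} {y} e h σ → resp-C {act σ x} {act σ y} (act-cong σ {x} {y} e) (h σ)
      ; ε-closed  = λ σ → resp-C {ε} {act σ ε} (≋-sym ℭ (act-ε σ)) ε-closed
      ; ∙-closed  = λ {x} {y} h k σ → resp-C {act σ x ∙ act σ y} {act σ (x ∙ y)} (≋-sym ℭ (act-∙ σ x y))
          (∙-closed {act σ x} {act σ y} (h σ) (k σ))
      ; ⁻¹-closed = λ {x} h σ → resp-C {act σ x ⁻¹} {act σ (x ⁻¹)} (≋-sym ℭ (act-⁻¹ σ x)) (⁻¹-closed {act σ x} (h σ))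
      }

    intersection-invariant : ∀ {g h} → Base.Similar g h → Intersection g → Intersection h
    intersection-invariant {g} {h} s k (τ , fτ) =
      resp-C {act composite g} {act (τ , fτ) h} (apply-cong τ (proj₂ (proj₂ conj))) (k composite)
      where
      conj : Σ[ σ ∈ Automorphism ℭ ] Automorphism.apply σ w₀ ≋ w₀ × Automorphism.apply σ (proj₁ g) ≋ proj₁ h
      conj = Base.similar⇒conjugate {g} {h} s
      composite : Aut₀
      composite = τ ∘ᴬ proj₁ conj , ≋-trans ℭ (apply-cong τ (proj₁ (proj₂ conj))) fτ

    private
      Coset : Set ℓ
      Coset = Representative (cosets group Component component-isSubgroup)

      small-Coset : Small Coset
      small-Coset = small-↣ coset-cells (small-2^ (small-× small-Code small-ℕ))

      nth : List Aut₀ → ℕ → Aut₀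
      nth []      _       = id₀
      nth (x ∷ l) zero    = x
      nth (x ∷ l) (suc n) = nth l n

      nth-all : ∀ {p} {P : Pred Aut₀ p} l → (∀ n → P (nth l n)) → All P l
      nth-all []      h = []
      nth-all (x ∷ l) h = h 0 ∷ nth-all l (h ∘ suc)

      conjugates : Code → List Aut₀
      conjugates θ with dec (Thick θ)
      ... | yes t = proj₁ (finite-conjugates t)
      ... | no _  = []

      conjugates-suffice : ∀ {θ} → Thick θ → ∀ g → All (λ τ → Component (act τ g)) (conjugates θ) → ∀ σ →
          pow ⟦ θ ⟧ m (act σ g)
      conjugates-suffice {θ} t with dec (Thick θ)
      ... | yes t′ = proj₂ (finite-conjugates t′)
      ... | no n   = ⊥-elim (n t)

      coset-of : Elt → Coset
      coset-of = represent (cosets group Component component-isSubgroup)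

    -- There may be a large number of automorphisms, so for each θ only the finitely many conjugates
    -- chosen by `finite-conjugates` are recorded. If x and y agree there, every σ sends x⁻¹y into
    -- θᵐ for all thick θ, hence into the component.
    intersection-index : cosets group Intersection intersection-isSubgroup ≤ᶜ setoid (Code × Lift ℓ ℕ → Coset)
    intersection-index = record
      { to        = λ x (θ , lift n) → coset-of (act (nth (conjugates θ) n) x)
      ; cong      = λ {x} {y} h → extensionality λ (θ , lift n) → let σ = nth (conjugates θ) n in
          Injection.cong (≤Rep (cosets group Component component-isSubgroup)) {act σ x} {act σ y}
            (resp-C {act σ (x ⁻¹ ∙ y)} {act σ x ⁻¹ ∙ act σ y} (act-quotient σ x y) (h σ))
      ; injective = λ {x} {y} e σ → m , pow-core m {act σ (x ⁻¹ ∙ y)} λ θ t → conjugates-suffice t (x ⁻¹ ∙ y)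
          (nth-all (conjugates θ) λ n → let τ = nth (conjugates θ) n in
            resp-C {act τ x ⁻¹ ∙ act τ y} {act τ (x ⁻¹ ∙ y)} (≋-sym ℭ (act-quotient τ x y))
              (Injection.injective (≤Rep (cosets group Component component-isSubgroup)) {act τ x} {act τ y}
                (cong (λ f → f (θ , lift n)) e))) σ
      }

    component-stable : BaseIndex.Component ⊆ Component
    component-stable {g} (n , p) = pow⊆ component-isSubgroup core⊆component n p
      where
      core⊆component : Base.Core ⊆ Component
      core⊆component {x} c = resp-C {act id₀ x} {x} (≋-refl ℭ) (Base.core⊆ Intersection intersection-isSubgroup
        (λ {g} {h} → intersection-invariant {g} {h}) intersection-index
            (small-→ (small-× small-Code small-ℕ) small-Coset) {x} c id₀)

-- The components

module BoundedComponents (cl : Classical) {ℓ} {L : Signature ℓ} {T : Theory L} (hereditary : HereditarilyGCompact T)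
                         {κ : Cardinal ℓ} {ℭ : Structure L} (monster : IsMonster T κ ℭ) (G : GroupIn ℭ) where
  open Choice cl
  open Cardinality cl
  open Compactness cl monster
  open GroupIn G
  open GroupOver cl monster G
  open Components T κ ℭ G
  open Powers group

  module At (P : Parameters) where
    open Parameters P public
    open DefinableSets cl monster G P public
    open ThickSets cl monster G P public
    open Index cl monster G P public

    bounded : ∃[ m ] (∀ {g} → Component g → pow Core m g)
    bounded = LascarDistance.component-bounded cl monster G P
      (hereditary ℭ (IsMonster.isModel monster) torsorSig N interpretation)
      where open TorsorStructure cl monster G P

    power : Code → Code
    power θ = formula (pow-def (code θ) (proj₁ bounded))
      where open Definability cl ℭ

    component⇔ : ∀ g → Component g ⇔ (∀ θ → Thick θ → ⟦ power θ ⟧ g)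
    component⇔ g = mk⇔ (λ c θ t → to (defines (pow-def (code θ) m) g) (pow-mono m (λ k → k θ t) (proj₂ bounded c)))
                       (λ h → m , pow-core m {g} λ θ t → from (defines (pow-def (code θ) m) g) (h θ t))
      where
      open Definability cl ℭ
      m = proj₁ bounded

    component-invariant : (σ : Automorphism ℭ) → Automorphism.apply σ w ≋ w → ∀ {g h} →
                          Automorphism.apply σ (proj₁ g) ≋ proj₁ h → Component g → Component h
    component-invariant σ fixes {g} {h} e c = from (component⇔ h) λ θ t →
      code-resp (power θ) {Action.act σ fixes g} {h} e
        (to (Action.act-invariant σ fixes (code (power θ)) g) (to (component⇔ g) c θ t))

    component⊆ : (H : Pred Elt ℓ) (isSub : IsSubgroup group H) →
                 ((σ : Automorphism ℭ) → Automorphism.apply σ w ≋ w → ∀ {g h} →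
                  Automorphism.apply σ (proj₁ g) ≋ proj₁ h → H g → H h) →
                 ∀ {Z} → cosets group H isSub ≤ᶜ setoid Z → Small Z → Component ⊆ H
    component⊆ H isSub invariant f small-Z {g} (n , p) = pow⊆ isSub
      (λ {x} → core⊆ H isSub (λ {g} {h} s k → let σ , fixes , e = similar⇒conjugate {g} {h} s
                                               in invariant σ fixes {g} {h} e k) f small-Z {x}) n {g} p

    small-cells : Small (Code × Lift ℓ ℕ → Bool)
    small-cells = small-2^ (small-× small-Code small-ℕ)

    component-index : cosets group Component component-isSubgroup ≤ᶜ setoid (Code × Lift ℓ ℕ → Bool)
    component-index = ≤ᶜ-trans {X = S} {setoid (Representative S)} {setoid (Code × Lift ℓ ℕ → Bool)} (≤Rep S)
        coset-cells
      where S = cosets group Component component-isSubgroup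

  module OverSet (A : Subset ℭ) (small-A : ∣ ℭ ∋ A ∣ <ᶜ κ) (definable : DefinableOver G A) where
    open Parameter cl T ℭ A
    open Definability cl ℭ

    private
      module C s = Setoid (carrier ℭ s)
      module D = DefinableOver definable

      A∣ : Cardinal ℓ
      A∣ = ∣ ℭ ∋ A ∣

      sorts : ∀ {x y} → EqElement ℭ x y → proj₁ x ≡ proj₁ y
      sorts (same _) = refl

      values : ∀ {x y} (e : EqElement ℭ x y) → Eq ℭ (proj₂ y) (subst ∥ ℭ ∥ (sorts e) (proj₂ x))
      values (same p) = C.sym _ p

      toRep : ∀ {U : Vars (Sort L)} → Ren (U ⊕ params ℭ A) (U ⊕ repVars)
      toRep = ren (λ { (inj₁ v) → inj₁ v ; (inj₂ c) → inj₂ (represent A∣ c) })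
                  (λ { (inj₁ v) → refl ; (inj₂ c) → sorts (rep-≈ A∣ c) })

      toRep⇔ : ∀ {U} (φ : FormulaOver ℭ A U) x → Holds ℭ A φ x ⇔ ℭ ⊨ rename toRep φ [ x ⋈ repTuple ]
      toRep⇔ φ x = ⊨-resp⇔ ℭ φ (λ { (inj₁ v) → C.refl _ ; (inj₂ c) → values (rep-≈ A∣ c) }) ⇔∘
          ⇔-sym (⊨-rename ℭ toRep φ _)

      fromRep : ∀ {U : Vars (Sort L)} → Ren (U ⊕ repVars) (U ⊕ params ℭ A)
      fromRep = ren (λ { (inj₁ v) → inj₁ v ; (inj₂ (c , _)) → inj₂ c }) (λ { (inj₁ v) → refl ; (inj₂ c) → refl })

      fromRep⇔ : ∀ {U} (φ : Formula L (U ⊕ repVars)) x → ℭ ⊨ φ [ x ⋈ repTuple ] ⇔ Holds ℭ A (rename fromRep φ) x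
      fromRep⇔ φ x = ⊨-resp⇔ ℭ φ (λ { (inj₁ v) → C.refl _ ; (inj₂ c) → C.refl _ }) ⇔∘ ⇔-sym (⊨-rename ℭ fromRep φ _)

      fixes-A : (σ : Automorphism ℭ) → Automorphism.apply σ repTuple ≋ repTuple → Automorphism.Fixes σ A
      fixes-A σ f c = go (rep-≈ A∣ c) (f (represent A∣ c))
        where
        go : ∀ {x y} → EqElement ℭ x y → Eq ℭ (Inverse.to (Automorphism.bijection σ _) (proj₂ x)) (proj₂ x) →
             Eq ℭ (Inverse.to (Automorphism.bijection σ _) (proj₂ y)) (proj₂ y)
        go (same p) q = C.trans _ (Inverse.to-cong (Automorphism.bijection σ _) (C.sym _ p)) (C.trans _ q p)

    parameters : Parameters
    parameters = record
      { w       = repTuple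
      ; small-W = ≤<-trans {X = setoid (Representative A∣)} {A∣} {κ} (Rep≤ A∣) small-A
      ; member  = cut (rename toRep D.member) λ x → ⇔-sym (D.member-defines x) ⇔∘ toRep⇔ D.member x
      ; product = cut (rename toRep D.product) λ ((g , h) , k) →
          ⇔-sym (D.product-defines g h k) ⇔∘ toRep⇔ D.product (proj₁ g ⋈ proj₁ h ⋈ proj₁ k)
      }

    open At parameters

    small-subsets : Small (Representative (2^ Symbols))
    small-subsets = ≤<-trans {X = setoid (Representative (2^ Symbols))} {2^ Symbols} {κ} (Rep≤ (2^ Symbols))
      (IsMonster.strongLimit monster Symbols (≤<-trans {X = Symbols} {setoid X} {κ} embed
        (small-⊎ (IsMonster.∣T∣<κ monster) (Parameters.small-W parameters))))
      where
      X : Set ℓ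
      X = Setoid.Carrier ∣ T ∣ᵀ ⊎ Representative A∣
      embed : Symbols ≤ᶜ setoid X
      embed = record
        { to        = [ inj₁ , inj₂ ∘ represent A∣ ]′
        ; cong      = λ { (Pointwise.inj₁ refl) → refl ; (Pointwise.inj₂ e) → cong inj₂ (Injection.cong (≤Rep A∣) e) }
        ; injective = λ { {inj₁ _} {inj₁ _} refl → Pointwise.inj₁ refl ; {inj₁ _} {inj₂ _} () ; {inj₂ _} {inj₁ _} ()
                        ; {inj₂ _} {inj₂ _} e → Pointwise.inj₂ (Injection.injective (≤Rep A∣) (inj₂-injective e)) }
        }

    small-index : SmallIndex A Component component-isSubgroup
    small-index = ≤ᶜ-trans {X = S} {setoid (Code × Lift ℓ ℕ → Bool)} {2^ Symbols} component-index
      (≤ᶜ-trans {X = setoid (Code × Lift ℓ ℕ → Bool)} {setoid (Representative Symbols → Bool)} {2^ Symbols}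
        (preimage formulas×ℕ) subsets≤)
      where S = cosets group Component component-isSubgroup

    invariant : Invariant A Component
    invariant σ f g h = component-invariant σ (λ (c , _) → f c) {g} {h}

    smallest : ∀ H (isSub : IsSubgroup group H) → SmallIndex A H isSub → Invariant A H → Component ⊆ H
    smallest H isSub f inv = component⊆ H isSub (λ σ fixes {g} {h} → inv σ (fixes-A σ fixes) g h)
      (≤ᶜ-trans {X = cosets group H isSub} {2^ Symbols} {setoid (Representative (2^ Symbols))} f
          (≤Rep (2^ Symbols))) small-subsets

    typeDefinable : TypeDefinable A Component
    typeDefinable = (λ φ → ∃[ θ ] Thick θ × φ ≡ rename fromRep (power θ)) , λ g → component⇔ g ⇔∘
      mk⇔ (λ { h φ (θ , t , refl) → to (fromRep⇔ (power θ) (proj₁ g)) (h θ t) })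
          (λ h θ t → from (fromRep⇔ (power θ) (proj₁ g)) (h _ (θ , t , refl)))

    typeDefinable⇒invariant : ∀ {H} → TypeDefinable A H → Invariant A H
    typeDefinable⇒invariant (p , e) σ f g h q k = from (e h) λ φ pφ →
      ⊨-resp ℭ φ (λ { (inj₁ v) → q v ; (inj₂ c) → f c }) (to (⊨-apply σ φ (proj₁ g ⋈ enum ℭ A)) (to (e g) k φ pφ))

    isG⁰⁰⁰ : IsG⁰⁰⁰[ A ] Component
    isG⁰⁰⁰ = record { isSubgroup = component-isSubgroup ; smallIndex = small-index ; property =
        invariant ; smallest = smallest }

    isG⁰⁰ : IsG⁰⁰[ A ] Component
    isG⁰⁰ = record { isSubgroup = component-isSubgroup ; smallIndex = small-index ; property = typeDefinable
                   ; smallest = λ H isSub f t → smallest H isSub f (typeDefinable⇒invariant t) }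

  -- Components over different sets coincide only up to `≐`, whereas the conclusion asks for one
  -- predicate that works over all sets.
  transfer : ∀ {q A} {Q : Pred (Pred Elt ℓ) q} {H K : Pred Elt ℓ} → H ≐ K → (Q H → Q K) →
             IsSmallestSubgroup A Q H → IsSmallestSubgroup A Q K
  transfer {H = H} {K} (i , j) f s = record
    { isSubgroup = isSubgroup-K ; smallIndex = smallIndex-K ; property = f property
    ; smallest = λ M isSub g q → smallest M isSub g q ∘ j }
    where
    open IsSmallestSubgroup s
    module S = IsSubgroup isSubgroup
    isSubgroup-K : IsSubgroup group K
    isSubgroup-K = record
      { resp = λ e k → i (S.resp e (j k)) ; ε-closed = i S.ε-closed
      ; ∙-closed = λ k l → i (S.∙-closed (j k) (j l)) ; ⁻¹-closed = λ k → i (S.⁻¹-closed (j k)) }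
    smallIndex-K : SmallIndex _ K isSubgroup-K
    smallIndex-K = record
      { to = Injection.to smallIndex ; cong = λ k → Injection.cong smallIndex (j k) ; injective = λ e →
          i (Injection.injective smallIndex e) }

  module _ (nip : NIP T) {A B : Subset ℭ} (small-A : ∣ ℭ ∋ A ∣ <ᶜ κ) (small-B : ∣ ℭ ∋ B ∣ <ᶜ κ)
           (definable-A : DefinableOver G A) (definable-B : DefinableOver G B) where

    private
      module A = OverSet A small-A definable-A
      module B = OverSet B small-B definable-B
      module PA = At A.parameters
      module PB = At B.parameters
      module AB = NipComponents cl monster G A.parameters (Parameters.w B.parameters)
          (Parameters.small-W B.parameters)
      module PAB = At AB.extended

    -- The component over A lies in the one over A and B together by `component-stable`, where NIP
    -- enters; that one lies in the component over B, which is invariant over the larger set and has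
    -- small index.
    component-⊆ : PA.Component ⊆ PB.Component
    component-⊆ {g} c = PAB.component⊆ PB.Component PB.component-isSubgroup
      (λ σ fixes {g} {h} → PB.component-invariant σ (λ v → fixes (inj₂ v)) {g} {h}) PB.component-index
          PB.small-cells {g}
      (AB.Bounded.component-stable (proj₁ PAB.bounded) (proj₂ PAB.bounded) (nip ℭ (IsMonster.isModel monster)) {g} c)

proposition2p12 : Classical →
    ∀ {ℓ} {L : Signature ℓ} (T : Theory L) → Complete T → HereditarilyGCompact T →
    (κ : Cardinal ℓ) (ℭ : Structure L) → IsMonster T κ ℭ →
    (A : Subset ℭ) → ∣ ℭ ∋ A ∣ <ᶜ κ →
    (G : GroupIn ℭ) → DefinableOver G A →
    let open Components T κ ℭ G in
    (∃[ H ] ∃[ K ] IsG⁰⁰[ A ] H × IsG⁰⁰⁰[ A ] K × H ≐ K) ×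
    (NIP T → ∃[ H ] ∃[ K ] IsG⁰⁰ H × IsG⁰⁰⁰ K × H ≐ K)
proposition2p12 cl T _ hereditary κ ℭ monster A small-A G definable =
    (_ , _ , OverSet.isG⁰⁰ A small-A definable , OverSet.isG⁰⁰⁰ A small-A definable , id , id) ,
    -- The component over the given `A` is the common witness; each other set `B` is reduced to it
    -- by `equal`.
    λ nip → _ , _ ,
      (λ B small-B definable-B → transfer (equal nip B small-B definable-B)
          (typeDefinable-≐ (equal nip B small-B definable-B))
        (OverSet.isG⁰⁰ B small-B definable-B)) ,
      (λ B small-B definable-B → transfer (equal nip B small-B definable-B)
          (invariant-≐ (equal nip B small-B definable-B))
        (OverSet.isG⁰⁰⁰ B small-B definable-B)) ,
      id , id
  where
  open BoundedComponents cl hereditary monster G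
  open Components T κ ℭ G

  component-over : (B : Subset ℭ) → ∣ ℭ ∋ B ∣ <ᶜ κ → DefinableOver G B → Pred (GroupIn.Elt G) _
  component-over B small-B definable-B = At.Component (OverSet.parameters B small-B definable-B)

  equal : NIP T → ∀ B small-B definable-B → component-over B small-B definable-B ≐ component-over A small-A definable
  equal nip B small-B definable-B =
    component-⊆ nip small-B small-A definable-B definable , component-⊆ nip small-A small-B definable definable-B

  typeDefinable-≐ : ∀ {B H K} → H ≐ K → TypeDefinable B H → TypeDefinable B K
  typeDefinable-≐ (i , j) (p , e) = p , λ g → mk⇔ (to (e g) ∘ j) (i ∘ from (e g))

  invariant-≐ : ∀ {B H K} → H ≐ K → Invariant B H → Invariant B K
  invariant-≐ (i , j) inv σ f g h e = i ∘ inv σ f g h e ∘ j
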